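{- Let $M_1,M_2$ be matroids of positive rank on disjoint ground sets $S_1,S_2$, such that no matroid isomorphic to $M_1$ can be obtained from $M_2$ by any combination of taking minors, free extensions and free coextensions, and no matroid isomorphic to $M_2$ can be obtained from $M_1$ in this way. For $i\in\{1,2\}$ fix a set $S'_i$ with $FI(M_i)\subseteq S'_i\subseteq S_i-FI(M_i^*)$. Let $k\ge 4\max\{|S_1|,|S_2|\}$ be an integer and let $T_1,T_2$ be sets with $|T_1|=k-r(M_1)-|S'_2|$ and $|T_2|=k-r(M_2)-|S'_1|$ such that $T_1,T_2,S_1\cup S_2$ are pairwise disjoint. Then the matroid $M=M_k(M_1,S'_1,T_1;M_2,S'_2,T_2)$ is an intertwine of $M_1$ and $M_2$.
   Context: All matroids are finite. A cyclic flat is a flat that is a (possibly empty) union of circuits; for a matroid $N$, $\mathcal{Z}'(N)$ denotes its set of nonempty proper cyclic flats, and $\eta_N(Y)=|Y|-r_N(Y)$ is the nullity. The free extension $N+x$ by a new element $x$ has as circuits those of $N$ together with $B\cup x$ for bases $B$ of $N$; the free coextension is $N\times x=(N^*+x)^*$. $FI(N)$ is the set of elements of $N$ lying in no proper cyclic flat of $N$ (the free elements and isthmuses of $N$); thus $FI(N^*)$ is the intersection of all nonempty cyclic flats of $N$ (the cofree elements and loops). A matroid $M$ is an intertwine of $N_1$ and $N_2$ if $M$ has minors isomorphic to $N_1$ and to $N_2$, but no proper minor of $M$ has both. Construction $M_k(N_1,A_1,U_1;N_2,A_2,U_2)$: let $N_1,N_2$ be matroids of positive rank on disjoint ground sets $R_1,R_2$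 with rank functions $\rho_1,\rho_2$; let $A_1\subseteq R_1$, $A_2\subseteq R_2$; let $k$ be an integer with $k\ge r(N_1)+\eta_{N_1}(A_1)+r(N_2)+\eta_{N_2}(A_2)$; and let $U_1,U_2$ be sets with $|U_1|=k-r(N_1)-|A_2|$, $|U_2|=k-r(N_2)-|A_1|$, such that $U_1,U_2,R_1\cup R_2$ are pairwise disjoint. Let $E=R_1\cup R_2\cup U_1\cup U_2$. Then $M_k(N_1,A_1,U_1;N_2,A_2,U_2)$ is the (existing and unique) matroid on $E$ whose cyclic flats are exactly: $\emptyset$, of rank $0$; $E$, of rank $k$; the sets $F\cup U_1\cup A_2$ for $F\in\mathcal{Z}'(N_1)$, of rank $\rho_1(F)+|U_1|+|A_2|$; and the sets $F\cup U_2\cup A_1$ for $F\in\mathcal{Z}'(N_2)$, of rank $\rho_2(F)+|U_2|+|A_1|$. -}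

module Defs where

open import Data.Nat using (ℕ; zero; suc; _+_; _∸_; _≤_; _<_; _⊓_)
open import Data.Bool using (if_then_else_)
open import Data.Fin using (Fin)
open import Data.Vec using (lookup)
open import Data.Fin.Subset
  using (Subset; _∈_; _∉_; _⊆_; _∩_; _∪_; _─_; ⁅_⁆; ∣_∣; Nonempty; Empty)
  renaming (⊥ to ∅)
open import Data.Product using (Σ; ∃; _×_; _,_; proj₁)
open import Data.Sum using (_⊎_)
open import Relation.Nullary using (¬_)
open import Relation.Binary.PropositionalEquality using (_≡_; _≢_)
open import Function.Bundles using (_↔_; _⇔_; Inverse)

-- Matroids.  All sets live inside a finite universe Fin n; a (raw)
-- matroid in the universe Fin n is a ground set E ⊆ Fin n together with
-- a rank function.  Only the values of r on subsets of E are meaningful.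

record Matroid (n : ℕ) : Set where
  constructor mat
  field
    E : Subset n
    r : Subset n → ℕ
open Matroid public

record IsMatroid {n : ℕ} (M : Matroid n) : Set where
  field
    R1 : ∀ X → X ⊆ E M → r M X ≤ ∣ X ∣
    R2 : ∀ X Y → X ⊆ E M → Y ⊆ E M → X ⊆ Y → r M X ≤ r M Y
    R3 : ∀ X Y → X ⊆ E M → Y ⊆ E M →
         r M (X ∪ Y) + r M (X ∩ Y) ≤ r M X + r M Y

rk : ∀ {n} → Matroid n → ℕ
rk M = r M (E M)

η : ∀ {n} → Matroid n → Subset n → ℕ
η M Y = ∣ Y ∣ ∸ r M Y

Disjoint : ∀ {n} → Subset n → Subset n → Set
Disjoint A B = Empty (A ∩ B)

Circuit : ∀ {n} → Matroid n → Subset n → Set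
Circuit M C = C ⊆ E M × r M C < ∣ C ∣ ×
              (∀ Y → Y ⊆ C → Y ≢ C → r M Y ≡ ∣ Y ∣)

Cyclic : ∀ {n} → Matroid n → Subset n → Set
Cyclic M X = ∀ e → e ∈ X → ∃ λ C → Circuit M C × e ∈ C × C ⊆ X

Flat : ∀ {n} → Matroid n → Subset n → Set
Flat M X = X ⊆ E M × (∀ e → e ∈ E M → e ∉ X → r M X < r M (X ∪ ⁅ e ⁆))

CyclicFlat : ∀ {n} → Matroid n → Subset n → Set
CyclicFlat M X = Flat M X × Cyclic M X

Z' : ∀ {n} → Matroid n → Subset n → Set
Z' M F = CyclicFlat M F × Nonempty F × F ≢ E M

dual : ∀ {n} → Matroid n → Matroid n
dual M = mat (E M) (λ X → ∣ X ∩ E M ∣ + r M (E M ─ X) ∸ r M (E M))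

freeExt : ∀ {n} → Matroid n → Fin n → Matroid n
freeExt N x = mat (E N ∪ ⁅ x ⁆)
  (λ X → if lookup X x
         then suc (r N (X ∩ E N)) ⊓ r N (E N)
         else r N (X ∩ E N))

freeCoext : ∀ {n} → Matroid n → Fin n → Matroid n
freeCoext N x = dual (freeExt (dual N) x)

minor : ∀ {n} → Matroid n → Subset n → Subset n → Matroid n
minor M C D = mat E' (λ X → r M ((X ∩ E') ∪ C) ∸ r M C)
  where E' = (E M ─ C) ─ D

ValidMinor : ∀ {n} → Matroid n → Subset n → Subset n → Set
ValidMinor M C D = C ⊆ E M × D ⊆ E M × Disjoint C D

Ground : ∀ {n} → Matroid n → Set
Ground M = Σ (Fin _) (λ x → x ∈ E M)

Iso : ∀ {m n} → Matroid m → Matroid n → Set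
Iso A B = Σ (Ground A ↔ Ground B) λ φ →
  ∀ X Y → X ⊆ E A → Y ⊆ E B →
  (∀ x (p : x ∈ E A) → (x ∈ X ⇔ proj₁ (Inverse.to φ (x , p)) ∈ Y)) →
  r A X ≡ r B Y

HasMinor : ∀ {m n} → Matroid m → Matroid n → Set
HasMinor M N = ∃ λ C → ∃ λ D → ValidMinor M C D × Iso N (minor M C D)

Intertwine : ∀ {m n₁ n₂} → Matroid m → Matroid n₁ → Matroid n₂ → Set
Intertwine M N₁ N₂ =
  HasMinor M N₁ × HasMinor M N₂ ×
  (∀ C D → ValidMinor M C D → Nonempty (C ∪ D) →
     ¬ (HasMinor (minor M C D) N₁ × HasMinor (minor M C D) N₂))

data Reach : ∀ {m n} → Matroid m → Matroid n → Set where
  iso    : ∀ {m n} {A : Matroid m} {B : Matroid n} → Iso A B → Reach A B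
  minorR : ∀ {n} {A : Matroid n} C D → ValidMinor A C D → Reach A (minor A C D)
  extR   : ∀ {n} {A : Matroid n} x → x ∉ E A → Reach A (freeExt A x)
  coextR : ∀ {n} {A : Matroid n} x → x ∉ E A → Reach A (freeCoext A x)
  transR : ∀ {m n p} {A : Matroid m} {B : Matroid n} {C : Matroid p} →
           Reach A B → Reach B C → Reach A C

FI : ∀ {n} → Matroid n → Fin n → Set
FI N e = e ∈ E N × (∀ F → CyclicFlat N F → F ≢ E N → e ∉ F)

record IsMk {n : ℕ} (k : ℕ) (N₁ : Matroid n) (A₁ U₁ : Subset n)
            (N₂ : Matroid n) (A₂ U₂ : Subset n) (M : Matroid n) : Set where
  field
    N₁-matroid : IsMatroid N₁
    N₂-matroid : IsMatroid N₂
    N₁-pos : 0 < rk N₁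
    N₂-pos : 0 < rk N₂
    R-disj : Disjoint (E N₁) (E N₂)
    A₁⊆R₁ : A₁ ⊆ E N₁
    A₂⊆R₂ : A₂ ⊆ E N₂
    k-big : rk N₁ + η N₁ A₁ + rk N₂ + η N₂ A₂ ≤ k
    U₁-size : ∣ U₁ ∣ + rk N₁ + ∣ A₂ ∣ ≡ k
    U₂-size : ∣ U₂ ∣ + rk N₂ + ∣ A₁ ∣ ≡ k
    U₁U₂-disj : Disjoint U₁ U₂
    U₁R-disj : Disjoint U₁ (E N₁ ∪ E N₂)
    U₂R-disj : Disjoint U₂ (E N₁ ∪ E N₂)
    M-matroid : IsMatroid M
    ground : E M ≡ E N₁ ∪ E N₂ ∪ U₁ ∪ U₂
    cyclicFlats : ∀ Z → CyclicFlat M Z ⇔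
      (Z ≡ ∅ ⊎ Z ≡ E M ⊎
       (∃ λ F → Z' N₁ F × Z ≡ F ∪ U₁ ∪ A₂) ⊎
       (∃ λ F → Z' N₂ F × Z ≡ F ∪ U₂ ∪ A₁))
    rank-∅ : r M ∅ ≡ 0
    rank-E : r M (E M) ≡ k
    rank-1 : ∀ F → Z' N₁ F → r M (F ∪ U₁ ∪ A₂) ≡ r N₁ F + ∣ U₁ ∣ + ∣ A₂ ∣
    rank-2 : ∀ F → Z' N₂ F → r M (F ∪ U₂ ∪ A₁) ≡ r N₂ F + ∣ U₂ ∣ + ∣ A₁ ∣

-- With rank functions ρᵢ on Rᵢ = E Nᵢ and B₁ = U₁ ∪ A₂, B₂ = U₂ ∪ A₁, the
-- rank of X in Mₖ is the least of |X|, k and the two numbers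
-- fᵢ(X) = ρᵢ(X ∩ Rᵢ) + |Bᵢ| + |X − (Rᵢ ∪ Bᵢ)|.  Let M/C∖D ≅ N₁ with C independent
-- and D coindependent.  Since k is large, f₁ or f₂ is at least k on all sets
-- containing C.  If it is f₁, then M/C∖D is also a minor of the matroid with rank
-- min(|X|, k, f₂(X)), the iterated free coextension of N₂ by B₂ followed by free
-- extensions, so N₁ arises from N₂ by the excluded operations.  If it is f₂, send a
-- nonempty proper cyclic flat Z of M/C∖D to the cyclic part of the N₁-closure of
-- (Z ∪ C) ∩ R₁.  Composed with the isomorphism this is an injective self-map of
-- the nonempty proper cyclic flats of N₁ along which the rank never grows and the
-- nullity never drops; as the set is finite both are constant, which forces
-- C ⊆ B₁ ∪ FI(N₁*) and D ⊆ (E − R₁ − B₁) ∪ FI(N₁).  Because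
-- FI(Nᵢ) ⊆ Aᵢ ⊆ Rᵢ − FI(Nᵢ*), the sets so allowed for N₁ and for N₂ are disjoint,
-- hence no element can be contracted, or deleted, for both minors.

module Submission where

open import Defs
open import Data.Nat using (ℕ; zero; suc; _+_; _*_; _∸_; _^_; _≤_; _<_; _≤ᵇ_; _≤?_; _<?_; _⊔_; _⊓_; z≤n; s≤s)
open import Data.Nat.Properties
open import Algebra.Properties.CommutativeSemigroup +-commutativeSemigroup using (interchange)
open import Data.Bool using (Bool; true; false; _∧_; _∨_; T; if_then_else_)
open import Data.Bool.Properties using (T-∧)
open import Data.Unit using (tt)
open import Data.Empty using (⊥; ⊥-elim)
open import Data.Product using (Σ; ∃; _×_; _,_; proj₁; proj₂)
open import Data.Sum using (_⊎_; inj₁; inj₂; [_,_]) renaming (map to map-⊎)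
open import Data.Fin using (Fin; zero; suc; toℕ; funToFin; finToFun)
open import Data.Fin.Properties using (any?; finToFun-funToFin; pigeonhole)
open import Data.List using (List; []; _∷_)
open import Data.Vec using (Vec; []; _∷_; lookup; map; tabulate)
open import Data.Vec.Properties using (lookup-zipWith; lookup-map; lookup-replicate; lookup∘tabulate; lookup⇒[]=; []=⇒lookup)
open import Data.Vec.Properties.WithK using ([]=-irrelevant)
open import Data.Fin.Subset
  using (Subset; _∈_; _∉_; _⊆_; _∩_; _∪_; _─_; ⁅_⁆; ∣_∣; Nonempty; Empty; inside; outside)
  renaming (⊥ to ∅)
open import Data.Fin.Subset.Properties
open import Relation.Nullary using (¬_; yes; no; Dec; does; _×-dec_)
open import Relation.Nullary.Decidable using (¬?; dec-true; dec-false; decidable-stable)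
open import Relation.Binary.PropositionalEquality hiding ([_])
open import Function using (_∘_; _⇔_; mk⇔; Equivalence; Inverse; mk↔ₛ′)

-- The isomorphism from `N₁` to the minor is arbitrary: its copy need not sit on `E N₁`, so a cyclic
-- flat and its image under the self-map can be compared only by inequalities. The losses in rank
-- and in size are charged to one potential, rank minus nullity up to the constant `|E N₁|`, and
-- periodicity makes every charge zero. Every nonempty proper cyclic flat is then itself an image,
-- so the inclusions obtained hold at all of them at once, which is how `FI` of the matroid and of
-- its dual appear.
--
-- Making the contracted set independent and the deleted set coindependent may move elements from
-- one side to the other, possibly the very element under study. That element is therefore
-- prescribed: `∅` and the ground set are cyclic flats of Mₖ, so no element is a loop or a coloop,
-- and a single contracted or deleted element can be kept in place. One such element is enough for
-- minimality.
--
-- The count showing that f₁ or f₂ reaches k takes `|E N₁| + |E N₁| + |E N₂| ≤ k`, and the same with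
-- the indices exchanged; the multiple of the maximum supplies both.

private
  variable
    n k m : ℕ
    e     : Fin n
    X Y   : Subset n

-- Finite sums, and cardinality as a sum of indicators

∑ : (Fin n → ℕ) → ℕ
∑ {zero}  f = 0
∑ {suc n} f = f zero + ∑ (λ i → f (suc i))

∑-+ : (f g : Fin n → ℕ) → ∑ (λ i → f i + g i) ≡ ∑ f + ∑ g
∑-+ {zero}  f g = refl
∑-+ {suc n} f g = trans (cong (f zero + g zero +_) (∑-+ (λ i → f (suc i)) (λ i → g (suc i))))
                        (interchange (f zero) (g zero) _ _)

∑-mono : (f g : Fin n → ℕ) → (∀ i → f i ≤ g i) → ∑ f ≤ ∑ g
∑-mono {zero}  f g f≤g = z≤n
∑-mono {suc n} f g f≤g = +-mono-≤ (f≤g zero) (∑-mono _ _ (λ i → f≤g (suc i)))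

∑-cong : (f g : Fin n → ℕ) → (∀ i → f i ≡ g i) → ∑ f ≡ ∑ g
∑-cong {zero}  f g f≗g = refl
∑-cong {suc n} f g f≗g = cong₂ _+_ (f≗g zero) (∑-cong _ _ (λ i → f≗g (suc i)))

∑-0 : ∀ n → ∑ {n} (λ _ → 0) ≡ 0
∑-0 zero    = refl
∑-0 (suc n) = ∑-0 n

bit : Bool → ℕ
bit true  = 1
bit false = 0

∣∣-∑ : (X : Subset n) → ∣ X ∣ ≡ ∑ (λ i → bit (lookup X i))
∣∣-∑ []             = refl
∣∣-∑ (inside ∷ X)   = cong suc (∣∣-∑ X)
∣∣-∑ (outside ∷ X)  = ∣∣-∑ X

-- Linear inequalities between numbers and cardinalities are proved by a
-- certificate check.  The sets are compared on the 2ᵏ cells of the Venn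
-- diagram of the k set variables; the hypotheses are all used with
-- coefficient one.

infixr 10 _∩′_
infixr 9 _∪′_
infixl 8 _─′_
infixl 7 _⊕_
infix  6 _⊑_ _≼_

data Exp (k : ℕ) : Set where
  var              : Fin k → Exp k
  ∅′               : Exp k
  _∩′_ _∪′_ _─′_   : Exp k → Exp k → Exp k

⟦_⟧ : Exp k → Vec (Subset n) k → Subset n
⟦ var i ⟧  σ = lookup σ i
⟦ ∅′ ⟧     σ = ∅
⟦ e ∩′ f ⟧ σ = ⟦ e ⟧ σ ∩ ⟦ f ⟧ σ
⟦ e ∪′ f ⟧ σ = ⟦ e ⟧ σ ∪ ⟦ f ⟧ σ
⟦ e ─′ f ⟧ σ = ⟦ e ⟧ σ ─ ⟦ f ⟧ σ

⟦_⟧ᵇ : Exp k → Vec Bool k → Bool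
⟦ var i ⟧ᵇ  v = lookup v i
⟦ ∅′ ⟧ᵇ     v = false
⟦ e ∩′ f ⟧ᵇ v = ⟦ e ⟧ᵇ v ∧ ⟦ f ⟧ᵇ v
⟦ e ∪′ f ⟧ᵇ v = ⟦ e ⟧ᵇ v ∨ ⟦ f ⟧ᵇ v
⟦ e ─′ f ⟧ᵇ v = if ⟦ f ⟧ᵇ v then false else ⟦ e ⟧ᵇ v

lookup-─ : (X Y : Subset n) (i : Fin n) →
           lookup (X ─ Y) i ≡ (if lookup Y i then false else lookup X i)
lookup-─ (x ∷ X) (inside  ∷ Y) zero    = refl
lookup-─ (x ∷ X) (outside ∷ Y) zero    = refl
lookup-─ (x ∷ X) (y ∷ Y)       (suc i) = lookup-─ X Y i

cell : Vec (Subset n) k → Fin n → Vec Bool k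
cell σ i = map (λ X → lookup X i) σ

lookup-⟦⟧ : (e : Exp k) (σ : Vec (Subset n) k) (i : Fin n) →
            lookup (⟦ e ⟧ σ) i ≡ ⟦ e ⟧ᵇ (cell σ i)
lookup-⟦⟧ (var j)  σ i = sym (lookup-map j (λ X → lookup X i) σ)
lookup-⟦⟧ ∅′       σ i = lookup-replicate i outside
lookup-⟦⟧ (e ∩′ f) σ i = trans (lookup-zipWith _∧_ i (⟦ e ⟧ σ) (⟦ f ⟧ σ))
                               (cong₂ _∧_ (lookup-⟦⟧ e σ i) (lookup-⟦⟧ f σ i))
lookup-⟦⟧ (e ∪′ f) σ i = trans (lookup-zipWith _∨_ i (⟦ e ⟧ σ) (⟦ f ⟧ σ))
                               (cong₂ _∨_ (lookup-⟦⟧ e σ i) (lookup-⟦⟧ f σ i))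
lookup-⟦⟧ (e ─′ f) σ i = trans (lookup-─ (⟦ e ⟧ σ) (⟦ f ⟧ σ) i)
                               (cong₂ (λ y x → if y then false else x) (lookup-⟦⟧ f σ i) (lookup-⟦⟧ e σ i))

data SetHyp (k : ℕ) : Set where
  _⊑_ : Exp k → Exp k → SetHyp k

Given⊆ : List (SetHyp k) → Vec (Subset n) k → Set → Set
Given⊆ []            σ G = G
Given⊆ (e ⊑ f ∷ hs)  σ G = ⟦ e ⟧ σ ⊆ ⟦ f ⟧ σ → Given⊆ hs σ G

infixr 5 _⇒ᵇ_
_⇒ᵇ_ : Bool → Bool → Bool
true  ⇒ᵇ y = y
false ⇒ᵇ y = true

⇒ᵇ-elim : ∀ x y → T (x ⇒ᵇ y) → T x → T y
⇒ᵇ-elim true y t _ = t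

⇒ᵇ-intro : ∀ x y → (T x → T y) → T (x ⇒ᵇ y)
⇒ᵇ-intro true  y t = t tt
⇒ᵇ-intro false y t = tt

-- Only cells that satisfy every inclusion can be inhabited, so a cell that violates one passes
-- vacuously.
guard : List (SetHyp k) → (Vec Bool k → Bool) → Vec Bool k → Bool
guard []           P v = P v
guard (e ⊑ f ∷ hs) P v = (⟦ e ⟧ᵇ v ⇒ᵇ ⟦ f ⟧ᵇ v) ⇒ᵇ guard hs P v

allCells : (Vec Bool k → Bool) → Bool
allCells {zero}  P = P []
allCells {suc k} P = allCells (λ v → P (true ∷ v)) ∧ allCells (λ v → P (false ∷ v))

allCells-elim : (P : Vec Bool k → Bool) → T (allCells P) → ∀ v → T (P v)
allCells-elim P t []          = t
allCells-elim P t (true  ∷ v) = allCells-elim _ (proj₁ (Equivalence.to T-∧ t)) v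
allCells-elim P t (false ∷ v) = allCells-elim _ (proj₂ (Equivalence.to (T-∧ {allCells (λ v → P (true ∷ v))}) t)) v

T-∈ : {X : Subset n} {i : Fin n} → T (lookup X i) → i ∈ X
T-∈ {X = X} {i} t with lookup X i in eq
... | true = lookup⇒[]= i X eq

∈-T : {X : Subset n} {i : Fin n} → i ∈ X → T (lookup X i)
∈-T i∈X = subst T (sym ([]=⇒lookup i∈X)) tt

⊆-cell : (e f : Exp k) (σ : Vec (Subset n) k) → ⟦ e ⟧ σ ⊆ ⟦ f ⟧ σ →
         ∀ i → T (⟦ e ⟧ᵇ (cell σ i) ⇒ᵇ ⟦ f ⟧ᵇ (cell σ i))
⊆-cell e f σ e⊆f i = ⇒ᵇ-intro _ _ λ t →
  subst T (lookup-⟦⟧ f σ i) (∈-T (e⊆f (T-∈ (subst T (sym (lookup-⟦⟧ e σ i)) t))))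

given⊆ : (hs : List (SetHyp k)) (P : Vec Bool k → Bool) (σ : Vec (Subset n) k) (G : Set) →
         T (allCells (guard hs P)) → ((∀ i → T (P (cell σ i))) → G) → Given⊆ hs σ G
given⊆ hs P σ G ok = go hs (λ i → allCells-elim (guard hs P) ok (cell σ i))
  where
  go : ∀ hs → (∀ i → T (guard hs P (cell σ i))) → ((∀ i → T (P (cell σ i))) → G) → Given⊆ hs σ G
  go []           t c = c t
  go (e ⊑ f ∷ hs) t c = λ e⊆f → go hs (λ i → ⇒ᵇ-elim _ _ (t i) (⊆-cell e f σ e⊆f i)) c

⊆-by : (hs : List (SetHyp k)) (e f : Exp k)
       {_ : T (allCells (guard hs (λ v → ⟦ e ⟧ᵇ v ⇒ᵇ ⟦ f ⟧ᵇ v)))} →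
       (σ : Vec (Subset n) k) → Given⊆ hs σ (⟦ e ⟧ σ ⊆ ⟦ f ⟧ σ)
⊆-by hs e f {ok} σ = given⊆ hs _ σ _ ok λ t {i} i∈e →
  T-∈ (subst T (sym (lookup-⟦⟧ f σ i)) (⇒ᵇ-elim _ _ (t i) (subst T (lookup-⟦⟧ e σ i) (∈-T i∈e))))

≡-by : (hs : List (SetHyp k)) (e f : Exp k)
       {_ : T (allCells (guard hs (λ v → (⟦ e ⟧ᵇ v ⇒ᵇ ⟦ f ⟧ᵇ v) ∧ (⟦ f ⟧ᵇ v ⇒ᵇ ⟦ e ⟧ᵇ v))))} →
       (σ : Vec (Subset n) k) → Given⊆ hs σ (⟦ e ⟧ σ ≡ ⟦ f ⟧ σ)
≡-by hs e f {ok} σ = given⊆ hs _ σ _ ok λ t → ⊆-antisym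
  (λ {i} i∈e → T-∈ (subst T (sym (lookup-⟦⟧ f σ i))
    (⇒ᵇ-elim _ _ (proj₁ (Equivalence.to T-∧ (t i))) (subst T (lookup-⟦⟧ e σ i) (∈-T i∈e)))))
  (λ {i} i∈f → T-∈ (subst T (sym (lookup-⟦⟧ e σ i))
    (⇒ᵇ-elim _ _ (proj₂ (Equivalence.to (T-∧ {⟦ e ⟧ᵇ (cell σ i) ⇒ᵇ _}) (t i))) (subst T (lookup-⟦⟧ f σ i) (∈-T i∈f)))))

data Tm (k m : ℕ) : Set where
  num  : Fin m → Tm k m
  con  : ℕ → Tm k m
  ∣_∣′ : Exp k → Tm k m
  _⊕_  : Tm k m → Tm k m → Tm k m

⟦_⟧ᵗ : Tm k m → Vec (Subset n) k → Vec ℕ m → ℕ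
⟦ num j ⟧ᵗ  σ ν = lookup ν j
⟦ con c ⟧ᵗ  σ ν = c
⟦ ∣ e ∣′ ⟧ᵗ σ ν = ∣ ⟦ e ⟧ σ ∣
⟦ s ⊕ t ⟧ᵗ  σ ν = ⟦ s ⟧ᵗ σ ν + ⟦ t ⟧ᵗ σ ν

const : Tm k m → ℕ
const (num j)  = 0
const (con c)  = c
const ∣ e ∣′   = 0
const (s ⊕ t)  = const s + const t

δ : Fin m → Fin m → ℕ
δ zero    zero    = 1
δ zero    (suc j) = 0
δ (suc i) zero    = 0
δ (suc i) (suc j) = δ i j

coeff : Tm k m → Fin m → ℕ
coeff (num i)  j = δ i j
coeff (con c)  j = 0
coeff ∣ e ∣′   j = 0
coeff (s ⊕ t)  j = coeff s j + coeff t j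

weight : Tm k m → Vec Bool k → ℕ
weight (num j)  v = 0
weight (con c)  v = 0
weight ∣ e ∣′   v = bit (⟦ e ⟧ᵇ v)
weight (s ⊕ t)  v = weight s v + weight t v

∑-zero* : (ν : Vec ℕ m) → ∑ {m} (λ j → 0 * lookup ν j) ≡ 0
∑-zero* {m} ν = ∑-0 m

∑-δ : (ν : Vec ℕ m) (i : Fin m) → ∑ (λ j → δ i j * lookup ν j) ≡ lookup ν i
∑-δ (x ∷ ν) zero    = trans (cong₂ _+_ (+-identityʳ x) (∑-zero* ν)) (+-identityʳ x)
∑-δ (x ∷ ν) (suc i) = ∑-δ ν i

-- The normal form behind the certificates: an affine part in the numerical variables, and a sum
-- over the points of the universe whose summand depends only on the Venn cell of the point.
expand : Tm k m → Vec (Subset n) k → Vec ℕ m → ℕ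
expand t σ ν = const t + (∑ (λ j → coeff t j * lookup ν j) + ∑ (λ i → weight t (cell σ i)))

expand-correct : (t : Tm k m) (σ : Vec (Subset n) k) (ν : Vec ℕ m) → ⟦ t ⟧ᵗ σ ν ≡ expand t σ ν
expand-correct {n = n} (num j) σ ν =
  sym (trans (cong₂ _+_ (∑-δ ν j) (∑-0 n)) (+-identityʳ _))
expand-correct {n = n} (con c) σ ν =
  sym (trans (cong (c +_) (cong₂ _+_ (∑-zero* ν) (∑-0 n))) (+-identityʳ c))
expand-correct {n = n} ∣ e ∣′ σ ν =
  trans (∣∣-∑ (⟦ e ⟧ σ)) (trans (∑-cong _ _ (λ i → cong bit (lookup-⟦⟧ e σ i)))
    (sym (cong (_+ ∑ (λ i → bit (⟦ e ⟧ᵇ (cell σ i)))) (∑-zero* ν))))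
expand-correct (s ⊕ t) σ ν = begin
  ⟦ s ⟧ᵗ σ ν + ⟦ t ⟧ᵗ σ ν
    ≡⟨ cong₂ _+_ (expand-correct s σ ν) (expand-correct t σ ν) ⟩
  expand s σ ν + expand t σ ν
    ≡⟨ interchange (const s) _ (const t) _ ⟩
  const s + const t + (∑ (λ j → coeff s j * lookup ν j) + ∑ (λ i → weight s (cell σ i)) +
                       (∑ (λ j → coeff t j * lookup ν j) + ∑ (λ i → weight t (cell σ i))))
    ≡⟨ cong (const s + const t +_) (interchange (∑ (λ j → coeff s j * lookup ν j)) _ _ _) ⟩
  const s + const t + (∑ (λ j → coeff s j * lookup ν j) + ∑ (λ j → coeff t j * lookup ν j) +
                       (∑ (λ i → weight s (cell σ i)) + ∑ (λ i → weight t (cell σ i))))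
    ≡⟨ cong (const s + const t +_) (cong₂ _+_
         (trans (sym (∑-+ (λ j → coeff s j * lookup ν j) _))
                (∑-cong _ _ (λ j → sym (*-distribʳ-+ (lookup ν j) (coeff s j) _))))
         (sym (∑-+ (λ i → weight s (cell σ i)) _))) ⟩
  expand (s ⊕ t) σ ν ∎
  where open ≡-Reasoning

data NumHyp (k m : ℕ) : Set where
  _≼_ : Tm k m → Tm k m → NumHyp k m

Given≤ : List (NumHyp k m) → Vec (Subset n) k → Vec ℕ m → Set → Set
Given≤ []            σ ν G = G
Given≤ (s ≼ t ∷ hs)  σ ν G = ⟦ s ⟧ᵗ σ ν ≤ ⟦ t ⟧ᵗ σ ν → Given≤ hs σ ν G

lefts rights : List (NumHyp k m) → Tm k m → Tm k m
lefts []            u = u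
lefts (s ≼ t ∷ hs)  u = lefts hs (u ⊕ s)
rights []           u = u
rights (s ≼ t ∷ hs) u = rights hs (u ⊕ t)

allFin : (Fin m → Bool) → Bool
allFin {zero}  P = true
allFin {suc m} P = P zero ∧ allFin (λ j → P (suc j))

allFin-elim : (P : Fin m → Bool) → T (allFin P) → ∀ j → T (P j)
allFin-elim P t zero    = proj₁ (Equivalence.to T-∧ t)
allFin-elim P t (suc j) = allFin-elim _ (proj₂ (Equivalence.to (T-∧ {P zero}) t)) j

infixr 6 _&_
_&_ : Bool → Bool → Bool
true  & y = y
false & y = false

&-elim : ∀ x {y} → T (x & y) → T x × T y
&-elim true t = tt , t

-- Domination of constants, of coefficients and of cell weights suffices because numerical variables
-- and cell sizes are nonnegative.
certifies : List (SetHyp k) → Tm k m → Tm k m → Bool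
certifies hs s t =
  (const s ≤ᵇ const t) & allFin (λ j → coeff s j ≤ᵇ coeff t j) &
  allCells (guard hs (λ v → weight s v ≤ᵇ weight t v))

certified : (hs : List (SetHyp k)) (s t : Tm k m) → T (certifies hs s t) →
            (σ : Vec (Subset n) k) (ν : Vec ℕ m) → Given⊆ hs σ (⟦ s ⟧ᵗ σ ν ≤ ⟦ t ⟧ᵗ σ ν)
certified hs s t ok σ ν with &-elim (const s ≤ᵇ const t) ok
... | okᶜ , ok′ with &-elim (allFin (λ j → coeff s j ≤ᵇ coeff t j)) ok′
... | okⁿ , okˢ = given⊆ hs _ σ _ okˢ λ w →
  subst₂ _≤_ (sym (expand-correct s σ ν)) (sym (expand-correct t σ ν))
    (+-mono-≤ (≤ᵇ⇒≤ (const s) (const t) okᶜ) (+-mono-≤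
      (∑-mono (λ j → coeff s j * lookup ν j) (λ j → coeff t j * lookup ν j)
        (λ j → *-monoˡ-≤ (lookup ν j) (≤ᵇ⇒≤ (coeff s j) (coeff t j) (allFin-elim _ okⁿ j))))
      (∑-mono (λ i → weight s (cell σ i)) (λ i → weight t (cell σ i))
        (λ i → ≤ᵇ⇒≤ (weight s (cell σ i)) (weight t (cell σ i)) (w i)))))

map-Given⊆ : (hs : List (SetHyp k)) (σ : Vec (Subset n) k) {G H : Set} → (G → H) →
             Given⊆ hs σ G → Given⊆ hs σ H
map-Given⊆ []           σ c g = c g
map-Given⊆ (_ ⊑ _ ∷ hs) σ c g = λ h → map-Given⊆ hs σ c (g h)

-- Each hypothesis `s′ ≤ t′` is traded for the goal `s + t′ ≤ t + s′`, from which `t′` cancels; one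
-- inequality without numerical hypotheses remains. A hypothesis needed with multiplicity two is
-- listed twice.
discharge : (hs : List (NumHyp k m)) (s t : Tm k m) (σ : Vec (Subset n) k) (ν : Vec ℕ m) {a b : ℕ} →
            (⟦ s ⟧ᵗ σ ν ≤ ⟦ t ⟧ᵗ σ ν → a ≤ b) →
            ⟦ rights hs s ⟧ᵗ σ ν ≤ ⟦ lefts hs t ⟧ᵗ σ ν → Given≤ hs σ ν (a ≤ b)
discharge []             s t σ ν c g = c g
discharge (s′ ≼ t′ ∷ hs) s t σ ν c g = λ s′≤t′ → discharge hs (s ⊕ t′) (t ⊕ s′) σ ν
  (λ h → c (+-cancelʳ-≤ (⟦ t′ ⟧ᵗ σ ν) _ _ (≤-trans h (+-monoʳ-≤ (⟦ t ⟧ᵗ σ ν) s′≤t′)))) g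

≤-by : (hs : List (SetHyp k)) (gs : List (NumHyp k m)) (s t : Tm k m)
       {_ : T (certifies hs (rights gs s) (lefts gs t))} →
       (σ : Vec (Subset n) k) (ν : Vec ℕ m) →
       Given⊆ hs σ (Given≤ gs σ ν (⟦ s ⟧ᵗ σ ν ≤ ⟦ t ⟧ᵗ σ ν))
≤-by hs gs s t {ok} σ ν =
  map-Given⊆ hs σ (discharge gs s t σ ν (λ h → h)) (certified hs (rights gs s) (lefts gs t) ok σ ν)

pattern s₀ = var zero
pattern s₁ = var (suc zero)
pattern s₂ = var (suc (suc zero))
pattern s₃ = var (suc (suc (suc zero)))
pattern s₄ = var (suc (suc (suc (suc zero))))
pattern s₅ = var (suc (suc (suc (suc (suc zero)))))
pattern s₆ = var (suc (suc (suc (suc (suc (suc zero))))))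
pattern s₇ = var (suc (suc (suc (suc (suc (suc (suc zero)))))))

pattern n₀ = num zero
pattern n₁ = num (suc zero)
pattern n₂ = num (suc (suc zero))
pattern n₃ = num (suc (suc (suc zero)))
pattern n₄ = num (suc (suc (suc (suc zero))))
pattern n₅ = num (suc (suc (suc (suc (suc zero)))))
pattern n₆ = num (suc (suc (suc (suc (suc (suc zero))))))
pattern n₇ = num (suc (suc (suc (suc (suc (suc (suc zero)))))))
pattern n₈ = num (suc (suc (suc (suc (suc (suc (suc (suc zero))))))))

no-sets : Vec (Subset 0) 0
no-sets = []

lin : (gs : List (NumHyp 0 m)) (s t : Tm 0 m) {_ : T (certifies [] (rights gs s) (lefts gs t))} →
      (ν : Vec ℕ m) → Given≤ gs no-sets ν (⟦ s ⟧ᵗ no-sets ν ≤ ⟦ t ⟧ᵗ no-sets ν)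
lin gs s t {ok} ν = ≤-by [] gs s t {ok} no-sets ν

-- Rank functions and cyclic flats

⁅⁆⊆ : e ∈ X → ⁅ e ⁆ ⊆ X
⁅⁆⊆ {e = e} {X = X} e∈X x∈e = subst (_∈ X) (sym (x∈⁅y⁆⇒x≡y e x∈e)) e∈X

Empty⇒⊆∅ : Empty X → X ⊆ ∅
Empty⇒⊆∅ X-empty x∈X = ⊥-elim (X-empty (_ , x∈X))

∉⇒⊆∅ : e ∉ X → ⁅ e ⁆ ∩ X ⊆ ∅
∉⇒⊆∅ {e = e} {X = X} e∉X x∈ with x∈p∩q⁻ ⁅ e ⁆ X x∈
... | x∈e , x∈X = ⊥-elim (e∉X (subst (_∈ X) (x∈⁅y⁆⇒x≡y e x∈e) x∈X))

⊆∅⇒∉ : ⁅ e ⁆ ∩ X ⊆ ∅ → e ∉ X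
⊆∅⇒∉ {e = e} h e∈X = ∉⊥ (h (x∈p∩q⁺ (x∈⁅x⁆ e , e∈X)))

∣⁅⁆∣≤ : (e : Fin n) → ∣ ⁅ e ⁆ ∣ ≤ 1
∣⁅⁆∣≤ e = ≤-reflexive (∣⁅x⁆∣≡1 e)

≤∣⁅⁆∣ : (e : Fin n) → 1 ≤ ∣ ⁅ e ⁆ ∣
≤∣⁅⁆∣ e = ≤-reflexive (sym (∣⁅x⁆∣≡1 e))

comprehension : {P : Fin n → Set} → (∀ i → Dec (P i)) → Subset n
comprehension P? = tabulate (does ∘ P?)

module _ {P : Fin n → Set} (P? : ∀ i → Dec (P i)) where

  ∈-comprehension⁺ : ∀ {i} → P i → i ∈ comprehension P?
  ∈-comprehension⁺ {i} p = lookup⇒[]= i _ (trans (lookup∘tabulate (does ∘ P?) i) (dec-true (P? i) p))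

  ∈-comprehension⁻ : ∀ {i} → i ∈ comprehension P? → P i
  ∈-comprehension⁻ {i} i∈ = decidable-stable (P? i) λ ¬p → true≢false
    (trans (sym ([]=⇒lookup i∈)) (trans (lookup∘tabulate (does ∘ P?) i) (dec-false (P? i) ¬p)))
    where
    true≢false : true ≢ false
    true≢false ()

subset-induction : (P : Subset n → Set) → P ∅ →
                   (∀ X e → e ∉ X → P X → P (X ∪ ⁅ e ⁆)) → ∀ X → P X
subset-induction {n} P P∅ P∪ X = go ∣ X ∣ X ≤-refl
  where
  go : ∀ m X → ∣ X ∣ ≤ m → P X
  go m X le with nonempty? X
  go m X le | no ¬ne = subst P (sym (Empty-unique ¬ne)) P∅
  go zero X le | yes (e , e∈X) = ⊥-elim (<⇒≱ (≤-trans (≤∣⁅⁆∣ e)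
    (≤-by (s₁ ⊑ s₀ ∷ []) [] ∣ s₁ ∣′ ∣ s₀ ∣′ (X ∷ ⁅ e ⁆ ∷ []) [] (⁅⁆⊆ e∈X))) le)
  go (suc m) X le | yes (e , e∈X) = subst P
    (≡-by (s₁ ⊑ s₀ ∷ []) ((s₀ ─′ s₁) ∪′ s₁) s₀ (X ∷ ⁅ e ⁆ ∷ []) (⁅⁆⊆ e∈X))
    (P∪ (X ─ ⁅ e ⁆) e (⊆∅⇒∉ (⊆-by [] (s₁ ∩′ (s₀ ─′ s₁)) ∅′ (X ∷ ⁅ e ⁆ ∷ [])))
      (go m (X ─ ⁅ e ⁆) (≤-by (s₁ ⊑ s₀ ∷ []) (con 1 ≼ ∣ s₁ ∣′ ∷ ∣ s₀ ∣′ ≼ con 1 ⊕ n₀ ∷ [])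
        ∣ s₀ ─′ s₁ ∣′ n₀ (X ∷ ⁅ e ⁆ ∷ []) (m ∷ []) (⁅⁆⊆ e∈X) (≤∣⁅⁆∣ e) le)))

record IsRank (r : Subset n → ℕ) : Set where
  field
    bounded : ∀ X → r X ≤ ∣ X ∣
    mono    : ∀ {X Y} → X ⊆ Y → r X ≤ r Y
    submod  : ∀ X Y → r (X ∪ Y) + r (X ∩ Y) ≤ r X + r Y

  submodular : ∀ {P Q} X Y → P ⊆ X ∪ Y → Q ⊆ X ∩ Y → r P + r Q ≤ r X + r Y
  submodular X Y P⊆ Q⊆ = ≤-trans (+-mono-≤ (mono P⊆) (mono Q⊆)) (submod X Y)

  increase : ∀ X Y → r X ≤ r Y + ∣ X ─ Y ∣
  increase X Y = ≤-by [] (n₀ ⊕ n₁ ≼ n₂ ⊕ n₃ ∷ n₃ ≼ ∣ s₀ ─′ s₁ ∣′ ∷ []) n₀ (n₂ ⊕ ∣ s₀ ─′ s₁ ∣′)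
    (X ∷ Y ∷ []) (r X ∷ r ∅ ∷ r Y ∷ r (X ─ Y) ∷ [])
    (submodular Y (X ─ Y) (⊆-by [] s₀ (s₁ ∪′ (s₀ ─′ s₁)) (X ∷ Y ∷ []))
                          (⊆-by [] ∅′ (s₁ ∩′ (s₀ ─′ s₁)) (X ∷ Y ∷ [])))
    (bounded (X ─ Y))

  independent-⊆ : ∀ {X Y} → X ⊆ Y → ∣ Y ∣ ≤ r Y → ∣ X ∣ ≤ r X
  independent-⊆ {X} {Y} X⊆Y ind =
    ≤-by (s₀ ⊑ s₁ ∷ []) (∣ s₁ ∣′ ≼ n₁ ∷ n₁ ≼ n₀ ⊕ ∣ s₁ ─′ s₀ ∣′ ∷ []) ∣ s₀ ∣′ n₀
      (X ∷ Y ∷ []) (r X ∷ r Y ∷ []) X⊆Y ind (increase Y X)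

  -- Submodularity for `A ∪ X` and `A ∪ ⁅ e ⁆`, whose intersection contains `A`, adds the elements
  -- of `B` one at a time.
  absorb : ∀ A B → (∀ e → e ∈ B → r (A ∪ ⁅ e ⁆) ≤ r A) → r (A ∪ B) ≤ r A
  absorb A B h = subset-induction (λ X → X ⊆ B → r (A ∪ X) ≤ r A)
    (λ _ → mono (⊆-by [] (s₀ ∪′ ∅′) s₀ (A ∷ [])))
    (λ X e _ ih X∪e⊆B → lin (n₀ ⊕ n₁ ≼ n₂ ⊕ n₃ ∷ n₂ ≼ n₁ ∷ n₃ ≼ n₁ ∷ []) n₀ n₁
      (r (A ∪ (X ∪ ⁅ e ⁆)) ∷ r A ∷ r (A ∪ X) ∷ r (A ∪ ⁅ e ⁆) ∷ [])
      (submodular (A ∪ X) (A ∪ ⁅ e ⁆)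
        (⊆-by [] (s₀ ∪′ s₁ ∪′ s₂) ((s₀ ∪′ s₁) ∪′ (s₀ ∪′ s₂)) (A ∷ X ∷ ⁅ e ⁆ ∷ []))
        (⊆-by [] s₀ ((s₀ ∪′ s₁) ∩′ (s₀ ∪′ s₂)) (A ∷ X ∷ ⁅ e ⁆ ∷ [])))
      (ih (X∪e⊆B ∘ p⊆p∪q ⁅ e ⁆)) (h e (X∪e⊆B (q⊆p∪q X ⁅ e ⁆ (x∈⁅x⁆ e)))))
    B (λ x → x)

  -- A coloop of `Y` stays a coloop after other elements are removed, by submodularity, so each
  -- removal costs a full unit of rank.
  remove-coloops : ∀ Y S → S ⊆ Y → (∀ e → e ∈ S → r (Y ─ ⁅ e ⁆) < r Y) → r (Y ─ S) + ∣ S ∣ ≤ r Y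
  remove-coloops Y S S⊆Y h = subset-induction (λ X → X ⊆ S → r (Y ─ X) + ∣ X ∣ ≤ r Y)
    (λ _ → ≤-by [] (n₀ ≼ n₁ ∷ []) (n₀ ⊕ ∣ ∅′ ∣′) n₁ (Y ∷ []) (r (Y ─ ∅) ∷ r Y ∷ [])
      (mono (⊆-by [] (s₀ ─′ ∅′) s₀ (Y ∷ []))))
    (λ X e e∉X ih X∪e⊆S → ≤-by []
      (n₀ ⊕ n₁ ≼ n₂ ⊕ n₃ ∷ n₂ ⊕ ∣ s₁ ∣′ ≼ n₀ ∷ con 1 ⊕ n₃ ≼ n₀ ∷ ∣ s₂ ∣′ ≼ con 1 ∷ [])
      (n₁ ⊕ ∣ s₁ ∪′ s₂ ∣′) n₀
      (Y ∷ X ∷ ⁅ e ⁆ ∷ []) (r Y ∷ r (Y ─ (X ∪ ⁅ e ⁆)) ∷ r (Y ─ X) ∷ r (Y ─ ⁅ e ⁆) ∷ [])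
      (submodular (Y ─ X) (Y ─ ⁅ e ⁆)
        (⊆-by (s₂ ∩′ s₁ ⊑ ∅′ ∷ []) s₀ ((s₀ ─′ s₁) ∪′ (s₀ ─′ s₂)) (Y ∷ X ∷ ⁅ e ⁆ ∷ []) (∉⇒⊆∅ e∉X))
        (⊆-by [] (s₀ ─′ (s₁ ∪′ s₂)) ((s₀ ─′ s₁) ∩′ (s₀ ─′ s₂)) (Y ∷ X ∷ ⁅ e ⁆ ∷ [])))
      (ih (X∪e⊆S ∘ p⊆p∪q ⁅ e ⁆)) (h e (X∪e⊆S (q⊆p∪q X ⁅ e ⁆ (x∈⁅x⁆ e)))) (∣⁅⁆∣≤ e))
    S (λ x → x)

  -- `W` is a basis of `B` in the contraction by `A`, grown greedily: an element is kept exactly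
  -- when it raises the rank.
  relative-basis : ∀ A B → ∃ λ W → W ⊆ B × r (A ∪ B) ≤ r (A ∪ W) × r A + ∣ W ∣ ≤ r (A ∪ B)
  relative-basis A = subset-induction
    (λ B → ∃ λ W → W ⊆ B × r (A ∪ B) ≤ r (A ∪ W) × r A + ∣ W ∣ ≤ r (A ∪ B))
    (∅ , (λ x → x) , ≤-refl , ≤-by [] (n₀ ≼ n₁ ∷ []) (n₀ ⊕ ∣ ∅′ ∣′) n₁ (A ∷ []) (r A ∷ r (A ∪ ∅) ∷ [])
      (mono (⊆-by [] s₀ (s₀ ∪′ ∅′) (A ∷ []))))
    step
    where
    step : ∀ B e → e ∉ B → (∃ λ W → W ⊆ B × r (A ∪ B) ≤ r (A ∪ W) × r A + ∣ W ∣ ≤ r (A ∪ B)) →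
           ∃ λ W → W ⊆ B ∪ ⁅ e ⁆ × r (A ∪ (B ∪ ⁅ e ⁆)) ≤ r (A ∪ W) × r A + ∣ W ∣ ≤ r (A ∪ (B ∪ ⁅ e ⁆))
    step B e e∉B (W , W⊆B , span , ind) with r (A ∪ (B ∪ ⁅ e ⁆)) ≤? r (A ∪ B)
    ... | yes le = W , p⊆p∪q ⁅ e ⁆ ∘ W⊆B , ≤-trans le span ,
      ≤-trans ind (mono (⊆-by [] (s₀ ∪′ s₁) (s₀ ∪′ s₁ ∪′ s₂) (A ∷ B ∷ ⁅ e ⁆ ∷ [])))
    ... | no gt = W ∪ ⁅ e ⁆ ,
      ⊆-by (s₀ ⊑ s₁ ∷ []) (s₀ ∪′ s₂) (s₁ ∪′ s₂) (W ∷ B ∷ ⁅ e ⁆ ∷ []) W⊆B ,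
      lin (n₀ ⊕ n₁ ≼ n₂ ⊕ n₃ ∷ n₂ ≼ n₁ ∷ []) n₀ n₃
        (r (A ∪ (B ∪ ⁅ e ⁆)) ∷ r (A ∪ W) ∷ r (A ∪ B) ∷ r (A ∪ (W ∪ ⁅ e ⁆)) ∷ [])
        (submodular (A ∪ B) (A ∪ (W ∪ ⁅ e ⁆))
          (⊆-by [] (s₀ ∪′ s₁ ∪′ s₃) ((s₀ ∪′ s₁) ∪′ (s₀ ∪′ s₂ ∪′ s₃)) (A ∷ B ∷ W ∷ ⁅ e ⁆ ∷ []))
          (⊆-by (s₂ ⊑ s₁ ∷ []) (s₀ ∪′ s₂) ((s₀ ∪′ s₁) ∩′ (s₀ ∪′ s₂ ∪′ s₃)) (A ∷ B ∷ W ∷ ⁅ e ⁆ ∷ []) W⊆B))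
        span ,
      ≤-by [] (n₀ ⊕ ∣ s₀ ∣′ ≼ n₁ ∷ con 1 ⊕ n₁ ≼ n₂ ∷ ∣ s₁ ∣′ ≼ con 1 ∷ []) (n₀ ⊕ ∣ s₀ ∪′ s₁ ∣′) n₂
        (W ∷ ⁅ e ⁆ ∷ []) (r A ∷ r (A ∪ B) ∷ r (A ∪ (B ∪ ⁅ e ⁆)) ∷ [])
        ind (≰⇒> gt) (∣⁅⁆∣≤ e)

  minimal-dependent : ∀ Y → r Y < ∣ Y ∣ →
    ∃ λ C → C ⊆ Y × r C < ∣ C ∣ × (∀ Z → Z ⊆ C → Z ≢ C → r Z ≡ ∣ Z ∣)
  minimal-dependent Y = go ∣ Y ∣ Y ≤-refl
    where
    go : ∀ m Y → ∣ Y ∣ ≤ m → r Y < ∣ Y ∣ →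
         ∃ λ C → C ⊆ Y × r C < ∣ C ∣ × (∀ Z → Z ⊆ C → Z ≢ C → r Z ≡ ∣ Z ∣)
    go zero Y le dep = ⊥-elim (n≮0 (≤-trans dep le))
    go (suc m) Y le dep with any? (λ e → (e ∈? Y) ×-dec (r (Y ─ ⁅ e ⁆) <? ∣ Y ─ ⁅ e ⁆ ∣))
    ... | yes (e , e∈Y , dep′) =
      let (C , C⊆ , rest) = go m (Y ─ ⁅ e ⁆)
            (≤-by (s₁ ⊑ s₀ ∷ []) (con 1 ≼ ∣ s₁ ∣′ ∷ ∣ s₀ ∣′ ≼ con 1 ⊕ n₀ ∷ []) ∣ s₀ ─′ s₁ ∣′ n₀
              (Y ∷ ⁅ e ⁆ ∷ []) (m ∷ []) (⁅⁆⊆ e∈Y) (≤∣⁅⁆∣ e) le) dep′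
      in C , p─q⊆p Y ⁅ e ⁆ ∘ C⊆ , rest
    ... | no ¬dep = Y , (λ x → x) , dep , independent
      where
      independent : ∀ Z → Z ⊆ Y → Z ≢ Y → r Z ≡ ∣ Z ∣
      independent Z Z⊆Y Z≢Y with any? (λ e → (e ∈? Y) ×-dec ¬? (e ∈? Z))
      ... | yes (e , e∈Y , e∉Z) = ≤-antisym (bounded Z) (independent-⊆
        (⊆-by (s₂ ⊑ s₀ ∷ s₁ ∩′ s₂ ⊑ ∅′ ∷ []) s₂ (s₀ ─′ s₁) (Y ∷ ⁅ e ⁆ ∷ Z ∷ []) Z⊆Y (∉⇒⊆∅ e∉Z))
        (≮⇒≥ λ dep′ → ¬dep (e , e∈Y , dep′)))
      ... | no ¬e = ⊥-elim (Z≢Y (⊆-antisym Z⊆Y λ {x} x∈Y →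
        decidable-stable (x ∈? Z) (λ x∉Z → ¬e (x , x∈Y , x∉Z))))

-- Extends the rank to the whole universe, with outside elements as loops. Sets then need no
-- inclusion proofs, and the ground sets of different matroids can be mixed freely.
ρ : Matroid n → Subset n → ℕ
ρ N X = r N (X ∩ E N)

ρ≡r : (N : Matroid n) → X ⊆ E N → ρ N X ≡ r N X
ρ≡r {X = X} N X⊆E = cong (r N) (≡-by (s₀ ⊑ s₁ ∷ []) (s₀ ∩′ s₁) s₀ (X ∷ E N ∷ []) X⊆E)

ρ-isRank : {N : Matroid n} → IsMatroid N → IsRank (ρ N)
ρ-isRank {N = N} isM = record
  { bounded = λ X → ≤-trans (R1 (X ∩ E N) (p∩q⊆q X (E N))) (∣p∩q∣≤∣p∣ X (E N))
  ; mono    = λ {X} {Y} X⊆Y → R2 (X ∩ E N) (Y ∩ E N) (p∩q⊆q X (E N)) (p∩q⊆q Y (E N))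
                (⊆-by (s₀ ⊑ s₁ ∷ []) (s₀ ∩′ s₂) (s₁ ∩′ s₂) (X ∷ Y ∷ E N ∷ []) X⊆Y)
  ; submod  = λ X Y → subst₂ (λ P Q → r N P + r N Q ≤ ρ N X + ρ N Y)
                (≡-by [] ((s₀ ∩′ s₂) ∪′ (s₁ ∩′ s₂)) ((s₀ ∪′ s₁) ∩′ s₂) (X ∷ Y ∷ E N ∷ []))
                (≡-by [] ((s₀ ∩′ s₂) ∩′ (s₁ ∩′ s₂)) ((s₀ ∩′ s₁) ∩′ s₂) (X ∷ Y ∷ E N ∷ []))
                (R3 (X ∩ E N) (Y ∩ E N) (p∩q⊆q X (E N)) (p∩q⊆q Y (E N)))
  }
  where open IsMatroid isM

ρ-cong : (N : Matroid n) → X ∩ E N ≡ Y ∩ E N → ρ N X ≡ ρ N Y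
ρ-cong N = cong (r N)

-- A set is a union of circuits exactly when its restriction has no coloops; in this form cyclicity
-- is an inequality between ranks, like flatness.
record RankCyclicFlat (N : Matroid n) (F : Subset n) : Set where
  field
    inGround : F ⊆ E N
    flat     : ∀ e → e ∈ E N → e ∉ F → ρ N F < ρ N (F ∪ ⁅ e ⁆)
    cyclic   : ∀ e → e ∈ F → ρ N F ≤ ρ N (F ─ ⁅ e ⁆)

module MatroidTheory {n} {N : Matroid n} (isM : IsMatroid N) where
  open IsRank (ρ-isRank isM) public

  rankCyclicFlat : ∀ {F} → CyclicFlat N F → RankCyclicFlat N F
  rankCyclicFlat {F} ((F⊆E , flat) , cyc) = record
    { inGround = F⊆E
    ; flat     = λ e e∈E e∉F → subst₂ _<_ (sym (ρ≡r N F⊆E))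
        (sym (ρ≡r N (⊆-by (s₀ ⊑ s₂ ∷ s₁ ⊑ s₂ ∷ []) (s₀ ∪′ s₁) s₂ (F ∷ ⁅ e ⁆ ∷ E N ∷ []) F⊆E (⁅⁆⊆ e∈E))))
        (flat e e∈E e∉F)
    ; cyclic   = λ e e∈F → in-circuit e (cyc e e∈F)
    }
    where
    in-circuit : ∀ e → (∃ λ C → Circuit N C × e ∈ C × C ⊆ F) → ρ N F ≤ ρ N (F ─ ⁅ e ⁆)
    -- Submodularity for `F ─ ⁅ e ⁆` and `C`: their union is `F`, and their intersection contains
    -- `C ─ ⁅ e ⁆`, which already has the rank of `C`.
    in-circuit e (C , (C⊆E , dep , min) , e∈C , C⊆F) =
      ≤-by (s₁ ⊑ s₀ ∷ []) (n₀ ⊕ n₁ ≼ n₂ ⊕ n₃ ∷ con 1 ⊕ n₃ ≼ ∣ s₀ ∣′ ∷ ∣ s₀ ─′ s₁ ∣′ ≼ n₁ ∷ ∣ s₁ ∣′ ≼ con 1 ∷ [])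
        n₀ n₂ (C ∷ ⁅ e ⁆ ∷ []) (ρ N F ∷ ρ N (C ─ ⁅ e ⁆) ∷ ρ N (F ─ ⁅ e ⁆) ∷ ρ N C ∷ [])
        (⁅⁆⊆ e∈C)
        (submodular (F ─ ⁅ e ⁆) C
          (⊆-by (s₁ ⊑ s₂ ∷ []) s₀ ((s₀ ─′ s₁) ∪′ s₂) (F ∷ ⁅ e ⁆ ∷ C ∷ []) (⁅⁆⊆ e∈C))
          (⊆-by (s₂ ⊑ s₀ ∷ []) (s₂ ─′ s₁) ((s₀ ─′ s₁) ∩′ s₂) (F ∷ ⁅ e ⁆ ∷ C ∷ []) C⊆F))
        (subst (_< ∣ C ∣) (sym (ρ≡r N C⊆E)) dep)
        (≤-reflexive (sym (trans (ρ≡r N (C⊆E ∘ p─q⊆p C ⁅ e ⁆)) (min (C ─ ⁅ e ⁆) (p─q⊆p C ⁅ e ⁆)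
          λ eq → ⊆∅⇒∉ (⊆-by [] (s₁ ∩′ (s₀ ─′ s₁)) ∅′ (C ∷ ⁅ e ⁆ ∷ [])) (subst (e ∈_) (sym eq) e∈C)))))
        (∣⁅⁆∣≤ e)

  cyclicFlat : ∀ {F} → RankCyclicFlat N F → CyclicFlat N F
  cyclicFlat {F} rcf = (inGround , λ e e∈E e∉F → subst₂ _<_ (ρ≡r N inGround)
      (ρ≡r N (⊆-by (s₀ ⊑ s₂ ∷ s₁ ⊑ s₂ ∷ []) (s₀ ∪′ s₁) s₂ (F ∷ ⁅ e ⁆ ∷ E N ∷ []) inGround (⁅⁆⊆ e∈E)))
      (flat e e∈E e∉F)) ,
    circuit
    where
    open RankCyclicFlat rcf
    circuit : Cyclic N F
    circuit e e∈F =
      -- `W` is a basis of `F ─ ⁅ e ⁆`. It spans `e`, so `W ∪ ⁅ e ⁆` is dependent; as `W` is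
      -- independent, a circuit inside must contain `e`.
      let (W , W⊆ , span , ind) = relative-basis ∅ (F ─ ⁅ e ⁆)
          (C , C⊆ , dep , min) = minimal-dependent (W ∪ ⁅ e ⁆)
            (≤-by (s₂ ⊑ s₀ ─′ s₁ ∷ [])
              (n₀ ≼ n₁ ∷ n₁ ≼ n₂ ∷ n₂ ≼ n₃ ∷ n₃ ≼ n₄ ∷ n₄ ≼ ∣ ∅′ ∪′ s₂ ∣′ ∷ con 1 ≼ ∣ s₁ ∣′ ∷ [])
              (con 1 ⊕ n₀) ∣ s₂ ∪′ s₁ ∣′
              (F ∷ ⁅ e ⁆ ∷ W ∷ [])
              (ρ N (W ∪ ⁅ e ⁆) ∷ ρ N F ∷ ρ N (F ─ ⁅ e ⁆) ∷ ρ N (∅ ∪ (F ─ ⁅ e ⁆)) ∷ ρ N (∅ ∪ W) ∷ [])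
              W⊆
              (mono (⊆-by (s₂ ⊑ s₀ ─′ s₁ ∷ s₁ ⊑ s₀ ∷ []) (s₂ ∪′ s₁) s₀ (F ∷ ⁅ e ⁆ ∷ W ∷ []) W⊆ (⁅⁆⊆ e∈F)))
              (cyclic e e∈F)
              (mono (⊆-by [] s₀ (∅′ ∪′ s₀) ((F ─ ⁅ e ⁆) ∷ [])))
              span (bounded (∅ ∪ W)) (≤∣⁅⁆∣ e))
          C⊆F = ⊆-by (s₂ ⊑ s₀ ─′ s₁ ∷ s₁ ⊑ s₀ ∷ s₃ ⊑ s₂ ∪′ s₁ ∷ []) s₃ s₀ (F ∷ ⁅ e ⁆ ∷ W ∷ C ∷ [])
                  W⊆ (⁅⁆⊆ e∈F) C⊆
          |W|≤ = ≤-by [] (n₀ ⊕ ∣ s₀ ∣′ ≼ n₁ ∷ n₁ ≼ n₂ ∷ n₂ ≼ n₃ ∷ []) ∣ s₀ ∣′ n₃ (W ∷ [])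
                  (ρ N ∅ ∷ ρ N (∅ ∪ (F ─ ⁅ e ⁆)) ∷ ρ N (∅ ∪ W) ∷ ρ N W ∷ [])
                  ind span (mono (⊆-by [] (∅′ ∪′ s₀) s₀ (W ∷ [])))
      in C , ((inGround ∘ C⊆F) , subst (_< ∣ C ∣) (ρ≡r N (inGround ∘ C⊆F)) dep ,
              λ Z Z⊆C Z≢C → trans (sym (ρ≡r N (inGround ∘ C⊆F ∘ Z⊆C))) (min Z Z⊆C Z≢C)) ,
         decidable-stable (e ∈? C) (λ e∉C → <⇒≱ dep (independent-⊆
           (⊆-by (s₂ ⊑ s₀ ∪′ s₁ ∷ s₁ ∩′ s₂ ⊑ ∅′ ∷ []) s₂ s₀ (W ∷ ⁅ e ⁆ ∷ C ∷ []) C⊆ (∉⇒⊆∅ e∉C))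
           |W|≤)) ,
         C⊆F

  inClosure? : ∀ X e → Dec (e ∈ E N × ρ N (X ∪ ⁅ e ⁆) ≤ ρ N X)
  inClosure? X e = (e ∈? E N) ×-dec (ρ N (X ∪ ⁅ e ⁆) ≤? ρ N X)

  cl : Subset n → Subset n
  cl X = comprehension (inClosure? X)

  nonColoop? : ∀ Y e → Dec (e ∈ Y × ρ N Y ≤ ρ N (Y ─ ⁅ e ⁆))
  nonColoop? Y e = (e ∈? Y) ×-dec (ρ N Y ≤? ρ N (Y ─ ⁅ e ⁆))

  cyclicPart : Subset n → Subset n
  cyclicPart Y = comprehension (nonColoop? Y)

  ρ-mono-∩ : ∀ {X Y} → X ∩ E N ⊆ Y → ρ N X ≤ ρ N Y
  ρ-mono-∩ {X} {Y} h = subst (_≤ ρ N Y)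
    (ρ-cong N (≡-by [] ((s₀ ∩′ s₁) ∩′ s₁) (s₀ ∩′ s₁) (X ∷ E N ∷ []))) (mono h)

  cl⊆E : ∀ X → cl X ⊆ E N
  cl⊆E X e∈ = proj₁ (∈-comprehension⁻ (inClosure? X) e∈)

  ⊆cl : ∀ X → X ∩ E N ⊆ cl X
  ⊆cl X {e} e∈ = let (e∈X , e∈E) = x∈p∩q⁻ X (E N) e∈ in
    ∈-comprehension⁺ (inClosure? X) (e∈E , mono (⊆-by (s₁ ⊑ s₀ ∷ []) (s₀ ∪′ s₁) s₀ (X ∷ ⁅ e ⁆ ∷ []) (⁅⁆⊆ e∈X)))

  ρ-cl : ∀ X → ρ N (cl X) ≤ ρ N X
  ρ-cl X = ≤-trans (mono (q⊆p∪q X (cl X)))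
    (absorb X (cl X) λ e e∈ → proj₂ (∈-comprehension⁻ (inClosure? X) e∈))

  cyclicPart⊆ : ∀ Y → cyclicPart Y ⊆ Y
  cyclicPart⊆ Y e∈ = proj₁ (∈-comprehension⁻ (nonColoop? Y) e∈)

  ∉cyclicPart : ∀ {Y e} → e ∈ Y → e ∉ cyclicPart Y → ρ N (Y ─ ⁅ e ⁆) < ρ N Y
  ∉cyclicPart {Y} e∈Y e∉ = ≰⇒> λ le → e∉ (∈-comprehension⁺ (nonColoop? Y) (e∈Y , le))

  ρ-cyclicPart : ∀ Y → ρ N (cyclicPart Y) + ∣ Y ─ cyclicPart Y ∣ ≤ ρ N Y
  ρ-cyclicPart Y = ≤-trans
    (+-monoˡ-≤ _ (mono (⊆-by (s₁ ⊑ s₀ ∷ []) s₁ (s₀ ─′ (s₀ ─′ s₁)) (Y ∷ cyclicPart Y ∷ []) (cyclicPart⊆ Y))))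
    (remove-coloops Y (Y ─ cyclicPart Y) (p─q⊆p Y _)
      λ e e∈ → ∉cyclicPart (p─q⊆p Y _ e∈) (⊆∅⇒∉
        (⊆-by (s₂ ⊑ s₀ ─′ s₁ ∷ []) (s₂ ∩′ s₁) ∅′ (Y ∷ cyclicPart Y ∷ ⁅ e ⁆ ∷ []) (⁅⁆⊆ e∈))))

  cyc : Subset n → Subset n
  cyc X = cyclicPart (cl X)

  cyc⊆E : ∀ X → cyc X ⊆ E N
  cyc⊆E X = cl⊆E X ∘ cyclicPart⊆ (cl X)

  -- For `X` inside the ground set, `X ⊆ cl X`, so `cyc X` attains the minimum of `ρ N Z + |X − Z|`
  -- over cyclic flats `Z`. This is the formula by which the cyclic flats and their ranks determine
  -- the matroid.
  ρ-cyc : ∀ X → ρ N (cyc X) + ∣ cl X ─ cyc X ∣ ≤ ρ N X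
  ρ-cyc X = ≤-trans (ρ-cyclicPart (cl X)) (ρ-cl X)

  cyc-rankCyclicFlat : ∀ X → RankCyclicFlat N (cyc X)
  cyc-rankCyclicFlat X = record { inGround = cyc⊆E X ; flat = flat ; cyclic = cyclic }
    where
    K = cl X
    F = cyc X
    flat : ∀ e → e ∈ E N → e ∉ F → ρ N F < ρ N (F ∪ ⁅ e ⁆)
    flat e e∈E e∉F with e ∈? K
    -- Here `e` is a coloop of `K`. Restoring the coloops other than `e` gains at most one each, so
    -- `e` itself must account for the missing unit.
    ... | yes e∈K =
      ≤-by (s₁ ⊑ s₀ ∷ s₂ ⊑ s₀ ∷ s₂ ∩′ s₁ ⊑ ∅′ ∷ [])
        (n₀ ⊕ ∣ s₀ ─′ s₁ ∣′ ≼ n₁ ∷ n₁ ≼ n₂ ⊕ ∣ s₀ ─′ (s₁ ∪′ s₂) ∣′ ∷ con 1 ≼ ∣ s₂ ∣′ ∷ []) (con 1 ⊕ n₀) n₂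
        (K ∷ F ∷ ⁅ e ⁆ ∷ []) (ρ N F ∷ ρ N K ∷ ρ N (F ∪ ⁅ e ⁆) ∷ [])
        (cyclicPart⊆ K) (⁅⁆⊆ e∈K) (∉⇒⊆∅ e∉F)
        (ρ-cyclicPart K) (increase K (F ∪ ⁅ e ⁆)) (≤∣⁅⁆∣ e)
    -- If `e` failed to raise the rank of `F`, submodularity would keep it from raising that of the
    -- larger set `K`.
    ... | no e∉K =
      lin (n₀ ⊕ n₁ ≼ n₂ ⊕ n₃ ∷ con 1 ⊕ n₄ ≼ n₅ ∷ n₅ ≼ n₀ ∷ n₃ ≼ n₄ ∷ []) (con 1 ⊕ n₁) n₂
        (ρ N (K ∪ ⁅ e ⁆) ∷ ρ N F ∷ ρ N (F ∪ ⁅ e ⁆) ∷ ρ N K ∷ ρ N X ∷ ρ N (X ∪ ⁅ e ⁆) ∷ [])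
        (submodular (F ∪ ⁅ e ⁆) K
          (⊆-by [] (s₀ ∪′ s₂) ((s₁ ∪′ s₂) ∪′ s₀) (K ∷ F ∷ ⁅ e ⁆ ∷ []))
          (⊆-by (s₁ ⊑ s₀ ∷ []) s₁ ((s₁ ∪′ s₂) ∩′ s₀) (K ∷ F ∷ ⁅ e ⁆ ∷ []) (cyclicPart⊆ K)))
        (≰⇒> λ le → e∉K (∈-comprehension⁺ (inClosure? X) (e∈E , le)))
        (ρ-mono-∩ (⊆-by (s₀ ∩′ s₁ ⊑ s₂ ∷ []) ((s₀ ∪′ s₃) ∩′ s₁) (s₂ ∪′ s₃) (X ∷ E N ∷ K ∷ ⁅ e ⁆ ∷ []) (⊆cl X)))
        (ρ-cl X)
    cyclic : ∀ e → e ∈ F → ρ N F ≤ ρ N (F ─ ⁅ e ⁆)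
    cyclic e e∈F =
      ≤-by (s₁ ⊑ s₀ ∷ s₂ ⊑ s₁ ∷ [])
        (n₀ ⊕ ∣ s₀ ─′ s₁ ∣′ ≼ n₁ ∷ n₁ ≼ n₂ ∷ n₂ ≼ n₃ ⊕ ∣ s₀ ─′ s₂ ─′ (s₁ ─′ s₂) ∣′ ∷ []) n₀ n₃
        (K ∷ F ∷ ⁅ e ⁆ ∷ []) (ρ N F ∷ ρ N K ∷ ρ N (K ─ ⁅ e ⁆) ∷ ρ N (F ─ ⁅ e ⁆) ∷ [])
        (cyclicPart⊆ K) (⁅⁆⊆ e∈F)
        (ρ-cyclicPart K) (proj₂ (∈-comprehension⁻ (nonColoop? K) e∈F)) (increase (K ─ ⁅ e ⁆) (F ─ ⁅ e ⁆))

  cyc-cyclicFlat : ∀ X → CyclicFlat N (cyc X)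
  cyc-cyclicFlat X = cyclicFlat (cyc-rankCyclicFlat X)

-- The rank function of Mₖ

-- For `B` disjoint from `E N`, this is the minimum of `ρ N F + |B| + |X − (F ∪ B)|` over all cyclic
-- flats `F` of `N`: the best estimate that the sets `F ∪ B` can give.
bound : Matroid n → Subset n → Subset n → ℕ
bound N B X = ρ N X + ∣ B ∣ + ∣ X ─ (E N ∪ B) ∣

-- All that is used about Mₖ from its definition, with the index symmetry visible. The minimum
-- formula is split into upper bounds and the statement `attained` that one of them is reached.
-- `free₁` and `free₂` say that each `B` already lifts the other bound to `k`.
record Amalgam (k : ℕ) (N₁ : Matroid n) (B₁ : Subset n) (N₂ : Matroid n) (B₂ : Subset n)
               (M : Matroid n) : Set where
  field
    isM₁      : IsMatroid N₁
    isM₂      : IsMatroid N₂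
    isM       : IsMatroid M
    R₁⊆E      : E N₁ ⊆ E M
    R₂⊆E      : E N₂ ⊆ E M
    B₁⊆E      : B₁ ⊆ E M
    B₂⊆E      : B₂ ⊆ E M
    E⊆        : E M ⊆ E N₁ ∪ E N₂ ∪ B₁ ∪ B₂
    R₁R₂      : E N₁ ∩ E N₂ ⊆ ∅
    R₁B₁      : E N₁ ∩ B₁ ⊆ ∅
    R₂B₂      : E N₂ ∩ B₂ ⊆ ∅
    B₁B₂      : B₁ ∩ B₂ ⊆ ∅
    size₁     : ∣ B₁ ∣ + rk N₁ ≡ k
    size₂     : ∣ B₂ ∣ + rk N₂ ≡ k
    rank-E    : ρ M (E M) ≡ k
    ρ≤bound₁  : ∀ X → ρ M X ≤ bound N₁ B₁ X
    ρ≤bound₂  : ∀ X → ρ M X ≤ bound N₂ B₂ X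
    attained  : ∀ X → X ⊆ E M →
                ∣ X ∣ ≤ ρ M X ⊎ k ≤ ρ M X ⊎ bound N₁ B₁ X ≤ ρ M X ⊎ bound N₂ B₂ X ≤ ρ M X
    free₁     : k ≤ bound N₂ B₂ B₁
    free₂     : k ≤ bound N₁ B₁ B₂
    loopless  : ∀ e → e ∈ E M → 1 ≤ ρ M ⁅ e ⁆
    coloopless : ∀ e → e ∈ E M → k ≤ ρ M (E M ─ ⁅ e ⁆)

  ρ≤k : ∀ X → ρ M X ≤ k
  ρ≤k X = subst (ρ M X ≤_) rank-E (MatroidTheory.ρ-mono-∩ isM (p∩q⊆q X (E M)))

swap₃₄ : ∀ {P Q R S : Set} → P ⊎ Q ⊎ R ⊎ S → P ⊎ Q ⊎ S ⊎ R
swap₃₄ (inj₁ p)                = inj₁ p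
swap₃₄ (inj₂ (inj₁ q))         = inj₂ (inj₁ q)
swap₃₄ (inj₂ (inj₂ (inj₁ r)))  = inj₂ (inj₂ (inj₂ r))
swap₃₄ (inj₂ (inj₂ (inj₂ s)))  = inj₂ (inj₂ (inj₁ s))

Amalgam-sym : {N₁ N₂ M : Matroid n} {B₁ B₂ : Subset n} →
              Amalgam k N₁ B₁ N₂ B₂ M → Amalgam k N₂ B₂ N₁ B₁ M
Amalgam-sym {N₁ = N₁} {N₂} {M} {B₁} {B₂} A = record
  { isM₁ = isM₂ ; isM₂ = isM₁ ; isM = isM
  ; R₁⊆E = R₂⊆E ; R₂⊆E = R₁⊆E ; B₁⊆E = B₂⊆E ; B₂⊆E = B₁⊆E
  ; E⊆ = ⊆-by (s₀ ⊑ s₁ ∪′ s₂ ∪′ s₃ ∪′ s₄ ∷ []) s₀ (s₂ ∪′ s₁ ∪′ s₄ ∪′ s₃)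
           (E M ∷ E N₁ ∷ E N₂ ∷ B₁ ∷ B₂ ∷ []) E⊆
  ; R₁R₂ = ⊆-by (s₀ ∩′ s₁ ⊑ ∅′ ∷ []) (s₁ ∩′ s₀) ∅′ (E N₁ ∷ E N₂ ∷ []) R₁R₂
  ; R₁B₁ = R₂B₂ ; R₂B₂ = R₁B₁
  ; B₁B₂ = ⊆-by (s₀ ∩′ s₁ ⊑ ∅′ ∷ []) (s₁ ∩′ s₀) ∅′ (B₁ ∷ B₂ ∷ []) B₁B₂
  ; size₁ = size₂ ; size₂ = size₁
  ; rank-E = rank-E ; ρ≤bound₁ = ρ≤bound₂ ; ρ≤bound₂ = ρ≤bound₁
  ; attained = λ X X⊆E → swap₃₄ (attained X X⊆E)
  ; free₁ = free₂ ; free₂ = free₁ ; loopless = loopless ; coloopless = coloopless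
  }
  where
  open Amalgam A

IsMk-sym : {N₁ N₂ M : Matroid n} {A₁ A₂ U₁ U₂ : Subset n} →
           IsMk k N₁ A₁ U₁ N₂ A₂ U₂ M → IsMk k N₂ A₂ U₂ N₁ A₁ U₁ M
IsMk-sym {k = k} {N₁ = N₁} {N₂} {M} {A₁} {A₂} {U₁} {U₂} S = record
  { N₁-matroid = N₂-matroid ; N₂-matroid = N₁-matroid ; N₁-pos = N₂-pos ; N₂-pos = N₁-pos
  ; R-disj = disjoint-sym R-disj ; A₁⊆R₁ = A₂⊆R₂ ; A₂⊆R₂ = A₁⊆R₁
  ; k-big = lin (n₀ ⊕ n₁ ⊕ n₂ ⊕ n₃ ≼ n₄ ∷ []) (n₂ ⊕ n₃ ⊕ n₀ ⊕ n₁) n₄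
      (rk N₁ ∷ η N₁ A₁ ∷ rk N₂ ∷ η N₂ A₂ ∷ k ∷ []) k-big
  ; U₁-size = U₂-size ; U₂-size = U₁-size ; U₁U₂-disj = disjoint-sym U₁U₂-disj
  ; U₁R-disj = subst (Disjoint U₂) (∪-comm (E N₁) (E N₂)) U₂R-disj
  ; U₂R-disj = subst (Disjoint U₁) (∪-comm (E N₁) (E N₂)) U₁R-disj
  ; M-matroid = M-matroid
  ; ground = trans ground (≡-by [] (s₀ ∪′ s₁ ∪′ s₂ ∪′ s₃) (s₁ ∪′ s₀ ∪′ s₃ ∪′ s₂) (E N₁ ∷ E N₂ ∷ U₁ ∷ U₂ ∷ []))
  ; cyclicFlats = λ Z → mk⇔
      (λ z → swap₃₄ (Equivalence.to (cyclicFlats Z) z))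
      (λ z → Equivalence.from (cyclicFlats Z) (swap₃₄ z))
  ; rank-∅ = rank-∅ ; rank-E = rank-E ; rank-1 = rank-2 ; rank-2 = rank-1
  }
  where
  open IsMk S
  disjoint-sym : Disjoint X Y → Disjoint Y X
  disjoint-sym {X = X} {Y = Y} = subst Empty (∩-comm X Y)

module OneSide {N₁ N₂ M : Matroid n} {A₁ A₂ U₁ U₂ : Subset n}
               (S : IsMk k N₁ A₁ U₁ N₂ A₂ U₂ M) where
  open IsMk S
  open MatroidTheory M-matroid using (bounded; ρ-mono-∩; increase)
  private
    module T₁ = MatroidTheory N₁-matroid
    module T₂ = MatroidTheory N₂-matroid

  U₁∩R : U₁ ∩ (E N₁ ∪ E N₂) ⊆ ∅
  U₁∩R = Empty⇒⊆∅ U₁R-disj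

  U₂∩R : U₂ ∩ (E N₁ ∪ E N₂) ⊆ ∅
  U₂∩R = Empty⇒⊆∅ U₂R-disj

  R₁∩R₂ : E N₁ ∩ E N₂ ⊆ ∅
  R₁∩R₂ = Empty⇒⊆∅ R-disj

  U₁∪A₂⊆E : U₁ ∪ A₂ ⊆ E M
  U₁∪A₂⊆E = ⊆-by (s₁ ⊑ s₂ ∷ s₃ ∪′ s₂ ∪′ s₀ ∪′ s₄ ⊑ s₅ ∷ []) (s₀ ∪′ s₁) s₅
    (U₁ ∷ A₂ ∷ E N₂ ∷ E N₁ ∷ U₂ ∷ E M ∷ []) A₂⊆R₂ (⊆-reflexive (sym ground))

  R₁⊆E : E N₁ ⊆ E M
  R₁⊆E = subst (E N₁ ⊆_) (sym ground) (p⊆p∪q _)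

  size : ∣ U₁ ∪ A₂ ∣ + rk N₁ ≡ k
  size = ≤-antisym
    (≤-by [] (∣ s₀ ∣′ ⊕ n₀ ⊕ ∣ s₁ ∣′ ≼ n₁ ∷ []) (∣ s₀ ∪′ s₁ ∣′ ⊕ n₀) n₁
      (U₁ ∷ A₂ ∷ []) (rk N₁ ∷ k ∷ []) (≤-reflexive U₁-size))
    (≤-by (s₁ ⊑ s₃ ∷ s₀ ∩′ (s₂ ∪′ s₃) ⊑ ∅′ ∷ []) (n₁ ≼ ∣ s₀ ∣′ ⊕ n₀ ⊕ ∣ s₁ ∣′ ∷ []) n₁ (∣ s₀ ∪′ s₁ ∣′ ⊕ n₀)
      (U₁ ∷ A₂ ∷ E N₁ ∷ E N₂ ∷ []) (rk N₁ ∷ k ∷ []) A₂⊆R₂ U₁∩R (≤-reflexive (sym U₁-size)))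

  ρ-E : ρ M (E M) ≡ k
  ρ-E = trans (ρ≡r M (λ x → x)) rank-E

  ρ-Z : ∀ {F} → Z' N₁ F → ρ M (F ∪ U₁ ∪ A₂) ≡ ρ N₁ F + ∣ U₁ ∣ + ∣ A₂ ∣
  ρ-Z {F} z@(((F⊆R₁ , _) , _) , _) = trans
    (ρ≡r M (⊆-by (s₀ ⊑ s₁ ∷ s₁ ⊑ s₂ ∷ s₃ ⊑ s₂ ∷ []) (s₀ ∪′ s₃) s₂
      (F ∷ E N₁ ∷ E M ∷ U₁ ∪ A₂ ∷ []) F⊆R₁ R₁⊆E U₁∪A₂⊆E))
    (trans (rank-1 F z) (cong (λ x → x + ∣ U₁ ∣ + ∣ A₂ ∣) (sym (ρ≡r N₁ F⊆R₁))))

  -- The cyclic flat of `N₁` that attains `ρ N₁ X` decides the comparison: if it is empty the bound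
  -- is at least `|X|`, if it is all of `E N₁` at least `k`, and otherwise it gives a cyclic flat of
  -- `M` whose rank is prescribed.
  ρ≤bound : ∀ X → ρ M X ≤ bound N₁ (U₁ ∪ A₂) X
  ρ≤bound X with nonempty? (T₁.cyc X) | E N₁ ⊆? T₁.cyc X
  ... | no F-empty | _ =
    ≤-by (s₀ ∩′ s₁ ⊑ s₂ ∷ s₃ ⊑ ∅′ ∷ []) (n₀ ⊕ ∣ s₂ ─′ s₃ ∣′ ≼ n₁ ∷ n₂ ≼ ∣ s₀ ∣′ ∷ [])
      n₂ (n₁ ⊕ ∣ s₄ ∣′ ⊕ ∣ s₀ ─′ (s₁ ∪′ s₄) ∣′)
      (X ∷ E N₁ ∷ T₁.cl X ∷ T₁.cyc X ∷ U₁ ∪ A₂ ∷ []) (ρ N₁ (T₁.cyc X) ∷ ρ N₁ X ∷ ρ M X ∷ [])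
      (T₁.⊆cl X) (Empty⇒⊆∅ F-empty) (T₁.ρ-cyc X) (bounded X)
  ... | yes _ | yes R₁⊆F =
    ≤-by [] (n₀ ⊕ ∣ s₂ ─′ s₃ ∣′ ≼ n₁ ∷ n₃ ≼ n₀ ∷ n₂ ≼ n₄ ∷ n₄ ≼ ∣ s₄ ∣′ ⊕ n₃ ∷ [])
      n₂ (n₁ ⊕ ∣ s₄ ∣′ ⊕ ∣ s₀ ─′ (s₁ ∪′ s₄) ∣′)
      (X ∷ E N₁ ∷ T₁.cl X ∷ T₁.cyc X ∷ U₁ ∪ A₂ ∷ [])
      (ρ N₁ (T₁.cyc X) ∷ ρ N₁ X ∷ ρ M X ∷ rk N₁ ∷ k ∷ [])
      (T₁.ρ-cyc X) (subst (_≤ ρ N₁ (T₁.cyc X)) (ρ≡r N₁ (λ x → x)) (T₁.mono R₁⊆F))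
      (subst (ρ M X ≤_) ρ-E (ρ-mono-∩ (p∩q⊆q X (E M)))) (≤-reflexive (sym size))
  ... | yes F-nonempty | no R₁⊈F =
    ≤-by (s₀ ∩′ s₁ ⊑ s₂ ∷ s₃ ⊑ s₁ ∷ s₅ ⊑ s₇ ∷ s₄ ∩′ (s₁ ∪′ s₇) ⊑ ∅′ ∷ [])
      (n₀ ⊕ ∣ s₂ ─′ s₃ ∣′ ≼ n₁ ∷ n₂ ≼ n₃ ⊕ ∣ s₀ ─′ (s₃ ∪′ s₄ ∪′ s₅) ∣′ ∷ n₃ ≼ n₀ ⊕ ∣ s₄ ∣′ ⊕ ∣ s₅ ∣′ ∷ [])
      n₂ (n₁ ⊕ ∣ s₄ ∪′ s₅ ∣′ ⊕ ∣ s₀ ─′ (s₁ ∪′ s₄ ∪′ s₅) ∣′)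
      (X ∷ E N₁ ∷ T₁.cl X ∷ F ∷ U₁ ∷ A₂ ∷ E M ∷ E N₂ ∷ []) (ρ N₁ F ∷ ρ N₁ X ∷ ρ M X ∷ ρ M (F ∪ U₁ ∪ A₂) ∷ [])
      (T₁.⊆cl X) (T₁.cyc⊆E X) A₂⊆R₂ U₁∩R
      (T₁.ρ-cyc X) (increase X (F ∪ U₁ ∪ A₂))
      (≤-reflexive (ρ-Z (T₁.cyc-cyclicFlat X , F-nonempty , λ F≡R₁ → R₁⊈F (⊆-reflexive (sym F≡R₁)))))
    where
    F = T₁.cyc X

  -- The rank of `X` is at least that of its flat `F ∪ U₁ ∪ A₂` plus the number of elements outside
  -- it, while `ρ N₁ X` exceeds `ρ N₁ F` by at most the number of elements of `X ∩ E N₁` outside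
  -- `F`.
  bound≤ρ : ∀ X → X ⊆ E M → (∃ λ F → Z' N₁ F × MatroidTheory.cyc M-matroid X ≡ F ∪ U₁ ∪ A₂) →
            bound N₁ (U₁ ∪ A₂) X ≤ ρ M X
  bound≤ρ X X⊆E (F , z@(((F⊆R₁ , _) , _) , _) , eq) =
    ≤-by (s₀ ⊑ s₆ ∷ s₀ ∩′ s₆ ⊑ s₂ ∷ s₃ ⊑ s₁ ∷ s₅ ⊑ s₇ ∷ s₄ ∩′ (s₁ ∪′ s₇) ⊑ ∅′ ∷ s₁ ∩′ s₇ ⊑ ∅′ ∷ [])
      (n₂ ⊕ ∣ s₂ ─′ (s₃ ∪′ s₄ ∪′ s₅) ∣′ ≼ n₃ ∷ n₀ ≼ n₁ ⊕ ∣ s₀ ∩′ s₁ ─′ s₃ ∣′ ∷ n₁ ⊕ ∣ s₄ ∣′ ⊕ ∣ s₅ ∣′ ≼ n₂ ∷ [])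
      (n₀ ⊕ ∣ s₄ ∪′ s₅ ∣′ ⊕ ∣ s₀ ─′ (s₁ ∪′ s₄ ∪′ s₅) ∣′) n₃
      (X ∷ E N₁ ∷ K ∷ F ∷ U₁ ∷ A₂ ∷ E M ∷ E N₂ ∷ []) (ρ N₁ X ∷ ρ N₁ F ∷ ρ M (F ∪ U₁ ∪ A₂) ∷ ρ M X ∷ [])
      X⊆E (MatroidTheory.⊆cl M-matroid X) F⊆R₁ A₂⊆R₂ U₁∩R R₁∩R₂
      (subst (λ Z → ρ M Z + ∣ K ─ Z ∣ ≤ ρ M X) eq (MatroidTheory.ρ-cyc M-matroid X))
      (≤-trans (T₁.ρ-mono-∩ (⊆-by [] ((s₀ ∩′ s₁) ) (s₀ ∩′ s₁) (X ∷ E N₁ ∷ []))) (T₁.increase (X ∩ E N₁) F))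
      (≤-reflexive (sym (ρ-Z z)))
    where
    K = MatroidTheory.cl M-matroid X

  -- The given sizes turn the right side into `2k − rk N₁ − rk N₂ − η N₂ A₂`, and the lower bound on
  -- `k` in the construction is what makes this at least `k`.
  free : k ≤ bound N₂ (U₂ ∪ A₁) (U₁ ∪ A₂)
  free =
    ≤-by (s₁ ⊑ s₃ ∷ s₀ ∩′ (s₄ ∪′ s₃) ⊑ ∅′ ∷ s₀ ∩′ s₂ ⊑ ∅′ ∷ s₅ ⊑ s₄ ∷ s₂ ∩′ (s₄ ∪′ s₃) ⊑ ∅′ ∷ [])
      (n₀ ⊕ n₁ ⊕ n₂ ⊕ n₃ ≼ n₄ ∷ n₄ ≼ ∣ s₀ ∣′ ⊕ n₀ ⊕ ∣ s₁ ∣′ ∷ n₄ ≼ ∣ s₂ ∣′ ⊕ n₂ ⊕ ∣ s₅ ∣′ ∷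
       ∣ s₁ ∣′ ≼ n₃ ⊕ n₅ ∷ n₅ ≼ n₆ ∷ [])
      n₄ (n₆ ⊕ ∣ s₂ ∪′ s₅ ∣′ ⊕ ∣ (s₀ ∪′ s₁) ─′ (s₃ ∪′ s₂ ∪′ s₅) ∣′)
      (U₁ ∷ A₂ ∷ U₂ ∷ E N₂ ∷ E N₁ ∷ A₁ ∷ [])
      (rk N₁ ∷ η N₁ A₁ ∷ rk N₂ ∷ η N₂ A₂ ∷ k ∷ r N₂ A₂ ∷ ρ N₂ (U₁ ∪ A₂) ∷ [])
      A₂⊆R₂ U₁∩R (Empty⇒⊆∅ U₁U₂-disj) A₁⊆R₁ U₂∩R
      k-big (≤-reflexive (sym U₁-size)) (≤-reflexive (sym U₂-size))
      (m≤n+m∸n′ ∣ A₂ ∣ (r N₂ A₂))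
      (subst (_≤ ρ N₂ (U₁ ∪ A₂)) (ρ≡r N₂ A₂⊆R₂) (T₂.mono (q⊆p∪q U₁ A₂)))
    where
    m≤n+m∸n′ : ∀ x y → x ≤ (x ∸ y) + y
    m≤n+m∸n′ x y = subst (x ≤_) (+-comm y (x ∸ y)) (m≤n+m∸n x y)

IsMk⇒Amalgam : {N₁ N₂ M : Matroid n} {A₁ A₂ U₁ U₂ : Subset n} →
               IsMk k N₁ A₁ U₁ N₂ A₂ U₂ M → Amalgam k N₁ (U₁ ∪ A₂) N₂ (U₂ ∪ A₁) M
IsMk⇒Amalgam {k = k} {N₁ = N₁} {N₂} {M} {A₁} {A₂} {U₁} {U₂} S = record
  { isM₁ = N₁-matroid ; isM₂ = N₂-matroid ; isM = M-matroid
  ; R₁⊆E = S₁.R₁⊆E ; R₂⊆E = S₂.R₁⊆E ; B₁⊆E = S₁.U₁∪A₂⊆E ; B₂⊆E = S₂.U₁∪A₂⊆E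
  ; E⊆ = ⊆-by (s₀ ⊑ s₁ ∪′ s₂ ∪′ s₃ ∪′ s₄ ∷ []) s₀ (s₁ ∪′ s₂ ∪′ (s₃ ∪′ s₆) ∪′ (s₄ ∪′ s₅))
      (E M ∷ E N₁ ∷ E N₂ ∷ U₁ ∷ U₂ ∷ A₁ ∷ A₂ ∷ []) (⊆-reflexive ground)
  ; R₁R₂ = S₁.R₁∩R₂
  ; R₁B₁ = ⊆-by (s₂ ∩′ (s₀ ∪′ s₁) ⊑ ∅′ ∷ s₃ ⊑ s₁ ∷ s₀ ∩′ s₁ ⊑ ∅′ ∷ []) (s₀ ∩′ (s₂ ∪′ s₃)) ∅′
      (E N₁ ∷ E N₂ ∷ U₁ ∷ A₂ ∷ []) S₁.U₁∩R A₂⊆R₂ S₁.R₁∩R₂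
  ; R₂B₂ = ⊆-by (s₂ ∩′ (s₀ ∪′ s₁) ⊑ ∅′ ∷ s₃ ⊑ s₁ ∷ s₀ ∩′ s₁ ⊑ ∅′ ∷ []) (s₀ ∩′ (s₂ ∪′ s₃)) ∅′
      (E N₂ ∷ E N₁ ∷ U₂ ∷ A₁ ∷ []) S₂.U₁∩R A₁⊆R₁ S₂.R₁∩R₂
  ; B₁B₂ = ⊆-by (s₂ ∩′ (s₀ ∪′ s₁) ⊑ ∅′ ∷ s₄ ∩′ (s₀ ∪′ s₁) ⊑ ∅′ ∷ s₃ ⊑ s₁ ∷ s₅ ⊑ s₀ ∷ s₀ ∩′ s₁ ⊑ ∅′ ∷ s₂ ∩′ s₄ ⊑ ∅′ ∷ [])
      ((s₂ ∪′ s₃) ∩′ (s₄ ∪′ s₅)) ∅′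
      (E N₁ ∷ E N₂ ∷ U₁ ∷ A₂ ∷ U₂ ∷ A₁ ∷ [])
      S₁.U₁∩R S₁.U₂∩R A₂⊆R₂ A₁⊆R₁ S₁.R₁∩R₂ (Empty⇒⊆∅ U₁U₂-disj)
  ; size₁ = S₁.size ; size₂ = S₂.size ; rank-E = S₁.ρ-E
  ; ρ≤bound₁ = S₁.ρ≤bound ; ρ≤bound₂ = S₂.ρ≤bound
  ; attained = λ X X⊆E → cases X X⊆E (Equivalence.to (cyclicFlats (cyc X)) (cyc-cyclicFlat X))
  ; free₁ = S₁.free ; free₂ = S₂.free
  -- `∅` is a flat, so there are no loops; `E M` is cyclic, so there are no coloops.
  ; loopless = λ e e∈E → ≤-trans (s≤s z≤n)
      (≤-trans (RankCyclicFlat.flat (rankCyclicFlat (Equivalence.from (cyclicFlats ∅) (inj₁ refl))) e e∈E ∉⊥)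
        (mono (⊆-by [] (∅′ ∪′ s₀) s₀ (⁅ e ⁆ ∷ []))))
  ; coloopless = λ e e∈E → subst (_≤ ρ M (E M ─ ⁅ e ⁆)) S₁.ρ-E
      (RankCyclicFlat.cyclic (rankCyclicFlat (Equivalence.from (cyclicFlats (E M)) (inj₂ (inj₁ refl)))) e e∈E)
  }
  where
  open IsMk S
  open MatroidTheory M-matroid
  module S₁ = OneSide S
  module S₂ = OneSide (IsMk-sym S)
  B₁ = U₁ ∪ A₂
  B₂ = U₂ ∪ A₁
  cases : ∀ X → X ⊆ E M →
    (cyc X ≡ ∅ ⊎ cyc X ≡ E M ⊎ (∃ λ F → Z' N₁ F × cyc X ≡ F ∪ B₁) ⊎ (∃ λ F → Z' N₂ F × cyc X ≡ F ∪ B₂)) →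
    ∣ X ∣ ≤ ρ M X ⊎ k ≤ ρ M X ⊎ bound N₁ B₁ X ≤ ρ M X ⊎ bound N₂ B₂ X ≤ ρ M X
  cases X X⊆E (inj₁ cyc≡∅) = inj₁
    (≤-by (s₀ ⊑ s₁ ∷ s₀ ∩′ s₁ ⊑ s₂ ∷ s₃ ⊑ ∅′ ∷ []) (n₀ ⊕ ∣ s₂ ─′ s₃ ∣′ ≼ n₁ ∷ []) ∣ s₀ ∣′ n₁
      (X ∷ E M ∷ cl X ∷ cyc X ∷ []) (ρ M (cyc X) ∷ ρ M X ∷ [])
      X⊆E (⊆cl X) (⊆-reflexive cyc≡∅) (ρ-cyc X))
  cases X X⊆E (inj₂ (inj₁ cyc≡E)) = inj₂ (inj₁
    (≤-trans (≤-reflexive (sym (trans (cong (ρ M) cyc≡E) S₁.ρ-E))) (≤-trans (m≤m+n _ _) (ρ-cyc X))))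
  cases X X⊆E (inj₂ (inj₂ (inj₁ z))) = inj₂ (inj₂ (inj₁ (S₁.bound≤ρ X X⊆E z)))
  cases X X⊆E (inj₂ (inj₂ (inj₂ z))) = inj₂ (inj₂ (inj₂ (S₂.bound≤ρ X X⊆E z)))

-- Isomorphisms and minors

ground-≡ : {A : Matroid n} {x y : Ground A} → proj₁ x ≡ proj₁ y → x ≡ y
ground-≡ {x = x , p} {y = .x , q} refl = cong (x ,_) ([]=-irrelevant p q)

Iso-sym : ∀ {m} {A : Matroid m} {B : Matroid n} → Iso A B → Iso B A
Iso-sym {A = A} {B} (φ , rank) = mk↔ₛ′ from to strictlyInverseʳ strictlyInverseˡ , λ X Y X⊆ Y⊆ h →
  sym (rank Y X Y⊆ X⊆ λ x x∈A →
    subst (λ z → z ∈ Y ⇔ proj₁ (to (x , x∈A)) ∈ X) (cong proj₁ (strictlyInverseʳ (x , x∈A)))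
      (mk⇔ (Equivalence.from (h _ (proj₂ (to (x , x∈A))))) (Equivalence.to (h _ (proj₂ (to (x , x∈A)))))))
  where open Inverse φ

Iso-relabel : (A B : Matroid n) → E A ≡ E B → (∀ X → X ⊆ E A → r A X ≡ r B X) → Iso A B
Iso-relabel (mat G _) (mat .G r′) refl same = mk↔ₛ′ (λ x → x) (λ x → x) (λ _ → refl) (λ _ → refl) ,
  λ X Y X⊆ Y⊆ h → trans (same X X⊆) (cong r′ (⊆-antisym
    (λ x∈X → Equivalence.to (h _ (X⊆ x∈X)) x∈X) (λ x∈Y → Equivalence.from (h _ (Y⊆ x∈Y)) x∈Y)))

module Image {n} {N A : Matroid n} (ι : Iso N A) where
  open Inverse (proj₁ ι) using (to; from; strictlyInverseˡ; strictlyInverseʳ)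

  φ : ∀ {x} → x ∈ E N → Fin n
  φ {x} x∈ = proj₁ (to (x , x∈))

  φ∈ : ∀ {x} (x∈ : x ∈ E N) → φ x∈ ∈ E A
  φ∈ {x} x∈ = proj₂ (to (x , x∈))

  φ⁻¹ : ∀ {y} → y ∈ E A → Fin n
  φ⁻¹ {y} y∈ = proj₁ (from (y , y∈))

  φ⁻¹∈ : ∀ {y} (y∈ : y ∈ E A) → φ⁻¹ y∈ ∈ E N
  φ⁻¹∈ {y} y∈ = proj₂ (from (y , y∈))

  -- The bijection acts on elements paired with membership proofs; irrelevance of these proofs makes
  -- the preimage depend on `y` alone.
  inImage? : ∀ X y → Dec (Σ (y ∈ E A) λ y∈ → φ⁻¹ y∈ ∈ X)
  inImage? X y with y ∈? E A
  ... | no y∉ = no λ (y∈ , _) → y∉ y∈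
  ... | yes y∈ with φ⁻¹ y∈ ∈? X
  ...   | yes in-X = yes (y∈ , in-X)
  ...   | no ¬in-X = no λ (y∈′ , in-X) → ¬in-X (subst (λ p → φ⁻¹ p ∈ X) ([]=-irrelevant y∈′ y∈) in-X)

  img : Subset n → Subset n
  img X = comprehension (inImage? X)

  ∈img⁻ : ∀ {X y} (y∈ : y ∈ E A) → y ∈ img X → φ⁻¹ y∈ ∈ X
  ∈img⁻ {X} y∈ y∈img = let (y∈′ , in-X) = ∈-comprehension⁻ (inImage? X) y∈img in
    subst (λ p → φ⁻¹ p ∈ X) ([]=-irrelevant y∈′ y∈) in-X

  ∈img⁺ : ∀ {X y} (y∈ : y ∈ E A) → φ⁻¹ y∈ ∈ X → y ∈ img X
  ∈img⁺ {X} y∈ in-X = ∈-comprehension⁺ (inImage? X) (y∈ , in-X)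

  img⊆ : ∀ X → img X ⊆ E A
  img⊆ X y∈ = proj₁ (∈-comprehension⁻ (inImage? X) y∈)

  φ∈img : ∀ {X x} (x∈ : x ∈ E N) → x ∈ X → φ x∈ ∈ img X
  φ∈img {X} x∈ x∈X = ∈img⁺ (φ∈ x∈) (subst (_∈ X) (sym (cong proj₁ (strictlyInverseʳ (_ , x∈)))) x∈X)

  φ∈img⁻ : ∀ {X x} (x∈ : x ∈ E N) → φ x∈ ∈ img X → x ∈ X
  φ∈img⁻ {X} x∈ φx∈ = subst (_∈ X) (cong proj₁ (strictlyInverseʳ (_ , x∈))) (∈img⁻ (φ∈ x∈) φx∈)

  rank-img : ∀ {X} → X ⊆ E N → r N X ≡ r A (img X)
  rank-img {X} X⊆ = proj₂ ι X (img X) X⊆ (img⊆ X) λ x x∈ → mk⇔ (φ∈img x∈) (φ∈img⁻ x∈)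

  img-E : img (E N) ≡ E A
  img-E = ⊆-antisym (img⊆ (E N)) λ y∈ → ∈img⁺ y∈ (φ⁻¹∈ y∈)

  img-∪ : ∀ X Y → img (X ∪ Y) ≡ img X ∪ img Y
  img-∪ X Y = ⊆-antisym
    (λ y∈ → let y∈A = img⊆ (X ∪ Y) y∈ in
      x∈p∪q⁺ (map-⊎ (∈img⁺ y∈A) (∈img⁺ y∈A) (x∈p∪q⁻ X Y (∈img⁻ y∈A y∈))))
    (λ y∈ → [ (λ y∈X → ∈img⁺ (img⊆ X y∈X) (p⊆p∪q Y (∈img⁻ (img⊆ X y∈X) y∈X)))
                     , (λ y∈Y → ∈img⁺ (img⊆ Y y∈Y) (q⊆p∪q X Y (∈img⁻ (img⊆ Y y∈Y) y∈Y))) ]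
            (x∈p∪q⁻ (img X) (img Y) y∈))

  img-─ : ∀ X Y → img (X ─ Y) ≡ img X ─ img Y
  img-─ X Y = ⊆-antisym
    (λ y∈ → let y∈A = img⊆ (X ─ Y) y∈ ; y∈X─Y = ∈img⁻ y∈A y∈ in
      x∈p∧x∉q⇒x∈p─q (∈img⁺ y∈A (p─q⊆p X Y y∈X─Y)) λ y∈Y → ∉─ X Y y∈X─Y (∈img⁻ y∈A y∈Y))
    (λ y∈ → let y∈A = img⊆ X (p─q⊆p (img X) (img Y) y∈) in
      ∈img⁺ y∈A (x∈p∧x∉q⇒x∈p─q (∈img⁻ y∈A (p─q⊆p (img X) (img Y) y∈))
        λ in-Y → ∉─ (img X) (img Y) y∈ (∈img⁺ y∈A in-Y)))
    where
    ∉─ : ∀ X Y {x} → x ∈ X ─ Y → x ∉ Y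
    ∉─ X Y {x} x∈ = ⊆∅⇒∉ (⊆-by (s₂ ⊑ s₀ ─′ s₁ ∷ []) (s₂ ∩′ s₁) ∅′ (X ∷ Y ∷ ⁅ x ⁆ ∷ []) (⁅⁆⊆ x∈))

  img-⁅⁆ : ∀ {x} (x∈ : x ∈ E N) → img ⁅ x ⁆ ≡ ⁅ φ x∈ ⁆
  img-⁅⁆ {x} x∈ = ⊆-antisym
    (λ {y} y∈ → let y∈A = img⊆ ⁅ x ⁆ y∈ in
      subst (_∈ ⁅ φ x∈ ⁆) (trans (cong (proj₁ ∘ to) (ground-≡ {A = N} (sym (x∈⁅y⁆⇒x≡y x (∈img⁻ y∈A y∈)))))
                                 (cong proj₁ (strictlyInverseˡ (y , y∈A))))
        (x∈⁅x⁆ (φ x∈)))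
    (⁅⁆⊆ (φ∈img x∈ (x∈⁅x⁆ x)))

  img-⁅φ⁻¹⁆ : ∀ {y} (y∈ : y ∈ E A) → img ⁅ φ⁻¹ y∈ ⁆ ≡ ⁅ y ⁆
  img-⁅φ⁻¹⁆ {y} y∈ = trans (img-⁅⁆ (φ⁻¹∈ y∈)) (cong ⁅_⁆ (cong proj₁ (strictlyInverseˡ (y , y∈))))

  img-injective : ∀ {X Y} → X ⊆ E N → img X ⊆ img Y → X ⊆ Y
  img-injective X⊆ h x∈X = φ∈img⁻ (X⊆ x∈X) (h (φ∈img (X⊆ x∈X) x∈X))

  ∣img∣ : ∀ X → X ⊆ E N → ∣ img X ∣ ≡ ∣ X ∣
  ∣img∣ = subset-induction (λ X → X ⊆ E N → ∣ img X ∣ ≡ ∣ X ∣)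
    (λ _ → cong ∣_∣ (⊆-antisym (λ y∈ → ⊥-elim (∉⊥ (∈img⁻ (img⊆ ∅ y∈) y∈))) (λ x∈ → ⊥-elim (∉⊥ x∈))))
    (λ X e e∉X ih X∪e⊆ →
      let e∈ = X∪e⊆ (q⊆p∪q X ⁅ e ⁆ (x∈⁅x⁆ e))
          eq = trans (img-∪ X ⁅ e ⁆) (cong (img X ∪_) (img-⁅⁆ e∈))
          ih′ = ih (X∪e⊆ ∘ p⊆p∪q ⁅ e ⁆)
      in trans (cong ∣_∣ eq) (≤-antisym
        (≤-by (s₁ ∩′ s₀ ⊑ ∅′ ∷ []) (∣ s₂ ∣′ ≼ ∣ s₀ ∣′ ∷ ∣ s₃ ∣′ ≼ con 1 ∷ con 1 ≼ ∣ s₁ ∣′ ∷ []) ∣ s₂ ∪′ s₃ ∣′ ∣ s₀ ∪′ s₁ ∣′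
          (X ∷ ⁅ e ⁆ ∷ img X ∷ ⁅ φ e∈ ⁆ ∷ []) [] (∉⇒⊆∅ e∉X) (≤-reflexive ih′) (∣⁅⁆∣≤ (φ e∈)) (≤∣⁅⁆∣ e))
        (≤-by (s₁ ∩′ s₀ ⊑ ∅′ ∷ []) (∣ s₂ ∣′ ≼ ∣ s₀ ∣′ ∷ ∣ s₃ ∣′ ≼ con 1 ∷ con 1 ≼ ∣ s₁ ∣′ ∷ []) ∣ s₂ ∪′ s₃ ∣′ ∣ s₀ ∪′ s₁ ∣′
          (img X ∷ ⁅ φ e∈ ⁆ ∷ X ∷ ⁅ e ⁆ ∷ []) []
          (∉⇒⊆∅ λ φe∈ → e∉X (φ∈img⁻ e∈ φe∈)) (≤-reflexive (sym ih′)) (∣⁅⁆∣≤ e) (≤∣⁅⁆∣ (φ e∈)))))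

-- A fixed matroid `A` can be a minor of `M` in several ways; keeping `A` apart from `C` and `D`
-- lets these change under it. The rank condition is additive, so no truncated subtraction has to be
-- undone.
record Presented (M A : Matroid n) (C D : Subset n) : Set where
  field
    C⊆E  : C ⊆ E M
    D⊆E  : D ⊆ E M
    C∩D  : C ∩ D ⊆ ∅
    E≡   : E A ≡ (E M ─ C) ─ D
    rank : ∀ Y → Y ⊆ E A → r A Y + ρ M C ≡ ρ M (Y ∪ C)

module _ {M : Matroid n} (isM : IsMatroid M) where
  open MatroidTheory isM

  presented-minor : ∀ {A C D C₀ D₀} → Presented M A C₀ D₀ → ValidMinor A C D →
                    Presented M (minor A C D) (C₀ ∪ C) (D₀ ∪ D)
  presented-minor {A} {C} {D} {C₀} {D₀} P (C⊆ , D⊆ , C#D) = record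
    { C⊆E = ⊆-by (s₂ ⊑ s₁ ∷ s₃ ⊑ s₀ ∷ s₀ ⊑ (s₁ ─′ s₂) ─′ s₄ ∷ []) (s₂ ∪′ s₃) s₁
        (E A ∷ E M ∷ C₀ ∷ C ∷ D₀ ∷ []) C⊆E C⊆ (⊆-reflexive E≡)
    ; D⊆E = ⊆-by (s₄ ⊑ s₁ ∷ s₃ ⊑ s₀ ∷ s₀ ⊑ (s₁ ─′ s₂) ─′ s₄ ∷ []) (s₄ ∪′ s₃) s₁
        (E A ∷ E M ∷ C₀ ∷ D ∷ D₀ ∷ []) D⊆E D⊆ (⊆-reflexive E≡)
    ; C∩D = ⊆-by (s₂ ∩′ s₄ ⊑ ∅′ ∷ s₃ ∩′ s₅ ⊑ ∅′ ∷ s₃ ⊑ s₀ ∷ s₅ ⊑ s₀ ∷ s₀ ⊑ (s₁ ─′ s₂) ─′ s₄ ∷ [])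
        ((s₂ ∪′ s₃) ∩′ (s₄ ∪′ s₅)) ∅′
        (E A ∷ E M ∷ C₀ ∷ C ∷ D₀ ∷ D ∷ []) C∩D (Empty⇒⊆∅ C#D) C⊆ D⊆ (⊆-reflexive E≡)
    ; E≡ = trans (cong (λ G → (G ─ C) ─ D) E≡)
        (≡-by [] (((s₁ ─′ s₂) ─′ s₄) ─′ s₃ ─′ s₅) ((s₁ ─′ (s₂ ∪′ s₃)) ─′ (s₄ ∪′ s₅))
          (E A ∷ E M ∷ C₀ ∷ C ∷ D₀ ∷ D ∷ []))
    ; rank = rank′
    }
    where
    open Presented P
    G = (E A ─ C) ─ D
    rank′ : ∀ Y → Y ⊆ G → r (minor A C D) Y + ρ M (C₀ ∪ C) ≡ ρ M (Y ∪ C₀ ∪ C)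
    rank′ Y Y⊆ = begin
      (r A ((Y ∩ G) ∪ C) ∸ r A C) + ρ M (C₀ ∪ C)
        ≡⟨ cong₂ (λ Z m → (r A (Z ∪ C) ∸ r A C) + m)
             (≡-by (s₀ ⊑ s₁ ∷ []) (s₀ ∩′ s₁) s₀ (Y ∷ G ∷ []) Y⊆)
             (trans (cong (ρ M) (∪-comm C₀ C)) (sym (rank C C⊆))) ⟩
      (r A (Y ∪ C) ∸ r A C) + (r A C + ρ M C₀)
        ≡⟨ sym (+-assoc (r A (Y ∪ C) ∸ r A C) (r A C) (ρ M C₀)) ⟩
      (r A (Y ∪ C) ∸ r A C) + r A C + ρ M C₀
        ≡⟨ cong (_+ ρ M C₀) (m∸n+n≡m (+-cancelʳ-≤ (ρ M C₀) _ _
             (subst₂ _≤_ (sym (rank C C⊆)) (sym (rank (Y ∪ C) Y∪C⊆))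
               (mono (⊆-by [] (s₁ ∪′ s₂) ((s₀ ∪′ s₁) ∪′ s₂) (Y ∷ C ∷ C₀ ∷ [])))))) ⟩
      r A (Y ∪ C) + ρ M C₀
        ≡⟨ rank (Y ∪ C) Y∪C⊆ ⟩
      ρ M ((Y ∪ C) ∪ C₀)
        ≡⟨ cong (ρ M) (≡-by [] ((s₀ ∪′ s₁) ∪′ s₂) (s₀ ∪′ s₂ ∪′ s₁) (Y ∷ C ∷ C₀ ∷ [])) ⟩
      ρ M (Y ∪ C₀ ∪ C) ∎
      where
      open ≡-Reasoning
      Y∪C⊆ : Y ∪ C ⊆ E A
      Y∪C⊆ = ⊆-by (s₀ ⊑ (s₂ ─′ s₁) ─′ s₃ ∷ s₁ ⊑ s₂ ∷ []) (s₀ ∪′ s₁) s₂ (Y ∷ C ∷ E A ∷ D ∷ []) Y⊆ C⊆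

  presented-self : Presented M M ∅ ∅
  presented-self = record
    { C⊆E = λ x∈ → ⊥-elim (∉⊥ x∈) ; D⊆E = λ x∈ → ⊥-elim (∉⊥ x∈) ; C∩D = ⊆-by [] (∅′ ∩′ ∅′) ∅′ []
    ; E≡ = ≡-by [] s₀ ((s₀ ─′ ∅′) ─′ ∅′) (E M ∷ [])
    ; rank = λ Y Y⊆ → trans (cong₂ _+_ (sym (ρ≡r M Y⊆)) (n≤0⇒n≡0 (≤-trans (bounded ∅) (≤-reflexive (∣⊥∣≡0 n)))))
        (trans (+-identityʳ _) (cong (ρ M) (≡-by [] s₀ (s₀ ∪′ ∅′) (Y ∷ []))))
    }

  -- Dependent elements of C can be deleted instead of contracted, and elements
  -- of D whose deletion lowers the rank can be contracted instead of deleted.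
  normalise : ∀ {A C D} I J → Presented M A C D → I ⊆ C → ∣ I ∣ ≤ ρ M I →
              J ⊆ D → ρ M (E M) ≤ ρ M (E M ─ J) →
              ∃ λ C′ → ∃ λ D′ → Presented M A C′ D′ × I ⊆ C′ × J ⊆ D′ ×
                ∣ C′ ∣ ≤ ρ M C′ × ρ M (E M) ≤ ρ M (E M ─ D′)
  normalise {A} {C} {D} I J P I⊆C I-ind J⊆D J-coind =
    let
      G = (E M ─ C) ─ D
      -- `I ∪ W` is a basis of `C`. `V` collects the elements of `D ─ J` needed to extend `C ∪ G` to
      -- a spanning set; these are the ones to contract. Coindependence of `J` is why `D ─ J` is
      -- enough.
      (W , W⊆ , W-span , W-ind) = relative-basis I C
      (V , V⊆ , V-span , V-ind) = relative-basis (C ∪ G) (D ─ J)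
      B = I ∪ W
      C′ = B ∪ V
      D′ = (C ∪ D) ─ C′
      B⊆C = ⊆-by (s₀ ⊑ s₂ ∷ s₁ ⊑ s₂ ∷ []) (s₀ ∪′ s₁) s₂ (I ∷ W ∷ C ∷ []) I⊆C W⊆
      C≤B : ρ M C ≤ ρ M B
      C≤B = ≤-trans (mono (q⊆p∪q I C)) W-span
      B-ind : ∣ B ∣ ≤ ρ M B
      B-ind = ≤-by [] (∣ s₀ ∣′ ≼ n₀ ∷ n₀ ⊕ ∣ s₁ ∣′ ≼ n₁ ∷ n₁ ≼ n₂ ∷ []) ∣ s₀ ∪′ s₁ ∣′ n₂
        (I ∷ W ∷ []) (ρ M I ∷ ρ M (I ∪ C) ∷ ρ M B ∷ []) I-ind W-ind W-span
      -- `V` is independent over `C ∪ G`, hence over every `Z ∪ C` with `Z ⊆ G`. So contracting `V`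
      -- shifts all these ranks by the same `|V|` and leaves the minor unchanged.
      lower : ∀ Z → Z ⊆ G → ρ M (Z ∪ C) + ∣ V ∣ ≤ ρ M (Z ∪ C′)
      lower = λ Z Z⊆G → lin
        (n₀ ⊕ n₁ ≼ n₂ ⊕ n₃ ∷ n₃ ⊕ n₄ ≼ n₈ ∷ n₈ ≼ n₀ ∷ n₂ ⊕ n₅ ≼ n₆ ⊕ n₇ ∷ n₇ ≼ n₅ ∷ []) (n₁ ⊕ n₄) n₆
        (ρ M ((C ∪ G) ∪ V) ∷ ρ M (Z ∪ C) ∷ ρ M (Z ∪ C ∪ V) ∷ ρ M (C ∪ G) ∷ ∣ V ∣ ∷ ρ M B ∷
         ρ M (Z ∪ C′) ∷ ρ M C ∷ ρ M ((C ∪ G) ∪ (D ─ J)) ∷ [])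
        (submodular (Z ∪ C ∪ V) (C ∪ G)
          (⊆-by [] ((s₁ ∪′ s₃) ∪′ s₂) ((s₀ ∪′ s₁ ∪′ s₂) ∪′ (s₁ ∪′ s₃)) (Z ∷ C ∷ V ∷ G ∷ []))
          (⊆-by (s₀ ⊑ s₃ ∷ []) (s₀ ∪′ s₁) ((s₀ ∪′ s₁ ∪′ s₂) ∩′ (s₁ ∪′ s₃)) (Z ∷ C ∷ V ∷ G ∷ []) Z⊆G))
        V-ind V-span
        (submodular (Z ∪ C′) C
          (⊆-by [] (s₀ ∪′ s₁ ∪′ s₂) ((s₀ ∪′ s₃ ∪′ s₂) ∪′ s₁) (Z ∷ C ∷ V ∷ B ∷ []))
          (⊆-by (s₃ ⊑ s₁ ∷ []) s₃ ((s₀ ∪′ s₃ ∪′ s₂) ∩′ s₁) (Z ∷ C ∷ V ∷ B ∷ []) B⊆C))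
        C≤B
      upper : ∀ Z → ρ M (Z ∪ C′) ≤ ρ M (Z ∪ C) + ∣ V ∣
      upper = λ Z → ≤-by (s₃ ⊑ s₁ ∷ []) (n₀ ≼ n₁ ⊕ ∣ (s₀ ∪′ s₃ ∪′ s₂) ─′ (s₀ ∪′ s₁) ∣′ ∷ []) n₀ (n₁ ⊕ ∣ s₂ ∣′)
        (Z ∷ C ∷ V ∷ B ∷ []) (ρ M (Z ∪ C′) ∷ ρ M (Z ∪ C) ∷ []) B⊆C (increase (Z ∪ C′) (Z ∪ C))
      C′-rank : ρ M C′ ≡ ρ M C + ∣ V ∣
      C′-rank = subst₂ (λ P Q → ρ M P ≡ ρ M Q + ∣ V ∣)
        (≡-by [] (∅′ ∪′ s₀) s₀ (C′ ∷ [])) (≡-by [] (∅′ ∪′ s₀) s₀ (C ∷ []))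
        (≤-antisym (upper ∅) (lower ∅ λ x∈ → ⊥-elim (∉⊥ x∈)))
    in C′ , D′ , record
      { C⊆E = ⊆-by (s₀ ⊑ s₁ ∷ s₂ ⊑ s₃ ─′ s₄ ∷ s₁ ⊑ s₅ ∷ s₃ ⊑ s₅ ∷ []) (s₀ ∪′ s₂) s₅
          (B ∷ C ∷ V ∷ D ∷ J ∷ E M ∷ []) B⊆C V⊆ C⊆E D⊆E
      ; D⊆E = ⊆-by (s₀ ⊑ s₃ ∷ s₁ ⊑ s₃ ∷ []) ((s₀ ∪′ s₁) ─′ s₂) s₃ (C ∷ D ∷ C′ ∷ E M ∷ []) C⊆E D⊆E
      ; C∩D = ⊆-by [] (s₂ ∩′ ((s₀ ∪′ s₁) ─′ s₂)) ∅′ (C ∷ D ∷ C′ ∷ [])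
      ; E≡ = trans E≡ (≡-by (s₀ ⊑ s₁ ∷ s₂ ⊑ s₃ ─′ s₄ ∷ [])
          ((s₅ ─′ s₁) ─′ s₃) ((s₅ ─′ (s₀ ∪′ s₂)) ─′ ((s₁ ∪′ s₃) ─′ (s₀ ∪′ s₂)))
          (B ∷ C ∷ V ∷ D ∷ J ∷ E M ∷ []) B⊆C V⊆)
      ; rank = λ Y Y⊆ → begin
          r A Y + ρ M C′             ≡⟨ cong (r A Y +_) C′-rank ⟩
          r A Y + (ρ M C + ∣ V ∣)    ≡⟨ sym (+-assoc (r A Y) (ρ M C) ∣ V ∣) ⟩
          r A Y + ρ M C + ∣ V ∣      ≡⟨ cong (_+ ∣ V ∣) (rank Y Y⊆) ⟩
          ρ M (Y ∪ C) + ∣ V ∣        ≡⟨ ≤-antisym (lower Y (subst (Y ⊆_) E≡ Y⊆)) (upper Y) ⟩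
          ρ M (Y ∪ C′)               ∎
      } ,
      p⊆p∪q V ∘ p⊆p∪q W ,
      ⊆-by (s₀ ⊑ s₁ ∷ s₂ ⊑ s₃ ─′ s₄ ∷ s₄ ⊑ s₃ ∷ s₁ ∩′ s₃ ⊑ ∅′ ∷ []) s₄ ((s₁ ∪′ s₃) ─′ (s₀ ∪′ s₂))
          (B ∷ C ∷ V ∷ D ∷ J ∷ []) B⊆C V⊆ J⊆D C∩D ,
      ≤-by [] (∣ s₀ ∣′ ≼ n₀ ∷ n₀ ≼ n₁ ∷ n₁ ⊕ ∣ s₁ ∣′ ≼ n₂ ∷ []) ∣ s₀ ∪′ s₁ ∣′ n₂
          (B ∷ V ∷ []) (ρ M B ∷ ρ M C ∷ ρ M C′ ∷ []) B-ind (mono B⊆C) (≤-reflexive (sym C′-rank)) ,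
      lin (n₀ ≼ n₁ ∷ n₁ ≼ n₂ ∷ n₂ ≼ n₃ ∷ n₃ ≼ n₄ ⊕ n₅ ∷ n₄ ⊕ n₅ ≼ n₆ ∷ n₆ ≼ n₇ ∷ []) n₀ n₇
        (ρ M (E M) ∷ ρ M (E M ─ J) ∷ ρ M ((C ∪ G) ∪ (D ─ J)) ∷ ρ M ((C ∪ G) ∪ V) ∷ ρ M (G ∪ C) ∷ ∣ V ∣ ∷
         ρ M (G ∪ C′) ∷ ρ M (E M ─ D′) ∷ [])
        J-coind
        (mono (⊆-by [] (s₀ ─′ s₃) ((s₁ ∪′ ((s₀ ─′ s₁) ─′ s₂)) ∪′ (s₂ ─′ s₃)) (E M ∷ C ∷ D ∷ J ∷ [])))
        V-span
        (≤-by [] (n₀ ≼ n₁ ⊕ ∣ ((s₀ ∪′ s₁) ∪′ s₂) ─′ (s₁ ∪′ s₀) ∣′ ∷ []) n₀ (n₁ ⊕ ∣ s₂ ∣′)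
          (C ∷ G ∷ V ∷ []) (ρ M ((C ∪ G) ∪ V) ∷ ρ M (G ∪ C) ∷ []) (increase ((C ∪ G) ∪ V) (G ∪ C)))
        (lower G (λ x → x))
        (mono (⊆-by (s₀ ⊑ s₁ ∷ s₂ ⊑ s₃ ─′ s₄ ∷ s₁ ⊑ s₅ ∷ s₃ ⊑ s₅ ∷ [])
          (((s₅ ─′ s₁) ─′ s₃) ∪′ s₀ ∪′ s₂) (s₅ ─′ ((s₁ ∪′ s₃) ─′ (s₀ ∪′ s₂)))
          (B ∷ C ∷ V ∷ D ∷ J ∷ E M ∷ []) B⊆C V⊆ C⊆E D⊆E))
    where
    open Presented P
    open ≡-Reasoning

-- Iterated free extensions and coextensions

Iso-refl : (A : Matroid n) → Iso A A
Iso-refl A = Iso-relabel A A refl (λ _ _ → refl)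

module _ (N : Matroid n) {x : Fin n} where

  freeExt-∈ : ∀ {X} → x ∈ X → r (freeExt N x) X ≡ suc (r N (X ∩ E N)) ⊓ rk N
  freeExt-∈ {X} x∈X = cong (λ t → if t then suc (r N (X ∩ E N)) ⊓ rk N else r N (X ∩ E N)) ([]=⇒lookup x∈X)

  freeExt-∉ : ∀ {X} → x ∉ X → r (freeExt N x) X ≡ r N (X ∩ E N)
  freeExt-∉ {X} x∉X with lookup X x in eq
  ... | true  = ⊥-elim (x∉X (lookup⇒[]= x X eq))
  ... | false = refl

-- These inequalities suffice to evaluate the dual rank without truncation and survive free
-- coextension; carrying them along spares a proof that each iterate is a matroid.
record IsSubcardinal (N : Matroid n) : Set where
  field
    bounded  : ∀ X → X ⊆ E N → r N X ≤ ∣ X ∣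
    spanning : ∀ X → X ⊆ E N → rk N ≤ r N X + ∣ E N ─ X ∣

  dual-rank : ∀ X → X ⊆ E N → r (dual N) X + rk N ≡ ∣ X ∣ + r N (E N ─ X)
  dual-rank X X⊆E = trans
    (m∸n+n≡m (≤-by (s₀ ⊑ s₁ ∷ []) (n₁ ≼ n₀ ⊕ ∣ s₁ ─′ (s₁ ─′ s₀) ∣′ ∷ []) n₁ (∣ s₀ ∩′ s₁ ∣′ ⊕ n₀)
      (X ∷ E N ∷ []) (r N (E N ─ X) ∷ rk N ∷ []) X⊆E (spanning (E N ─ X) (p─q⊆p (E N) X))))
    (cong (λ Z → ∣ Z ∣ + r N (E N ─ X)) (≡-by (s₀ ⊑ s₁ ∷ []) (s₀ ∩′ s₁) s₀ (X ∷ E N ∷ []) X⊆E))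

module _ {N : Matroid n} (sub : IsSubcardinal N) {x : Fin n} (x∉E : x ∉ E N) where
  open IsSubcardinal sub
  private
    E′ : Subset n
    E′ = E N ∪ ⁅ x ⁆

    r* : Subset n → ℕ
    r* = r (freeExt (dual N) x)

    x∩E : ⁅ x ⁆ ∩ E N ⊆ ∅
    x∩E = ∉⇒⊆∅ x∉E

    r∅ : r N ∅ ≡ 0
    r∅ = n≤0⇒n≡0 (≤-trans (bounded ∅ (λ x∈ → ⊥-elim (∉⊥ x∈))) (≤-reflexive (∣⊥∣≡0 n)))

    corank : rk (dual N) + rk N ≡ ∣ E N ∣
    corank = trans (dual-rank (E N) (λ x → x)) (trans
      (cong (λ Z → ∣ E N ∣ + r N Z) (≡-by [] (s₀ ─′ s₀) ∅′ (E N ∷ [])))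
      (trans (cong (∣ E N ∣ +_) r∅) (+-identityʳ _)))

    r*-E′ : r* E′ ≡ rk (dual N)
    r*-E′ = trans (freeExt-∈ (dual N) (q⊆p∪q (E N) ⁅ x ⁆ (x∈⁅x⁆ x))) (trans
      (cong (λ Z → suc (r (dual N) Z) ⊓ rk (dual N)) (≡-by [] ((s₀ ∪′ s₁) ∩′ s₀) s₀ (E N ∷ ⁅ x ⁆ ∷ [])))
      (m≥n⇒m⊓n≡n (n≤1+n (rk (dual N)))))

  -- One minimum covers both cases: if `x ∈ X` the second term is never the larger, since `X ∩ E N`
  -- misses `x`; if `x ∉ X` the cardinality is the smaller exactly when `X` is independent in `N`.
  freeCoext-rank : ∀ X → X ⊆ E′ → r (freeCoext N x) X ≡ ∣ X ∣ ⊓ suc (r N (X ∩ E N))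
  freeCoext-rank X X⊆E′ = trans (cong (∣ X ∩ E′ ∣ + r* (E′ ─ X) ∸_) r*-E′)
    (trans (cong (_∸ rk (dual N)) shifted) (m+n∸n≡m (∣ X ∣ ⊓ suc (r N (X ∩ E N))) (rk (dual N))))
    where
    X∩E = X ∩ E N

    E∖X : (E′ ─ X) ∩ E N ≡ E N ─ X
    E∖X = ≡-by [] (((s₀ ∪′ s₁) ─′ s₂) ∩′ s₀) (s₀ ─′ s₂) (E N ∷ ⁅ x ⁆ ∷ X ∷ [])

    p : ℕ
    p = r (dual N) (E N ─ X)

    p-rank : p + rk N ≡ ∣ E N ─ X ∣ + r N X∩E
    p-rank = trans (dual-rank (E N ─ X) (p─q⊆p (E N) X))
      (cong (λ Z → ∣ E N ─ X ∣ + r N Z) (≡-by [] (s₀ ─′ (s₀ ─′ s₁)) (s₁ ∩′ s₀) (E N ∷ X ∷ [])))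

    shifted : ∣ X ∩ E′ ∣ + r* (E′ ─ X) ≡ ∣ X ∣ ⊓ suc (r N X∩E) + rk (dual N)
    shifted with x ∈? X
    ... | yes x∈X = begin
        ∣ X ∩ E′ ∣ + r* (E′ ─ X)
          ≡⟨ cong (∣ X ∩ E′ ∣ +_) (trans (freeExt-∉ (dual N) (⊆∅⇒∉ (⊆-by (s₀ ⊑ s₁ ∷ []) (s₀ ∩′ (s₂ ─′ s₁)) ∅′
               (⁅ x ⁆ ∷ X ∷ E′ ∷ []) (⁅⁆⊆ x∈X)))) (cong (r (dual N)) E∖X)) ⟩
        ∣ X ∩ E′ ∣ + p
          ≡⟨ ≤-antisym
            (≤-by (s₁ ⊑ s₀ ∷ s₁ ∩′ s₂ ⊑ ∅′ ∷ [])
              (n₀ ⊕ n₁ ≼ ∣ s₂ ─′ s₀ ∣′ ⊕ n₂ ∷ ∣ s₂ ∣′ ≼ n₃ ⊕ n₁ ∷ ∣ s₁ ∣′ ≼ con 1 ∷ [])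
              (∣ s₀ ∩′ (s₂ ∪′ s₁) ∣′ ⊕ n₀) (con 1 ⊕ n₂ ⊕ n₃) (X ∷ ⁅ x ⁆ ∷ E N ∷ []) nums
              (⁅⁆⊆ x∈X) x∩E (≤-reflexive p-rank) (≤-reflexive (sym corank)) (∣⁅⁆∣≤ x))
            (≤-by (s₁ ⊑ s₀ ∷ s₁ ∩′ s₂ ⊑ ∅′ ∷ [])
              (∣ s₂ ─′ s₀ ∣′ ⊕ n₂ ≼ n₀ ⊕ n₁ ∷ n₃ ⊕ n₁ ≼ ∣ s₂ ∣′ ∷ con 1 ≼ ∣ s₁ ∣′ ∷ [])
              (con 1 ⊕ n₂ ⊕ n₃) (∣ s₀ ∩′ (s₂ ∪′ s₁) ∣′ ⊕ n₀) (X ∷ ⁅ x ⁆ ∷ E N ∷ []) nums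
              (⁅⁆⊆ x∈X) x∩E (≤-reflexive (sym p-rank)) (≤-reflexive corank) (≤∣⁅⁆∣ x)) ⟩
        suc (r N X∩E) + rk (dual N)
          ≡⟨ cong (_+ rk (dual N)) (sym (m≥n⇒m⊓n≡n
            (≤-by (s₁ ⊑ s₀ ∷ s₁ ∩′ s₂ ⊑ ∅′ ∷ []) (n₂ ≼ ∣ s₀ ∩′ s₂ ∣′ ∷ con 1 ≼ ∣ s₁ ∣′ ∷ []) (con 1 ⊕ n₂) ∣ s₀ ∣′
              (X ∷ ⁅ x ⁆ ∷ E N ∷ []) nums (⁅⁆⊆ x∈X) x∩E (bounded X∩E (p∩q⊆q X (E N))) (≤∣⁅⁆∣ x)))) ⟩
        ∣ X ∣ ⊓ suc (r N X∩E) + rk (dual N) ∎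
      where
      open ≡-Reasoning
      nums = p ∷ rk N ∷ r N X∩E ∷ rk (dual N) ∷ []
    ... | no x∉X = begin
        ∣ X ∩ E′ ∣ + r* (E′ ─ X)
          ≡⟨ cong₂ (λ Z m → ∣ Z ∣ + m) (≡-by (s₀ ⊑ s₁ ∷ []) (s₀ ∩′ s₁) s₀ (X ∷ E′ ∷ []) X⊆E′)
               (trans (freeExt-∈ (dual N) (x∈p∧x∉q⇒x∈p─q (q⊆p∪q (E N) ⁅ x ⁆ (x∈⁅x⁆ x)) x∉X))
                 (cong (λ Z → suc (r (dual N) Z) ⊓ rk (dual N)) E∖X)) ⟩
        ∣ X ∣ + suc p ⊓ rk (dual N)
          ≡⟨ +-distribˡ-⊓ ∣ X ∣ (suc p) (rk (dual N)) ⟩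
        (∣ X ∣ + suc p) ⊓ (∣ X ∣ + rk (dual N))
          ≡⟨ cong (_⊓ (∣ X ∣ + rk (dual N))) (≤-antisym
            (≤-by (s₀ ⊑ s₂ ∪′ s₁ ∷ s₁ ∩′ s₀ ⊑ ∅′ ∷ [])
              (n₀ ⊕ n₁ ≼ ∣ s₂ ─′ s₀ ∣′ ⊕ n₂ ∷ ∣ s₂ ∣′ ≼ n₃ ⊕ n₁ ∷ [])
              (∣ s₀ ∣′ ⊕ (con 1 ⊕ n₀)) (con 1 ⊕ n₂ ⊕ n₃) (X ∷ ⁅ x ⁆ ∷ E N ∷ []) nums
              X⊆E′ (∉⇒⊆∅ x∉X) (≤-reflexive p-rank) (≤-reflexive (sym corank)))
            (≤-by (s₁ ∩′ s₀ ⊑ ∅′ ∷ [])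
              (∣ s₂ ─′ s₀ ∣′ ⊕ n₂ ≼ n₀ ⊕ n₁ ∷ n₃ ⊕ n₁ ≼ ∣ s₂ ∣′ ∷ [])
              (con 1 ⊕ n₂ ⊕ n₃) (∣ s₀ ∣′ ⊕ (con 1 ⊕ n₀)) (X ∷ ⁅ x ⁆ ∷ E N ∷ []) nums
              (∉⇒⊆∅ x∉X) (≤-reflexive (sym p-rank)) (≤-reflexive corank))) ⟩
        (suc (r N X∩E) + rk (dual N)) ⊓ (∣ X ∣ + rk (dual N))
          ≡⟨ ⊓-comm (suc (r N X∩E) + rk (dual N)) _ ⟩
        (∣ X ∣ + rk (dual N)) ⊓ (suc (r N X∩E) + rk (dual N))
          ≡⟨ sym (+-distribʳ-⊓ (rk (dual N)) ∣ X ∣ (suc (r N X∩E))) ⟩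
        ∣ X ∣ ⊓ suc (r N X∩E) + rk (dual N) ∎
      where
      open ≡-Reasoning
      nums = p ∷ rk N ∷ r N X∩E ∷ rk (dual N) ∷ []

  freeCoext-isSubcardinal : IsSubcardinal (freeCoext N x)
  freeCoext-isSubcardinal = record
    { bounded  = λ X X⊆ → ≤-trans (≤-reflexive (freeCoext-rank X X⊆)) (m⊓n≤m _ _)
    ; spanning = λ X X⊆ → subst₂ (λ s t → s ≤ t + ∣ E′ ─ X ∣)
        (sym (freeCoext-rank E′ (λ x → x))) (sym (freeCoext-rank X X⊆))
        (≤-trans (⊓-mono-≤
            (≤-by [] [] ∣ s₁ ∣′ (∣ s₀ ∣′ ⊕ ∣ s₁ ─′ s₀ ∣′) (X ∷ E′ ∷ []) [])
            (≤-by (s₀ ⊑ s₂ ∪′ s₁ ∷ [])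
              (n₁ ≼ n₀ ⊕ ∣ s₂ ─′ (s₀ ∩′ s₂) ∣′ ∷ [])
              (con 1 ⊕ n₁) (con 1 ⊕ n₀ ⊕ ∣ (s₂ ∪′ s₁) ─′ s₀ ∣′)
              (X ∷ ⁅ x ⁆ ∷ E N ∷ []) (r N (X ∩ E N) ∷ r N (E′ ∩ E N) ∷ []) X⊆
              (subst (λ Z → r N Z ≤ r N (X ∩ E N) + ∣ E N ─ (X ∩ E N) ∣)
                (≡-by [] s₀ ((s₀ ∪′ s₁) ∩′ s₀) (E N ∷ ⁅ x ⁆ ∷ []))
                (spanning (X ∩ E N) (p∩q⊆q X (E N))))))
          (≤-reflexive (sym (+-distribʳ-⊓ ∣ E′ ─ X ∣ ∣ X ∣ (suc (r N (X ∩ E N)))))))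
    }

∣∪⁅⁆∣ : e ∉ X → ∣ X ∪ ⁅ e ⁆ ∣ ≡ suc ∣ X ∣
∣∪⁅⁆∣ {e = e} {X = X} e∉X = ≤-antisym
  (≤-by [] (∣ s₁ ∣′ ≼ con 1 ∷ []) ∣ s₀ ∪′ s₁ ∣′ (con 1 ⊕ ∣ s₀ ∣′) (X ∷ ⁅ e ⁆ ∷ []) [] (∣⁅⁆∣≤ e))
  (≤-by (s₁ ∩′ s₀ ⊑ ∅′ ∷ []) (con 1 ≼ ∣ s₁ ∣′ ∷ []) (con 1 ⊕ ∣ s₀ ∣′) ∣ s₀ ∪′ s₁ ∣′ (X ∷ ⁅ e ⁆ ∷ []) []
    (∉⇒⊆∅ e∉X) (≤∣⁅⁆∣ e))

-- The nested minima collapse because a set has at most one element outside the previous ground set,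
-- so only the outermost cardinality counts.
free-coextensions : {N : Matroid n} → IsSubcardinal N → ∀ B → E N ∩ B ⊆ ∅ →
  ∃ λ N′ → Reach N N′ × E N′ ≡ E N ∪ B × IsSubcardinal N′ ×
    (∀ X → X ⊆ E N′ → r N′ X ≡ ∣ X ∣ ⊓ (∣ B ∣ + r N (X ∩ E N)))
free-coextensions {n} {N} sub = subset-induction
  (λ B → E N ∩ B ⊆ ∅ → ∃ λ N′ → Reach N N′ × E N′ ≡ E N ∪ B × IsSubcardinal N′ ×
    (∀ X → X ⊆ E N′ → r N′ X ≡ ∣ X ∣ ⊓ (∣ B ∣ + r N (X ∩ E N))))
  (λ _ → N , iso (Iso-refl N) , ≡-by [] s₀ (s₀ ∪′ ∅′) (E N ∷ []) , sub , λ X X⊆ → sym (trans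
    (m≥n⇒m⊓n≡n (subst (λ m → m + r N (X ∩ E N) ≤ ∣ X ∣) (sym (∣⊥∣≡0 n))
      (≤-trans (IsSubcardinal.bounded sub (X ∩ E N) (p∩q⊆q X (E N))) (∣p∩q∣≤∣p∣ X (E N)))))
    (trans (cong (_+ r N (X ∩ E N)) (∣⊥∣≡0 n)) (ρ≡r N X⊆))))
  λ B e e∉B ih B∪e# →
    let (N′ , reach , E≡ , sub′ , rank) =
          ih (⊆-by (s₀ ∩′ (s₁ ∪′ s₂) ⊑ ∅′ ∷ []) (s₀ ∩′ s₁) ∅′ (E N ∷ B ∷ ⁅ e ⁆ ∷ []) B∪e#)
        e∉E′ : e ∉ E N′
        e∉E′ = ⊆∅⇒∉ (⊆-by (s₀ ∩′ (s₁ ∪′ s₂) ⊑ ∅′ ∷ s₃ ⊑ s₀ ∪′ s₁ ∷ s₂ ∩′ s₁ ⊑ ∅′ ∷ []) (s₂ ∩′ s₃) ∅′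
          (E N ∷ B ∷ ⁅ e ⁆ ∷ E N′ ∷ []) B∪e# (⊆-reflexive E≡) (∉⇒⊆∅ e∉B))
    in freeCoext N′ e , transR reach (coextR e e∉E′) ,
       trans (cong (_∪ ⁅ e ⁆) E≡) (∪-assoc (E N) B ⁅ e ⁆) ,
       freeCoext-isSubcardinal sub′ e∉E′ ,
       λ X X⊆ → begin
         r (freeCoext N′ e) X
           ≡⟨ freeCoext-rank sub′ e∉E′ X X⊆ ⟩
         ∣ X ∣ ⊓ suc (r N′ (X ∩ E N′))
           ≡⟨ cong (λ m → ∣ X ∣ ⊓ suc m) (trans (rank (X ∩ E N′) (p∩q⊆q X (E N′)))
                (cong (λ Z → ∣ X ∩ E N′ ∣ ⊓ (∣ B ∣ + r N Z))
                  (≡-by (s₃ ∪′ s₂ ⊑ s₁ ∷ []) ((s₀ ∩′ s₁) ∩′ s₃) (s₀ ∩′ s₃) (X ∷ E N′ ∷ B ∷ E N ∷ [])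
                    (⊆-reflexive (sym E≡))))) ⟩
         ∣ X ∣ ⊓ (suc ∣ X ∩ E N′ ∣ ⊓ (suc ∣ B ∣ + r N (X ∩ E N)))
           ≡⟨ sym (⊓-assoc ∣ X ∣ (suc ∣ X ∩ E N′ ∣) _) ⟩
         ∣ X ∣ ⊓ suc ∣ X ∩ E N′ ∣ ⊓ (suc ∣ B ∣ + r N (X ∩ E N))
           ≡⟨ cong₂ (λ s t → s ⊓ (t + r N (X ∩ E N)))
                (m≤n⇒m⊓n≡m (≤-by (s₀ ⊑ s₁ ∪′ s₂ ∷ []) (∣ s₂ ∣′ ≼ con 1 ∷ []) ∣ s₀ ∣′ (con 1 ⊕ ∣ s₀ ∩′ s₁ ∣′)
                  (X ∷ E N′ ∷ ⁅ e ⁆ ∷ []) [] X⊆ (∣⁅⁆∣≤ e)))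
                (sym (∣∪⁅⁆∣ e∉B)) ⟩
         ∣ X ∣ ⊓ (∣ B ∪ ⁅ e ⁆ ∣ + r N (X ∩ E N)) ∎
  where open ≡-Reasoning

free-extensions : {N : Matroid n} → (∀ X → X ⊆ E N → r N X ≤ rk N) → ∀ S → E N ∩ S ⊆ ∅ →
  ∃ λ N′ → Reach N N′ × E N′ ≡ E N ∪ S ×
    (∀ X → X ⊆ E N′ → r N′ X ≡ (r N (X ∩ E N) + ∣ X ─ E N ∣) ⊓ rk N)
free-extensions {n} {N} ≤rk = subset-induction
  (λ S → E N ∩ S ⊆ ∅ → ∃ λ N′ → Reach N N′ × E N′ ≡ E N ∪ S ×
    (∀ X → X ⊆ E N′ → r N′ X ≡ (r N (X ∩ E N) + ∣ X ─ E N ∣) ⊓ rk N))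
  (λ _ → N , iso (Iso-refl N) , ≡-by [] s₀ (s₀ ∪′ ∅′) (E N ∷ []) , λ X X⊆ → sym (trans
    (cong₂ (λ s t → (s + t) ⊓ rk N) (ρ≡r N X⊆)
      (trans (cong ∣_∣ (≡-by (s₀ ⊑ s₁ ∷ []) (s₀ ─′ s₁) ∅′ (X ∷ E N ∷ []) X⊆)) (∣⊥∣≡0 n)))
    (trans (cong (_⊓ rk N) (+-identityʳ (r N X))) (m≤n⇒m⊓n≡m (≤rk X X⊆)))))
  λ S e e∉S ih S∪e# →
    let (N′ , reach , E≡ , rank) =
          ih (⊆-by (s₀ ∩′ (s₁ ∪′ s₂) ⊑ ∅′ ∷ []) (s₀ ∩′ s₁) ∅′ (E N ∷ S ∷ ⁅ e ⁆ ∷ []) S∪e#)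
        e# : ⁅ e ⁆ ∩ E N′ ⊆ ∅
        e# = ⊆-by (s₀ ∩′ (s₁ ∪′ s₂) ⊑ ∅′ ∷ s₃ ⊑ s₀ ∪′ s₁ ∷ s₂ ∩′ s₁ ⊑ ∅′ ∷ []) (s₂ ∩′ s₃) ∅′
          (E N ∷ S ∷ ⁅ e ⁆ ∷ E N′ ∷ []) S∪e# (⊆-reflexive E≡) (∉⇒⊆∅ e∉S)
        E⊆E′ : E N ⊆ E N′
        E⊆E′ = subst (E N ⊆_) (sym E≡) (p⊆p∪q S)
        rk′ : rk N′ ≡ rk N
        rk′ = trans (rank (E N′) (λ x → x)) (m≥n⇒m⊓n≡n (≤-trans
          (≤-reflexive (cong (r N) (≡-by (s₀ ⊑ s₁ ∷ []) s₀ (s₁ ∩′ s₀) (E N ∷ E N′ ∷ []) E⊆E′)))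
          (m≤m+n _ _)))
        rank-∩ : ∀ X → r N′ (X ∩ E N′) ≡ (r N (X ∩ E N) + ∣ X ∩ E N′ ─ E N ∣) ⊓ rk N
        rank-∩ = λ X → trans (rank (X ∩ E N′) (p∩q⊆q X (E N′)))
          (cong (λ Z → (r N Z + ∣ X ∩ E N′ ─ E N ∣) ⊓ rk N)
            (≡-by (s₂ ⊑ s₁ ∷ []) ((s₀ ∩′ s₁) ∩′ s₂) (s₀ ∩′ s₂) (X ∷ E N′ ∷ E N ∷ []) E⊆E′))
    in freeExt N′ e , transR reach (extR e (⊆∅⇒∉ e#)) ,
       trans (cong (_∪ ⁅ e ⁆) E≡) (∪-assoc (E N) S ⁅ e ⁆) ,
       λ X X⊆ → extended N′ e X X⊆ e# E⊆E′ rk′ (rank-∩ X) (e ∈? X)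
  where
  open ≡-Reasoning
  extended : ∀ N′ e X → X ⊆ E N′ ∪ ⁅ e ⁆ → ⁅ e ⁆ ∩ E N′ ⊆ ∅ → E N ⊆ E N′ → rk N′ ≡ rk N →
    r N′ (X ∩ E N′) ≡ (r N (X ∩ E N) + ∣ X ∩ E N′ ─ E N ∣) ⊓ rk N → Dec (e ∈ X) →
    r (freeExt N′ e) X ≡ (r N (X ∩ E N) + ∣ X ─ E N ∣) ⊓ rk N
  extended N′ e X X⊆ e# E⊆E′ rk′ rank (no e∉X) = trans (freeExt-∉ N′ e∉X) (trans rank
    (cong (λ Z → (r N (X ∩ E N) + ∣ Z ∣) ⊓ rk N)
      (≡-by (s₀ ⊑ s₁ ∪′ s₃ ∷ s₃ ∩′ s₀ ⊑ ∅′ ∷ []) (s₀ ∩′ s₁ ─′ s₂) (s₀ ─′ s₂)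
        (X ∷ E N′ ∷ E N ∷ ⁅ e ⁆ ∷ []) X⊆ (∉⇒⊆∅ e∉X))))
  extended N′ e X X⊆ e# E⊆E′ rk′ rank (yes e∈X) = begin
    r (freeExt N′ e) X                         ≡⟨ freeExt-∈ N′ e∈X ⟩
    suc (r N′ (X ∩ E N′)) ⊓ rk N′              ≡⟨ cong₂ (λ s t → suc s ⊓ t) rank rk′ ⟩
    suc a ⊓ suc (rk N) ⊓ rk N                  ≡⟨ ⊓-assoc (suc a) (suc (rk N)) (rk N) ⟩
    suc a ⊓ (suc (rk N) ⊓ rk N)                ≡⟨ cong (suc a ⊓_) (m≥n⇒m⊓n≡n (n≤1+n (rk N))) ⟩
    suc a ⊓ rk N                               ≡⟨ cong (_⊓ rk N) (≤-antisym
      (≤-by (s₃ ∩′ s₁ ⊑ ∅′ ∷ s₃ ⊑ s₀ ∷ s₂ ⊑ s₁ ∷ []) (con 1 ≼ ∣ s₃ ∣′ ∷ [])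
        (con 1 ⊕ (n₀ ⊕ ∣ s₀ ∩′ s₁ ─′ s₂ ∣′)) (n₀ ⊕ ∣ s₀ ─′ s₂ ∣′)
        (X ∷ E N′ ∷ E N ∷ ⁅ e ⁆ ∷ []) (r N (X ∩ E N) ∷ []) e# (⁅⁆⊆ e∈X) E⊆E′ (≤∣⁅⁆∣ e))
      (≤-by (s₀ ⊑ s₁ ∪′ s₃ ∷ []) (∣ s₃ ∣′ ≼ con 1 ∷ [])
        (n₀ ⊕ ∣ s₀ ─′ s₂ ∣′) (con 1 ⊕ (n₀ ⊕ ∣ s₀ ∩′ s₁ ─′ s₂ ∣′))
        (X ∷ E N′ ∷ E N ∷ ⁅ e ⁆ ∷ []) (r N (X ∩ E N) ∷ []) X⊆ (∣⁅⁆∣≤ e))) ⟩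
    (r N (X ∩ E N) + ∣ X ─ E N ∣) ⊓ rk N       ∎
    where
    a = r N (X ∩ E N) + ∣ X ∩ E N′ ─ E N ∣

-- Minors of Mₖ

bound-mono : {N : Matroid n} → IsMatroid N → ∀ B {X Y} → X ⊆ Y → bound N B X ≤ bound N B Y
bound-mono {N = N} isM B {X} {Y} X⊆Y =
  ≤-by (s₀ ⊑ s₁ ∷ []) (n₀ ≼ n₁ ∷ []) (n₀ ⊕ ∣ s₂ ∣′ ⊕ ∣ s₀ ─′ (s₃ ∪′ s₂) ∣′) (n₁ ⊕ ∣ s₂ ∣′ ⊕ ∣ s₁ ─′ (s₃ ∪′ s₂) ∣′)
    (X ∷ Y ∷ B ∷ E N ∷ []) (ρ N X ∷ ρ N Y ∷ []) X⊆Y (MatroidTheory.mono isM X⊆Y)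

IsMatroid⇒IsSubcardinal : {N : Matroid n} → IsMatroid N → IsSubcardinal N
IsMatroid⇒IsSubcardinal {N = N} isM = record
  { bounded  = IsMatroid.R1 isM
  ; spanning = λ X X⊆ → subst₂ (λ s t → s ≤ t + ∣ E N ─ X ∣) (ρ≡r N (λ x → x)) (ρ≡r N X⊆)
      (MatroidTheory.increase isM (E N) X)
  }

-- Coextending by `B` produces the cardinality term and the summand `|B|`; extending by `S` then
-- adds the outside elements to both terms and caps the result at the full rank.
free-lift : {N : Matroid n} → IsMatroid N → ∀ B S → E N ∩ B ⊆ ∅ → (E N ∪ B) ∩ S ⊆ ∅ →
  ∃ λ N′ → Reach N N′ × E N′ ≡ (E N ∪ B) ∪ S ×
    (∀ X → X ⊆ E N′ → r N′ X ≡ (∣ X ∣ ⊓ bound N B X) ⊓ (∣ B ∣ + rk N))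
free-lift {N = N} isM B S E∩B E∪B∩S =
  let (N₁ , reach₁ , E₁≡ , sub₁ , rank₁) = free-coextensions (IsMatroid⇒IsSubcardinal isM) B E∩B
      E₁⊆ = ⊆-reflexive E₁≡
      ⊆E₁ = ⊆-reflexive (sym E₁≡)
      rk₁ : rk N₁ ≡ ∣ B ∣ + rk N
      rk₁ = begin
        rk N₁                                    ≡⟨ rank₁ (E N₁) (λ x → x) ⟩
        ∣ E N₁ ∣ ⊓ (∣ B ∣ + r N (E N₁ ∩ E N))    ≡⟨ cong (λ Z → ∣ E N₁ ∣ ⊓ (∣ B ∣ + r N Z))
          (≡-by (s₀ ∪′ s₁ ⊑ s₂ ∷ []) (s₂ ∩′ s₀) s₀ (E N ∷ B ∷ E N₁ ∷ []) ⊆E₁) ⟩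
        ∣ E N₁ ∣ ⊓ (∣ B ∣ + rk N)                ≡⟨ m≥n⇒m⊓n≡n
          (≤-by (s₀ ∪′ s₁ ⊑ s₂ ∷ s₀ ∩′ s₁ ⊑ ∅′ ∷ []) (n₀ ≼ ∣ s₀ ∣′ ∷ []) (∣ s₁ ∣′ ⊕ n₀) ∣ s₂ ∣′
            (E N ∷ B ∷ E N₁ ∷ []) (rk N ∷ []) ⊆E₁ E∩B (IsMatroid.R1 isM (E N) (λ x → x))) ⟩
        ∣ B ∣ + rk N                             ∎
      (N₂ , reach₂ , E₂≡ , rank₂) = free-extensions
        (λ X X⊆ → subst₂ _≤_ (sym (rank₁ X X⊆)) (sym (rank₁ (E N₁) (λ x → x)))
          (⊓-mono-≤ (p⊆q⇒∣p∣≤∣q∣ X⊆) (+-monoʳ-≤ ∣ B ∣ (MatroidTheory.mono isM X⊆))))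
        S (⊆-by (s₀ ⊑ s₁ ∪′ s₂ ∷ (s₁ ∪′ s₂) ∩′ s₃ ⊑ ∅′ ∷ []) (s₀ ∩′ s₃) ∅′
            (E N₁ ∷ E N ∷ B ∷ S ∷ []) E₁⊆ E∪B∩S)
  in N₂ , transR reach₁ reach₂ , trans E₂≡ (cong (_∪ S) E₁≡) , λ X X⊆ → begin
    r N₂ X
      ≡⟨ rank₂ X X⊆ ⟩
    (r N₁ (X ∩ E N₁) + ∣ X ─ E N₁ ∣) ⊓ rk N₁
      ≡⟨ cong₂ (λ s t → (s + ∣ X ─ E N₁ ∣) ⊓ t) (rank₁ (X ∩ E N₁) (p∩q⊆q X (E N₁))) rk₁ ⟩
    (∣ X ∩ E N₁ ∣ ⊓ (∣ B ∣ + r N ((X ∩ E N₁) ∩ E N)) + ∣ X ─ E N₁ ∣) ⊓ (∣ B ∣ + rk N)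
      ≡⟨ cong (_⊓ (∣ B ∣ + rk N)) (+-distribʳ-⊓ ∣ X ─ E N₁ ∣ ∣ X ∩ E N₁ ∣ _) ⟩
    ((∣ X ∩ E N₁ ∣ + ∣ X ─ E N₁ ∣) ⊓ (∣ B ∣ + r N ((X ∩ E N₁) ∩ E N) + ∣ X ─ E N₁ ∣)) ⊓ (∣ B ∣ + rk N)
      ≡⟨ cong₂ (λ s t → (s ⊓ t) ⊓ (∣ B ∣ + rk N))
           (≤-antisym (≤-by [] [] (∣ s₀ ∩′ s₁ ∣′ ⊕ ∣ s₀ ─′ s₁ ∣′) ∣ s₀ ∣′ (X ∷ E N₁ ∷ []) [])
                      (≤-by [] [] ∣ s₀ ∣′ (∣ s₀ ∩′ s₁ ∣′ ⊕ ∣ s₀ ─′ s₁ ∣′) (X ∷ E N₁ ∷ []) []))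
           (cong₂ _+_ (trans (+-comm ∣ B ∣ _) (cong (λ Z → r N Z + ∣ B ∣)
               (≡-by (s₂ ∪′ s₃ ⊑ s₁ ∷ []) ((s₀ ∩′ s₁) ∩′ s₂) (s₀ ∩′ s₂) (X ∷ E N₁ ∷ E N ∷ B ∷ []) ⊆E₁)))
             (cong (λ Z → ∣ X ─ Z ∣) E₁≡)) ⟩
    (∣ X ∣ ⊓ bound N B X) ⊓ (∣ B ∣ + rk N) ∎
  where open ≡-Reasoning

module _ {k : ℕ} {N₁ N₂ M : Matroid n} {B₁ B₂ : Subset n} (Am : Amalgam k N₁ B₁ N₂ B₂ M) where
  open Amalgam Am

  -- M and the free lift of N₂ have the same rank on every set containing C.
  reach-from-second : ∀ {A C D} → Presented M A C D → k ≤ bound N₁ B₁ C → Reach N₂ A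
  reach-from-second {A} {C} {D} P k≤ = through
    (free-lift isM₂ B₂ (E M ─ (E N₂ ∪ B₂)) R₂B₂ (⊆-by [] (s₀ ∩′ (s₁ ─′ s₀)) ∅′ (E N₂ ∪ B₂ ∷ E M ∷ [])))
    where
    open Presented P renaming (E≡ to E≡A)
    agree : ∀ W → C ⊆ W → W ⊆ E M → (∣ W ∣ ⊓ bound N₂ B₂ W) ⊓ (∣ B₂ ∣ + rk N₂) ≡ ρ M W
    agree W C⊆W W⊆E = ≤-antisym (upper (attained W W⊆E))
      (⊓-glb (⊓-glb (MatroidTheory.bounded isM W) (ρ≤bound₂ W)) (subst (ρ M W ≤_) (sym size₂) (ρ≤k W)))
      where
      m⊓k≤k : ∀ m → m ⊓ (∣ B₂ ∣ + rk N₂) ≤ k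
      m⊓k≤k m = ≤-trans (m⊓n≤n m _) (≤-reflexive size₂)
      upper : ∣ W ∣ ≤ ρ M W ⊎ k ≤ ρ M W ⊎ bound N₁ B₁ W ≤ ρ M W ⊎ bound N₂ B₂ W ≤ ρ M W →
              (∣ W ∣ ⊓ bound N₂ B₂ W) ⊓ (∣ B₂ ∣ + rk N₂) ≤ ρ M W
      upper (inj₁ le)               = ≤-trans (≤-trans (m⊓n≤m _ _) (m⊓n≤m _ _)) le
      upper (inj₂ (inj₁ le))        = ≤-trans (m⊓k≤k _) le
      upper (inj₂ (inj₂ (inj₁ le))) = ≤-trans (m⊓k≤k _) (≤-trans k≤ (≤-trans (bound-mono isM₁ B₁ C⊆W) le))
      upper (inj₂ (inj₂ (inj₂ le))) = ≤-trans (≤-trans (m⊓n≤m _ _) (m⊓n≤n _ _)) le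
    same : ∀ M′ → E M′ ≡ E M →
           (∀ X → X ⊆ E M′ → r M′ X ≡ (∣ X ∣ ⊓ bound N₂ B₂ X) ⊓ (∣ B₂ ∣ + rk N₂)) →
           ∀ X → X ⊆ (E M ─ C) ─ D → r (minor M′ C D) X ≡ r A X
    same M′ E≡ rank′ X X⊆ = begin
      r M′ ((X ∩ ((E M′ ─ C) ─ D)) ∪ C) ∸ r M′ C
        ≡⟨ cong (λ Z → r M′ (Z ∪ C) ∸ r M′ C) (trans (cong (λ G → X ∩ ((G ─ C) ─ D)) E≡)
             (≡-by (s₀ ⊑ s₁ ∷ []) (s₀ ∩′ s₁) s₀ (X ∷ ((E M ─ C) ─ D) ∷ []) X⊆)) ⟩
      r M′ (X ∪ C) ∸ r M′ C
        ≡⟨ cong₂ _∸_ (lifted (X ∪ C) (q⊆p∪q X C)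
             (⊆-by (s₀ ⊑ (s₂ ─′ s₁) ─′ s₃ ∷ s₁ ⊑ s₂ ∷ []) (s₀ ∪′ s₁) s₂ (X ∷ C ∷ E M ∷ D ∷ []) X⊆ C⊆E))
             (lifted C (λ x → x) C⊆E) ⟩
      ρ M (X ∪ C) ∸ ρ M C
        ≡⟨ cong (_∸ ρ M C) (sym (rank X (subst (X ⊆_) (sym E≡A) X⊆))) ⟩
      (r A X + ρ M C) ∸ ρ M C
        ≡⟨ m+n∸n≡m (r A X) (ρ M C) ⟩
      r A X ∎
      where
      open ≡-Reasoning
      lifted : ∀ W → C ⊆ W → W ⊆ E M → r M′ W ≡ ρ M W
      lifted W C⊆W W⊆E = trans (rank′ W (subst (W ⊆_) (sym E≡) W⊆E)) (agree W C⊆W W⊆E)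

    through : (∃ λ M′ → Reach N₂ M′ × E M′ ≡ (E N₂ ∪ B₂) ∪ (E M ─ (E N₂ ∪ B₂)) ×
                (∀ X → X ⊆ E M′ → r M′ X ≡ (∣ X ∣ ⊓ bound N₂ B₂ X) ⊓ (∣ B₂ ∣ + rk N₂))) → Reach N₂ A
    through (M′ , reach , E′≡ , rank′) = transR reach (transR
      (minorR C D (subst (C ⊆_) (sym E≡) C⊆E , subst (D ⊆_) (sym E≡) D⊆E , λ (_ , x∈) → ∉⊥ (C∩D x∈)))
      (iso (Iso-relabel (minor M′ C D) A (trans (cong (λ G → (G ─ C) ─ D) E≡) (sym E≡A))
        λ X X⊆ → same M′ E≡ rank′ X (subst (λ G → X ⊆ (G ─ C) ─ D) E≡ X⊆))))
      where
      E≡ : E M′ ≡ E M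
      E≡ = trans E′≡ (≡-by (s₁ ⊑ s₀ ∷ s₂ ⊑ s₀ ∷ []) ((s₁ ∪′ s₂) ∪′ (s₀ ─′ (s₁ ∪′ s₂))) s₀
        (E M ∷ E N₂ ∷ B₂ ∷ []) R₂⊆E B₂⊆E)

  -- Contract `B₁` and delete everything outside `E N₁ ∪ B₁`. On `X ∪ B₁` with `X ⊆ E N₁` the first
  -- bound equals `r N₁ X + |B₁|`; the other values in the minimum are no smaller, the second bound
  -- because of `free₁`.
  hasMinor₁ : HasMinor M N₁
  hasMinor₁ = B₁ , D , (B₁⊆E , p─q⊆p (E M) _ , λ (_ , x∈) → ∉⊥ (B∩D x∈)) ,
    Iso-relabel N₁ (minor M B₁ D)
      (≡-by (s₁ ⊑ s₀ ∷ s₂ ⊑ s₀ ∷ s₁ ∩′ s₂ ⊑ ∅′ ∷ []) s₁ ((s₀ ─′ s₂) ─′ (s₀ ─′ (s₁ ∪′ s₂)))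
        (E M ∷ E N₁ ∷ B₁ ∷ []) R₁⊆E B₁⊆E R₁B₁)
      λ X X⊆ → begin
        r N₁ X
          ≡⟨ sym (trans (cong (_∸ ∣ B₁ ∣) (ρ-∪ X X⊆)) (m+n∸n≡m (r N₁ X) ∣ B₁ ∣)) ⟩
        ρ M (X ∪ B₁) ∸ ∣ B₁ ∣
          ≡⟨ cong₂ _∸_ (ρ≡r M (⊆-by (s₀ ⊑ s₃ ∷ s₃ ⊑ s₂ ∷ s₁ ⊑ s₂ ∷ []) (s₀ ∪′ s₁) s₂ (X ∷ B₁ ∷ E M ∷ E N₁ ∷ []) X⊆ R₁⊆E B₁⊆E))
               (sym (trans (sym (ρ≡r M B₁⊆E)) ρ-B₁)) ⟩
        r M (X ∪ B₁) ∸ r M B₁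
          ≡⟨ cong (λ Z → r M (Z ∪ B₁) ∸ r M B₁)
               (≡-by (s₀ ⊑ s₂ ∷ s₂ ⊑ s₃ ∷ s₂ ∩′ s₁ ⊑ ∅′ ∷ []) s₀ (s₀ ∩′ ((s₃ ─′ s₁) ─′ (s₃ ─′ (s₂ ∪′ s₁))))
                 (X ∷ B₁ ∷ E N₁ ∷ E M ∷ []) X⊆ R₁⊆E R₁B₁) ⟩
        r M ((X ∩ ((E M ─ B₁) ─ D)) ∪ B₁) ∸ r M B₁ ∎
    where
    open ≡-Reasoning
    D : Subset n
    D = E M ─ (E N₁ ∪ B₁)
    B∩D : B₁ ∩ D ⊆ ∅
    B∩D = ⊆-by [] (s₂ ∩′ (s₀ ─′ (s₁ ∪′ s₂))) ∅′ (E M ∷ E N₁ ∷ B₁ ∷ [])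
    ρ-∪ : ∀ X → X ⊆ E N₁ → ρ M (X ∪ B₁) ≡ r N₁ X + ∣ B₁ ∣
    ρ-∪ X X⊆ = ≤-antisym
      (≤-trans (ρ≤bound₁ (X ∪ B₁)) (≤-by (s₀ ⊑ s₁ ∷ []) (n₀ ≼ n₁ ∷ [])
        (n₀ ⊕ ∣ s₂ ∣′ ⊕ ∣ (s₀ ∪′ s₂) ─′ (s₁ ∪′ s₂) ∣′) (n₁ ⊕ ∣ s₂ ∣′)
        (X ∷ E N₁ ∷ B₁ ∷ []) (ρ N₁ (X ∪ B₁) ∷ r N₁ X ∷ []) X⊆
        (≤-reflexive (cong (r N₁) (≡-by (s₀ ⊑ s₁ ∷ s₁ ∩′ s₂ ⊑ ∅′ ∷ []) ((s₀ ∪′ s₂) ∩′ s₁) s₀ (X ∷ E N₁ ∷ B₁ ∷ []) X⊆ R₁B₁)))))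
      (lower (attained (X ∪ B₁) (⊆-by (s₀ ⊑ s₃ ∷ s₃ ⊑ s₂ ∷ s₁ ⊑ s₂ ∷ []) (s₀ ∪′ s₁) s₂ (X ∷ B₁ ∷ E M ∷ E N₁ ∷ []) X⊆ R₁⊆E B₁⊆E)))
      where
      ≤k : r N₁ X + ∣ B₁ ∣ ≤ k
      ≤k = lin (n₀ ≼ n₁ ∷ n₂ ⊕ n₁ ≼ n₃ ∷ []) (n₀ ⊕ n₂) n₃ (r N₁ X ∷ rk N₁ ∷ ∣ B₁ ∣ ∷ k ∷ [])
        (IsMatroid.R2 isM₁ X (E N₁) X⊆ (λ x → x) X⊆) (≤-reflexive size₁)
      lower : ∣ X ∪ B₁ ∣ ≤ ρ M (X ∪ B₁) ⊎ k ≤ ρ M (X ∪ B₁) ⊎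
              bound N₁ B₁ (X ∪ B₁) ≤ ρ M (X ∪ B₁) ⊎ bound N₂ B₂ (X ∪ B₁) ≤ ρ M (X ∪ B₁) →
              r N₁ X + ∣ B₁ ∣ ≤ ρ M (X ∪ B₁)
      lower (inj₁ le) = ≤-trans
        (≤-by (s₀ ⊑ s₁ ∷ s₁ ∩′ s₂ ⊑ ∅′ ∷ []) (n₀ ≼ ∣ s₀ ∣′ ∷ []) (n₀ ⊕ ∣ s₂ ∣′) ∣ s₀ ∪′ s₂ ∣′
          (X ∷ E N₁ ∷ B₁ ∷ []) (r N₁ X ∷ []) X⊆ R₁B₁ (IsMatroid.R1 isM₁ X X⊆)) le
      lower (inj₂ (inj₁ le)) = ≤-trans ≤k le
      lower (inj₂ (inj₂ (inj₁ le))) = ≤-trans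
        (≤-trans (+-monoˡ-≤ ∣ B₁ ∣ (subst (_≤ ρ N₁ (X ∪ B₁)) (ρ≡r N₁ X⊆) (MatroidTheory.mono isM₁ (p⊆p∪q B₁))))
          (m≤m+n _ _)) le
      lower (inj₂ (inj₂ (inj₂ le))) = ≤-trans ≤k (≤-trans free₁ (≤-trans (bound-mono isM₂ B₂ (q⊆p∪q X B₁)) le))
    ρ-B₁ : ρ M B₁ ≡ ∣ B₁ ∣
    ρ-B₁ = trans (cong (ρ M) (≡-by [] s₀ (∅′ ∪′ s₀) (B₁ ∷ []))) (trans (ρ-∪ ∅ (λ x∈ → ⊥-elim (∉⊥ x∈)))
      (cong (_+ ∣ B₁ ∣) (n≤0⇒n≡0 (≤-trans (IsMatroid.R1 isM₁ ∅ (λ x∈ → ⊥-elim (∉⊥ x∈))) (≤-reflexive (∣⊥∣≡0 n))))))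

  -- Suppose both bounds stay below `k`. As `|Bᵢ| = k − rk Nᵢ`, fewer than
  -- `rk Nᵢ − ρ Nᵢ C ≤ |E Nᵢ − C|` elements of `C` lie outside `E Nᵢ ∪ Bᵢ`. Disjointness of `B₁` and
  -- `B₂` puts each element of `C` outside `E N₁ ∪ E N₂` into one of these counts. Hence
  -- `|C| < |E N₁| + |E N₂|`, whereas `|C| = k − rk N₁ ≥ k − |E N₁|`.
  one-bound-fails : ∀ C → C ⊆ E M → ∣ C ∣ + rk N₁ ≡ k → ∣ E N₁ ∣ + ∣ E N₁ ∣ + ∣ E N₂ ∣ ≤ k →
                    k ≤ bound N₁ B₁ C ⊎ k ≤ bound N₂ B₂ C
  one-bound-fails C C⊆E size k-big with k ≤? bound N₁ B₁ C | k ≤? bound N₂ B₂ C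
  ... | yes le | _      = inj₁ le
  ... | no _   | yes le = inj₂ le
  ... | no gt₁ | no gt₂ = ⊥-elim (<-irrefl refl
    (≤-by (s₀ ⊑ s₁ ∪′ s₂ ∪′ s₃ ∪′ s₄ ∷ s₃ ∩′ s₄ ⊑ ∅′ ∷ [])
      (con 1 ⊕ (n₀ ⊕ ∣ s₃ ∣′ ⊕ ∣ s₀ ─′ (s₁ ∪′ s₃) ∣′) ≼ n₄ ∷
       con 1 ⊕ (n₁ ⊕ ∣ s₄ ∣′ ⊕ ∣ s₀ ─′ (s₂ ∪′ s₄) ∣′) ≼ n₄ ∷
       n₂ ≼ n₀ ⊕ ∣ s₁ ─′ s₀ ∣′ ∷ n₃ ≼ n₁ ⊕ ∣ s₂ ─′ s₀ ∣′ ∷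
       n₄ ≼ ∣ s₃ ∣′ ⊕ n₂ ∷ n₄ ≼ ∣ s₄ ∣′ ⊕ n₃ ∷ n₄ ≼ ∣ s₀ ∣′ ⊕ n₂ ∷ n₂ ≼ ∣ s₁ ∣′ ∷
       ∣ s₁ ∣′ ⊕ ∣ s₁ ∣′ ⊕ ∣ s₂ ∣′ ≼ n₄ ∷ [])
      (con 1 ⊕ n₄) n₄
      (C ∷ E N₁ ∷ E N₂ ∷ B₁ ∷ B₂ ∷ []) (ρ N₁ C ∷ ρ N₂ C ∷ rk N₁ ∷ rk N₂ ∷ k ∷ [])
      (⊆-trans C⊆E E⊆) B₁B₂
      (≰⇒> gt₁) (≰⇒> gt₂)
      (subst (_≤ ρ N₁ C + ∣ E N₁ ─ C ∣) (ρ≡r N₁ (λ x → x)) (MatroidTheory.increase isM₁ (E N₁) C))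
      (subst (_≤ ρ N₂ C + ∣ E N₂ ─ C ∣) (ρ≡r N₂ (λ x → x)) (MatroidTheory.increase isM₂ (E N₂) C))
      (≤-reflexive (sym size₁)) (≤-reflexive (sym size₂)) (≤-reflexive (sym size))
      (IsMatroid.R1 isM₁ (E N₁) (λ x → x)) k-big))

-- Cyclic flats of the dual

∣∣≤0⇒⊆∅ : ∣ X ∣ ≤ 0 → X ⊆ ∅
∣∣≤0⇒⊆∅ {X = X} le {x} x∈X = ⊥-elim (n≮0 (≤-trans
  (≤-by (s₁ ⊑ s₀ ∷ []) (con 1 ≼ ∣ s₁ ∣′ ∷ []) (con 1) ∣ s₀ ∣′ (X ∷ ⁅ x ⁆ ∷ []) [] (⁅⁆⊆ x∈X) (≤∣⁅⁆∣ x)) le))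

encode : Subset n → Fin (2 ^ n)
encode X = funToFin (λ i → if lookup X i then zero else suc zero)

encode-injective : encode X ≡ encode Y → X ≡ Y
encode-injective {X = X} {Y = Y} eq = ⊆-antisym (⊆-of X Y eq) (⊆-of Y X (sym eq))
  where
  side : Bool → Fin 2
  side s = if s then zero else suc zero
  side-injective : ∀ s t → s ≡ true → side s ≡ side t → t ≡ true
  side-injective true true _ _ = refl
  ⊆-of : ∀ X Y → encode X ≡ encode Y → X ⊆ Y
  ⊆-of X Y eq {x} x∈X = lookup⇒[]= x Y (side-injective (lookup X x) (lookup Y x) ([]=⇒lookup x∈X) (begin
    side (lookup X x)          ≡⟨ sym (finToFun-funToFin (λ i → side (lookup X i)) x) ⟩
    finToFun (encode X) x      ≡⟨ cong (λ c → finToFun c x) eq ⟩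
    finToFun (encode Y) x      ≡⟨ finToFun-funToFin (λ i → side (lookup Y i)) x ⟩
    side (lookup Y x)          ∎))
    where open ≡-Reasoning

-- An injective self-map of a finite set permutes it, so a potential that
-- never increases along it is constant and all the slack vanishes.
module Orbit (P : Subset n → Set) (g : Subset n → Subset n) (q slack : Subset n → ℕ)
             (closed : ∀ {F} → P F → P (g F))
             (injective : ∀ {F F′} → P F → P F′ → g F ≡ g F′ → F ≡ F′)
             (decrease : ∀ {F} → P F → q (g F) + slack F ≤ q F) where

  iter : ℕ → Subset n → Subset n
  iter zero    F = F
  iter (suc m) F = g (iter m F)

  iter-P : ∀ m {F} → P F → P (iter m F)
  iter-P zero    p = p
  iter-P (suc m) p = closed (iter-P m p)

  q-iter : ∀ m {F} → P F → q (iter m F) ≤ q F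
  q-iter zero    p = ≤-refl
  q-iter (suc m) p = ≤-trans (m+n≤o⇒m≤o _ (decrease (iter-P m p))) (q-iter m p)

  cancel : ∀ i d {F} → P F → iter i F ≡ iter (i + d) F → F ≡ iter d F
  cancel zero    d p eq = eq
  cancel (suc i) d p eq = cancel i d p (injective (iter-P i p) (iter-P (i + d) p) eq)

  periodic : ∀ {F} → P F → ∃ λ m → F ≡ iter (suc m) F
  periodic {F} p =
    let (i , j , i<j , eq) = pigeonhole (n<1+n (2 ^ n)) (λ i → encode (iter (toℕ i) F))
        (d , i+d) = m≤n⇒∃[o]m+o≡n i<j
    in d , cancel (toℕ i) (suc d) p (trans (encode-injective eq)
         (cong (λ m → iter m F) (sym (trans (+-suc (toℕ i) d) i+d))))

  -- `F₀` is the predecessor of `F` on its cycle. The potential cannot rise from `F` round to `F₀`,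
  -- so the last step back to `F` cannot lower it either.
  tight-preimage : ∀ {F} → P F → ∃ λ F₀ → P F₀ × g F₀ ≡ F × slack F₀ ≤ 0
  tight-preimage {F} p =
    let (m , eq) = periodic p
        F₀ = iter m F
        p₀ = iter-P m p
    in F₀ , p₀ , sym eq ,
       lin (n₀ ⊕ n₁ ≼ n₂ ∷ n₂ ≼ n₃ ∷ n₃ ≼ n₀ ∷ []) n₁ (con 0) (q (g F₀) ∷ slack F₀ ∷ q F₀ ∷ q F ∷ [])
         (decrease p₀) (q-iter m p) (≤-reflexive (cong q eq))

module _ {N : Matroid n} (isM : IsMatroid N) where
  open MatroidTheory isM

  ρ-dual : ∀ X → X ⊆ E N → r (dual N) X + rk N ≡ ∣ X ∣ + ρ N (E N ─ X)
  ρ-dual X X⊆ = trans (IsSubcardinal.dual-rank (IsMatroid⇒IsSubcardinal isM) X X⊆)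
    (cong (∣ X ∣ +_) (sym (ρ≡r N (p─q⊆p (E N) X))))

  private
    ρ≤rk : ∀ X → ρ N X ≤ rk N
    ρ≤rk X = subst (ρ N X ≤_) (ρ≡r N (λ x → x)) (ρ-mono-∩ (p∩q⊆q X (E N)))

  dual-isMatroid : IsMatroid (dual N)
  dual-isMatroid = record
    { R1 = λ X X⊆ → lin (n₀ ⊕ n₁ ≼ n₂ ⊕ n₃ ∷ n₃ ≼ n₁ ∷ []) n₀ n₂
        (r (dual N) X ∷ rk N ∷ ∣ X ∣ ∷ ρ N (E N ─ X) ∷ []) (≤-reflexive (ρ-dual X X⊆)) (ρ≤rk (E N ─ X))
    ; R2 = λ X Y X⊆ Y⊆ X⊆Y → ≤-by (s₀ ⊑ s₁ ∷ s₁ ⊑ s₂ ∷ [])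
        (n₀ ⊕ n₁ ≼ ∣ s₀ ∣′ ⊕ n₂ ∷ n₂ ≼ n₃ ⊕ ∣ (s₂ ─′ s₀) ─′ (s₂ ─′ s₁) ∣′ ∷ ∣ s₁ ∣′ ⊕ n₃ ≼ n₄ ⊕ n₁ ∷ [])
        n₀ n₄
        (X ∷ Y ∷ E N ∷ []) (r (dual N) X ∷ rk N ∷ ρ N (E N ─ X) ∷ ρ N (E N ─ Y) ∷ r (dual N) Y ∷ [])
        X⊆Y Y⊆ (≤-reflexive (ρ-dual X X⊆)) (increase (E N ─ X) (E N ─ Y)) (≤-reflexive (sym (ρ-dual Y Y⊆)))
    ; R3 = λ X Y X⊆ Y⊆ →
        let X∪Y⊆ = ⊆-by (s₀ ⊑ s₂ ∷ s₁ ⊑ s₂ ∷ []) (s₀ ∪′ s₁) s₂ (X ∷ Y ∷ E N ∷ []) X⊆ Y⊆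
            X∩Y⊆ : X ∩ Y ⊆ E N
            X∩Y⊆ = X⊆ ∘ p∩q⊆p X Y
        in ≤-by []
        (n₀ ⊕ n₄ ≼ ∣ s₀ ∪′ s₁ ∣′ ⊕ n₅ ∷ n₁ ⊕ n₄ ≼ ∣ s₀ ∩′ s₁ ∣′ ⊕ n₆ ∷
         ∣ s₀ ∣′ ⊕ n₇ ≼ n₂ ⊕ n₄ ∷ ∣ s₁ ∣′ ⊕ n₈ ≼ n₃ ⊕ n₄ ∷ n₆ ⊕ n₅ ≼ n₇ ⊕ n₈ ∷ []) (n₀ ⊕ n₁) (n₂ ⊕ n₃)
        (X ∷ Y ∷ [])
        (r (dual N) (X ∪ Y) ∷ r (dual N) (X ∩ Y) ∷ r (dual N) X ∷ r (dual N) Y ∷ rk N ∷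
         ρ N (E N ─ (X ∪ Y)) ∷ ρ N (E N ─ (X ∩ Y)) ∷ ρ N (E N ─ X) ∷ ρ N (E N ─ Y) ∷ [])
        (≤-reflexive (ρ-dual (X ∪ Y) X∪Y⊆)) (≤-reflexive (ρ-dual (X ∩ Y) X∩Y⊆))
        (≤-reflexive (sym (ρ-dual X X⊆))) (≤-reflexive (sym (ρ-dual Y Y⊆)))
        (submodular (E N ─ X) (E N ─ Y)
          (⊆-by [] (s₂ ─′ s₀ ∩′ s₁) ((s₂ ─′ s₀) ∪′ (s₂ ─′ s₁)) (X ∷ Y ∷ E N ∷ []))
          (⊆-by [] (s₂ ─′ (s₀ ∪′ s₁)) ((s₂ ─′ s₀) ∩′ (s₂ ─′ s₁)) (X ∷ Y ∷ E N ∷ [])))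
    }

  -- The dual rank formula exchanges the two conditions under complementation: an element is no
  -- coloop of `H` in the dual exactly when it raises the rank of `E N ─ H`.
  dual-cyclicFlat : ∀ {H} → CyclicFlat (dual N) H → CyclicFlat N (E N ─ H)
  dual-cyclicFlat {H} cf = cyclicFlat record
    { inGround = p─q⊆p (E N) H
    ; flat     = λ e e∈E e∉ →
        let e∈H = decidable-stable (e ∈? H) λ e∉H → e∉ (x∈p∧x∉q⇒x∈p─q e∈E e∉H)
        in ≤-by (s₁ ⊑ s₀ ∷ [])
          (n₀ ⊕ n₁ ≼ n₂ ⊕ n₁ ∷ ∣ s₀ ∣′ ⊕ n₃ ≼ n₀ ⊕ n₁ ∷ n₂ ⊕ n₁ ≼ ∣ s₀ ─′ s₁ ∣′ ⊕ n₄ ∷ con 1 ≼ ∣ s₁ ∣′ ∷ [])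
          (con 1 ⊕ n₃) n₄
          (H ∷ ⁅ e ⁆ ∷ []) (r (dual N) H ∷ rk N ∷ r (dual N) (H ─ ⁅ e ⁆) ∷ ρ N (E N ─ H) ∷ ρ N ((E N ─ H) ∪ ⁅ e ⁆) ∷ [])
          (⁅⁆⊆ e∈H)
          (+-monoˡ-≤ (rk N) (subst₂ _≤_ (ρ≡r (dual N) inGround) (ρ≡r (dual N) (inGround ∘ p─q⊆p H ⁅ e ⁆)) (cyclic e e∈H)))
          (≤-reflexive (sym (ρ-dual H inGround)))
          (≤-reflexive (trans (ρ-dual (H ─ ⁅ e ⁆) (inGround ∘ p─q⊆p H ⁅ e ⁆)) (cong (λ Z → ∣ H ─ ⁅ e ⁆ ∣ + ρ N Z)
            (≡-by (s₁ ⊑ s₂ ∷ []) (s₂ ─′ (s₀ ─′ s₁)) ((s₂ ─′ s₀) ∪′ s₁) (H ∷ ⁅ e ⁆ ∷ E N ∷ []) (⁅⁆⊆ e∈E)))))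
          (≤∣⁅⁆∣ e)
    ; cyclic   = λ e e∈ →
        let e∈E = p─q⊆p (E N) H e∈
            e∉H = ⊆∅⇒∉ (⊆-by (s₂ ⊑ s₀ ─′ s₁ ∷ []) (s₂ ∩′ s₁) ∅′ (E N ∷ H ∷ ⁅ e ⁆ ∷ []) (⁅⁆⊆ e∈))
            H∪e⊆ = ⊆-by (s₀ ⊑ s₂ ∷ s₁ ⊑ s₂ ∷ []) (s₀ ∪′ s₁) s₂ (H ∷ ⁅ e ⁆ ∷ E N ∷ []) inGround (⁅⁆⊆ e∈E)
        in ≤-by []
          (con 1 ⊕ n₀ ≼ n₂ ∷ ∣ s₀ ∣′ ⊕ n₃ ≼ n₀ ⊕ n₁ ∷ n₂ ⊕ n₁ ≼ ∣ s₀ ∪′ s₁ ∣′ ⊕ n₄ ∷ ∣ s₁ ∣′ ≼ con 1 ∷ []) n₃ n₄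
          (H ∷ ⁅ e ⁆ ∷ []) (r (dual N) H ∷ rk N ∷ r (dual N) (H ∪ ⁅ e ⁆) ∷ ρ N (E N ─ H) ∷ ρ N ((E N ─ H) ─ ⁅ e ⁆) ∷ [])
          (subst₂ _<_ (ρ≡r (dual N) inGround) (ρ≡r (dual N) H∪e⊆) (flat e e∈E e∉H))
          (≤-reflexive (sym (ρ-dual H inGround)))
          (≤-reflexive (trans (ρ-dual (H ∪ ⁅ e ⁆) H∪e⊆) (cong (λ Z → ∣ H ∪ ⁅ e ⁆ ∣ + ρ N Z)
            (≡-by [] (s₂ ─′ (s₀ ∪′ s₁)) ((s₂ ─′ s₀) ─′ s₁) (H ∷ ⁅ e ⁆ ∷ E N ∷ [])))))
          (∣⁅⁆∣≤ e)
    }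
    where open RankCyclicFlat (MatroidTheory.rankCyclicFlat dual-isMatroid cf)

  FI-by-Z' : ∀ {e} → e ∈ E N → (∀ F → Z' N F → e ∉ F) → FI N e
  FI-by-Z' {e} e∈E h = e∈E , λ F cf F≢E e∈F → h F (cf , (e , e∈F) , F≢E) e∈F

  -- A proper cyclic flat of the dual through `e` would have as complement a nonempty proper cyclic
  -- flat of `N` that misses `e`.
  FI-dual-by-Z' : ∀ {e} → e ∈ E N → (∀ F → Z' N F → e ∈ F) → FI (dual N) e
  FI-dual-by-Z' {e} e∈E h = e∈E , λ H cf H≢E e∈H →
    let ∉E─H = ⊆∅⇒∉ {X = E N ─ H} (⊆-by (s₂ ⊑ s₁ ∷ []) (s₂ ∩′ (s₀ ─′ s₁)) ∅′ (E N ∷ H ∷ ⁅ e ⁆ ∷ []) (⁅⁆⊆ e∈H))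
    in ∉E─H (h (E N ─ H) (dual-cyclicFlat cf , nonempty H (proj₁ (proj₁ cf)) H≢E ,
         λ eq → ∉E─H (subst (e ∈_) (sym eq) e∈E)))
    where
    nonempty : ∀ H → H ⊆ E N → H ≢ E N → Nonempty (E N ─ H)
    nonempty H H⊆E H≢E with nonempty? (E N ─ H)
    ... | yes ne = ne
    ... | no ¬ne = ⊥-elim (H≢E (⊆-antisym H⊆E
      (⊆-by (s₀ ─′ s₁ ⊑ ∅′ ∷ []) s₀ s₁ (E N ∷ H ∷ []) (Empty⇒⊆∅ ¬ne))))

  -- Without nonempty proper cyclic flats every element lies in both FI sets.
  Z'-exists : ∀ {S : Subset n} → 0 < rk N → (∀ e → FI N e → e ∈ S) → (∀ e → e ∈ S → ¬ FI (dual N) e) →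
              ¬ (∀ F → ¬ Z' N F)
  Z'-exists pos FI⊆S S∩FI* none with nonempty? (E N)
  ... | yes (e , e∈E) = S∩FI* e (FI⊆S e (FI-by-Z' e∈E λ F z → ⊥-elim (none F z)))
                          (FI-dual-by-Z' e∈E λ F z → ⊥-elim (none F z))
  ... | no ¬ne = n≮0 (≤-trans pos (≤-trans (IsMatroid.R1 isM (E N) (λ x → x))
                   (≤-reflexive (trans (cong ∣_∣ (Empty-unique ¬ne)) (∣⊥∣≡0 n)))))

-- The self-map of the cyclic flats

module Core {k : ℕ} {N₁ N₂ M : Matroid n} {B₁ B₂ : Subset n} (Am : Amalgam k N₁ B₁ N₂ B₂ M)
            {A : Matroid n} {C D : Subset n} (P : Presented M A C D) (ι : Iso N₁ A)
            (C-ind : ∣ C ∣ ≤ ρ M C) (D-coind : ρ M (E M) ≤ ρ M (E M ─ D)) where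
  open Amalgam Am
  open Presented P renaming (E≡ to E≡A)
  open Image ι
  private
    module T = MatroidTheory isM
    module T₁ = MatroidTheory isM₁

  ρ-img : ∀ {X} → X ⊆ E N₁ → ρ N₁ X + ρ M C ≡ ρ M (img X ∪ C)
  ρ-img {X} X⊆ = trans (cong (_+ ρ M C) (trans (ρ≡r N₁ X⊆) (rank-img X⊆))) (rank (img X) (img⊆ X))

  ∣C∣≡ : ∣ C ∣ ≡ ρ M C
  ∣C∣≡ = ≤-antisym C-ind (T.bounded C)

  -- `C` together with the ground set of the minor is the complement of `D`, which spans because `D`
  -- is coindependent.
  C-size : ∣ C ∣ + rk N₁ ≡ k
  C-size = begin
    ∣ C ∣ + rk N₁            ≡⟨ cong₂ _+_ ∣C∣≡ (sym (ρ≡r N₁ (λ x → x))) ⟩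
    ρ M C + ρ N₁ (E N₁)      ≡⟨ +-comm (ρ M C) _ ⟩
    ρ N₁ (E N₁) + ρ M C      ≡⟨ ρ-img (λ x → x) ⟩
    ρ M (img (E N₁) ∪ C)     ≡⟨ cong (λ Z → ρ M (Z ∪ C)) (trans img-E E≡A) ⟩
    ρ M (((E M ─ C) ─ D) ∪ C) ≡⟨ cong (ρ M) (≡-by (s₁ ∩′ s₂ ⊑ ∅′ ∷ s₁ ⊑ s₀ ∷ []) (((s₀ ─′ s₁) ─′ s₂) ∪′ s₁) (s₀ ─′ s₂)
                                 (E M ∷ C ∷ D ∷ []) C∩D C⊆E) ⟩
    ρ M (E M ─ D)            ≡⟨ ≤-antisym (ρ≤k (E M ─ D))
                                 (subst (_≤ ρ M (E M ─ D)) rank-E D-coind) ⟩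
    k                        ∎
    where open ≡-Reasoning

  module Irrelevant (k≤ : k ≤ bound N₂ B₂ C) where

    ∣B₁∣≡∣C∣ : ∣ B₁ ∣ ≡ ∣ C ∣
    ∣B₁∣≡∣C∣ = +-cancelʳ-≡ (rk N₁) ∣ B₁ ∣ ∣ C ∣ (trans size₁ (sym C-size))

    g : Subset n → Subset n
    g F = T₁.cyc (img F ∪ C)

    G⊆ : E A ⊆ (E M ─ C) ─ D
    G⊆ = ⊆-reflexive E≡A

    module Step {F : Subset n} (z : Z' N₁ F) where
      open RankCyclicFlat (T₁.rankCyclicFlat (proj₁ z))

      Z K F′ : Subset n
      Z  = img F
      K  = T₁.cl (Z ∪ C)
      F′ = g F

      Z⊆ : Z ⊆ (E M ─ C) ─ D
      Z⊆ = ⊆-trans (img⊆ F) G⊆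

      F<∣F∣ : ρ N₁ F < ∣ F ∣
      F<∣F∣ = let (e , e∈F) = proj₁ (proj₂ z) in
        ≤-by (s₁ ⊑ s₀ ∷ []) (n₀ ≼ n₁ ∷ n₁ ≼ ∣ s₀ ─′ s₁ ∣′ ∷ con 1 ≼ ∣ s₁ ∣′ ∷ []) (con 1 ⊕ n₀) ∣ s₀ ∣′
          (F ∷ ⁅ e ⁆ ∷ []) (ρ N₁ F ∷ ρ N₁ (F ─ ⁅ e ⁆) ∷ []) (⁅⁆⊆ e∈F)
          (cyclic e e∈F) (T₁.bounded (F ─ ⁅ e ⁆)) (≤∣⁅⁆∣ e)

      F<rk : ρ N₁ F < rk N₁
      F<rk with any? (λ e → (e ∈? E N₁) ×-dec ¬? (e ∈? F))
      ... | yes (e , e∈E , e∉F) = ≤-trans (flat e e∈E e∉F)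
        (subst (ρ N₁ (F ∪ ⁅ e ⁆) ≤_) (ρ≡r N₁ (λ x → x)) (T₁.ρ-mono-∩ (p∩q⊆q (F ∪ ⁅ e ⁆) (E N₁))))
      ... | no ¬e = ⊥-elim (proj₂ (proj₂ z) (⊆-antisym inGround λ {x} x∈E →
        decidable-stable (x ∈? F) (λ x∉F → ¬e (x , x∈E , x∉F))))

      ρZ≡ : ρ N₁ F + ∣ C ∣ ≡ ρ M (Z ∪ C)
      ρZ≡ = trans (cong (ρ N₁ F +_) ∣C∣≡) (ρ-img inGround)

      Z<∣Z∣ : ρ M (Z ∪ C) < ∣ Z ∪ C ∣
      Z<∣Z∣ = ≤-by (s₂ ⊑ (s₃ ─′ s₁) ─′ s₄ ∷ []) (n₁ ≼ n₀ ⊕ ∣ s₁ ∣′ ∷ con 1 ⊕ n₀ ≼ ∣ s₀ ∣′ ∷ ∣ s₀ ∣′ ≼ ∣ s₂ ∣′ ∷ [])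
        (con 1 ⊕ n₁) ∣ s₂ ∪′ s₁ ∣′ (F ∷ C ∷ Z ∷ E M ∷ D ∷ []) (ρ N₁ F ∷ ρ M (Z ∪ C) ∷ []) Z⊆
        (≤-reflexive (sym ρZ≡)) F<∣F∣ (≤-reflexive (sym (∣img∣ F inGround)))

      Z<k : ρ M (Z ∪ C) < k
      Z<k = lin (n₁ ≼ n₀ ⊕ n₂ ∷ con 1 ⊕ n₀ ≼ n₃ ∷ n₂ ⊕ n₃ ≼ n₄ ∷ []) (con 1 ⊕ n₁) n₄
        (ρ N₁ F ∷ ρ M (Z ∪ C) ∷ ∣ C ∣ ∷ rk N₁ ∷ k ∷ []) (≤-reflexive (sym ρZ≡)) F<rk (≤-reflexive C-size)

      -- `Z ∪ C` is dependent and not spanning, because `F` is nonempty, cyclic and a proper flat.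
      -- With the second bound at least `k`, only the first can be attained.
      bound≤ : bound N₁ B₁ (Z ∪ C) ≤ ρ M (Z ∪ C)
      bound≤ with attained (Z ∪ C) (⊆-by (s₀ ⊑ (s₂ ─′ s₁) ─′ s₃ ∷ s₁ ⊑ s₂ ∷ []) (s₀ ∪′ s₁) s₂
                    (Z ∷ C ∷ E M ∷ D ∷ []) Z⊆ C⊆E)
      ... | inj₁ le               = ⊥-elim (<⇒≱ Z<∣Z∣ le)
      ... | inj₂ (inj₁ le)        = ⊥-elim (<⇒≱ Z<k le)
      ... | inj₂ (inj₂ (inj₁ le)) = le
      ... | inj₂ (inj₂ (inj₂ le)) = ⊥-elim (<⇒≱ Z<k (≤-trans k≤ (≤-trans (bound-mono isM₂ B₂ (q⊆p∪q Z C)) le)))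

      -- Cyclicity of `F`, and in `add` its flatness, carried through the isomorphism. As `bound≤`
      -- makes the first bound exact at `Z ∪ C`, both become comparisons of that bound at
      -- neighbouring sets.
      remove : ∀ {y} → y ∈ Z → ρ M (Z ∪ C) ≤ bound N₁ B₁ ((Z ─ ⁅ y ⁆) ∪ C)
      remove {y} y∈Z = let y∈A = img⊆ F y∈Z ; e = φ⁻¹ y∈A in ≤-trans
        (subst₂ _≤_ (ρ-img inGround)
          (trans (ρ-img (inGround ∘ p─q⊆p F ⁅ e ⁆))
            (cong (λ W → ρ M (W ∪ C)) (trans (img-─ F ⁅ e ⁆) (cong (Z ─_) (img-⁅φ⁻¹⁆ y∈A)))))
          (+-monoˡ-≤ (ρ M C) (cyclic e (∈img⁻ y∈A y∈Z))))
        (ρ≤bound₁ ((Z ─ ⁅ y ⁆) ∪ C))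

      add : ∀ {y} → y ∈ E A → y ∉ Z → ρ M (Z ∪ C) < bound N₁ B₁ ((Z ∪ ⁅ y ⁆) ∪ C)
      add {y} y∈A y∉Z = let e = φ⁻¹ y∈A ; e∈E = φ⁻¹∈ y∈A in ≤-trans
        (subst₂ _<_ (ρ-img inGround)
          (trans (ρ-img (⊆-by (s₀ ⊑ s₂ ∷ s₁ ⊑ s₂ ∷ []) (s₀ ∪′ s₁) s₂ (F ∷ ⁅ e ⁆ ∷ E N₁ ∷ []) inGround (⁅⁆⊆ e∈E)))
            (cong (λ W → ρ M (W ∪ C)) (trans (img-∪ F ⁅ e ⁆) (cong (Z ∪_) (img-⁅φ⁻¹⁆ y∈A)))))
          (+-monoˡ-< (ρ M C) (flat e e∈E λ e∈F → y∉Z (∈img⁺ y∈A e∈F))))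
        (ρ≤bound₁ ((Z ∪ ⁅ y ⁆) ∪ C))

      -- An element outside `E N₁ ∪ B₁` is counted singly in the first bound, and removing it would
      -- lower the bound against `remove`.
      Z⊆R∪B : Z ⊆ E N₁ ∪ B₁
      Z⊆R∪B {y} y∈Z = decidable-stable (y ∈? E N₁ ∪ B₁) λ y∉ → <⇒≱
        (≤-by (s₁ ⊑ s₀ ∷ s₀ ⊑ (s₅ ─′ s₂) ─′ s₆ ∷ s₁ ∩′ (s₃ ∪′ s₄) ⊑ ∅′ ∷ []) (n₀ ≼ n₁ ∷ con 1 ≼ ∣ s₁ ∣′ ∷ [])
          (con 1 ⊕ (n₀ ⊕ ∣ s₄ ∣′ ⊕ ∣ ((s₀ ─′ s₁) ∪′ s₂) ─′ (s₃ ∪′ s₄) ∣′))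
          (n₁ ⊕ ∣ s₄ ∣′ ⊕ ∣ (s₀ ∪′ s₂) ─′ (s₃ ∪′ s₄) ∣′)
          (Z ∷ ⁅ y ⁆ ∷ C ∷ E N₁ ∷ B₁ ∷ E M ∷ D ∷ []) (ρ N₁ ((Z ─ ⁅ y ⁆) ∪ C) ∷ ρ N₁ (Z ∪ C) ∷ [])
          (⁅⁆⊆ y∈Z) Z⊆ (∉⇒⊆∅ y∉)
          (T₁.mono (⊆-by [] ((s₀ ─′ s₁) ∪′ s₂) (s₀ ∪′ s₂) (Z ∷ ⁅ y ⁆ ∷ C ∷ []))) (≤∣⁅⁆∣ y))
        (≤-trans bound≤ (remove y∈Z))

      -- Under these hypotheses adding `y` leaves the first bound unchanged, which `add` forbids for
      -- `y ∉ Z`. It applies to elements of `B₁` and of the closure `K`.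
      closed : ∀ {y} → y ∈ E A → y ∈ E N₁ ∪ B₁ → ρ N₁ ((Z ∪ ⁅ y ⁆) ∪ C) ≤ ρ N₁ (Z ∪ C) → y ∈ Z
      closed {y} y∈A y∈ le = decidable-stable (y ∈? Z) λ y∉Z → <⇒≱ (add y∈A y∉Z) (≤-trans
        (≤-by (s₁ ⊑ s₃ ∪′ s₄ ∷ []) (n₀ ≼ n₁ ∷ [])
          (n₀ ⊕ ∣ s₄ ∣′ ⊕ ∣ ((s₀ ∪′ s₁) ∪′ s₂) ─′ (s₃ ∪′ s₄) ∣′) (n₁ ⊕ ∣ s₄ ∣′ ⊕ ∣ (s₀ ∪′ s₂) ─′ (s₃ ∪′ s₄) ∣′)
          (Z ∷ ⁅ y ⁆ ∷ C ∷ E N₁ ∷ B₁ ∷ []) (ρ N₁ ((Z ∪ ⁅ y ⁆) ∪ C) ∷ ρ N₁ (Z ∪ C) ∷ []) (⁅⁆⊆ y∈) le)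
        bound≤)

      B∩G⊆Z : B₁ ∩ E A ⊆ Z
      B∩G⊆Z {y} y∈ = let (y∈B , y∈A) = x∈p∩q⁻ B₁ (E A) y∈ in
        closed y∈A (q⊆p∪q (E N₁) B₁ y∈B) (T₁.ρ-mono-∩
          (⊆-by (s₁ ⊑ s₄ ∷ s₃ ∩′ s₄ ⊑ ∅′ ∷ []) (((s₀ ∪′ s₁) ∪′ s₂) ∩′ s₃) (s₀ ∪′ s₂)
            (Z ∷ ⁅ y ⁆ ∷ C ∷ E N₁ ∷ B₁ ∷ []) (⁅⁆⊆ y∈B) R₁B₁))

      K∩G⊆Z : K ∩ E A ⊆ Z
      K∩G⊆Z {y} y∈ = let (y∈K , y∈A) = x∈p∩q⁻ K (E A) y∈
                         (y∈R , le) = ∈-comprehension⁻ (T₁.inClosure? (Z ∪ C)) y∈K in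
        closed y∈A (p⊆p∪q B₁ y∈R) (≤-trans
          (T₁.mono (⊆-by [] ((s₀ ∪′ s₁) ∪′ s₂) ((s₀ ∪′ s₂) ∪′ s₁) (Z ∷ ⁅ y ⁆ ∷ C ∷ []))) le)

      -- Removing such a `y` keeps the first bound, in which it is seen only through `ρ N₁`; so `y`
      -- is no coloop of `K` and survives in its cyclic part.
      Z∩R⊆F′ : Z ∩ E N₁ ⊆ F′
      Z∩R⊆F′ {y} y∈ = let (y∈Z , y∈R) = x∈p∩q⁻ Z (E N₁) y∈ in
        ∈-comprehension⁺ (T₁.nonColoop? K)
          ( T₁.⊆cl (Z ∪ C) (x∈p∩q⁺ (p⊆p∪q C y∈Z , y∈R))
          , ≤-trans (T₁.ρ-cl (Z ∪ C)) (≤-trans (≮⇒≥ λ lt → <⇒≱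
              (≤-by (s₁ ⊑ s₃ ∷ []) (con 1 ⊕ n₀ ≼ n₁ ∷ [])
                (con 1 ⊕ (n₀ ⊕ ∣ s₄ ∣′ ⊕ ∣ ((s₀ ─′ s₁) ∪′ s₂) ─′ (s₃ ∪′ s₄) ∣′))
                (n₁ ⊕ ∣ s₄ ∣′ ⊕ ∣ (s₀ ∪′ s₂) ─′ (s₃ ∪′ s₄) ∣′)
                (Z ∷ ⁅ y ⁆ ∷ C ∷ E N₁ ∷ B₁ ∷ []) (ρ N₁ ((Z ─ ⁅ y ⁆) ∪ C) ∷ ρ N₁ (Z ∪ C) ∷ []) (⁅⁆⊆ y∈R) lt)
              (≤-trans bound≤ (remove y∈Z)))
            (T₁.ρ-mono-∩ (⊆-by ((s₀ ∪′ s₂) ∩′ s₃ ⊑ s₄ ∷ s₁ ⊑ s₀ ∷ s₀ ⊑ (s₅ ─′ s₂) ─′ s₆ ∷ [])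
              (((s₀ ─′ s₁) ∪′ s₂) ∩′ s₃) (s₄ ─′ s₁) (Z ∷ ⁅ y ⁆ ∷ C ∷ E N₁ ∷ K ∷ E M ∷ D ∷ [])
              (T₁.⊆cl (Z ∪ C)) (⁅⁆⊆ y∈Z) Z⊆))))

      F′⊆K : F′ ⊆ K
      F′⊆K = T₁.cyclicPart⊆ K

      -- Recovers `Z` from `F′`, which is why `g` is injective.
      Z≡ : Z ≡ (F′ ∪ B₁) ∩ E A
      Z≡ = ⊆-antisym
        (⊆-by (s₀ ⊑ s₁ ∪′ s₂ ∷ s₀ ∩′ s₁ ⊑ s₃ ∷ s₀ ⊑ s₄ ∷ []) s₀ ((s₃ ∪′ s₂) ∩′ s₄)
          (Z ∷ E N₁ ∷ B₁ ∷ F′ ∷ E A ∷ []) Z⊆R∪B Z∩R⊆F′ (img⊆ F))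
        (⊆-by (s₁ ∩′ s₂ ⊑ s₀ ∷ s₃ ∩′ s₂ ⊑ s₀ ∷ s₄ ⊑ s₃ ∷ []) ((s₄ ∪′ s₁) ∩′ s₂) s₀
          (Z ∷ B₁ ∷ E A ∷ K ∷ F′ ∷ []) B∩G⊆Z K∩G⊆Z F′⊆K)

      -- In `bound≤` the summand `|B₁|` cancels against the `|C|` in `ρZ≡`, since the two sizes
      -- agree; what is left over are the coloops `K ─ F′` and the part of `C` outside `E N₁ ∪ B₁`.
      rank-drop : ρ N₁ F′ + ∣ K ─ F′ ∣ + ∣ C ─ (E N₁ ∪ B₁) ∣ ≤ ρ N₁ F
      rank-drop = ≤-by [] (n₀ ⊕ ∣ s₃ ─′ s₄ ∣′ ≼ n₁ ∷ n₁ ⊕ ∣ s₂ ∣′ ⊕ ∣ (s₅ ∪′ s₀) ─′ (s₁ ∪′ s₂) ∣′ ≼ n₂ ∷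
          n₂ ≼ n₃ ⊕ ∣ s₀ ∣′ ∷ ∣ s₀ ∣′ ≼ ∣ s₂ ∣′ ∷ [])
        (n₀ ⊕ ∣ s₃ ─′ s₄ ∣′ ⊕ ∣ s₀ ─′ (s₁ ∪′ s₂) ∣′) n₃
        (C ∷ E N₁ ∷ B₁ ∷ K ∷ F′ ∷ Z ∷ []) (ρ N₁ F′ ∷ ρ N₁ (Z ∪ C) ∷ ρ M (Z ∪ C) ∷ ρ N₁ F ∷ [])
        (T₁.ρ-cyc (Z ∪ C)) bound≤ (≤-reflexive (sym ρZ≡)) (≤-reflexive (sym ∣B₁∣≡∣C∣))

      -- By `Z≡`, `Z` is what `F′` and `B₁` retain outside `C` and `D`. As `|B₁| = |C|`, the part of
      -- `C` in `B₁` cancels; the part in `E N₁` lies in `K`, so at most `|K ─ F′|` of it falls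
      -- outside `F′`.
      size-gain : ∣ Z ∣ + ∣ B₁ ∩ D ∣ + ∣ F′ ∩ D ∣ ≤ ∣ F′ ∣ + ∣ K ─ F′ ∣ + ∣ C ─ (E N₁ ∪ B₁) ∣
      size-gain = ≤-by
        (s₀ ⊑ (s₁ ∪′ s₂) ∩′ ((s₇ ─′ s₃) ─′ s₄) ∷ (s₀ ∪′ s₃) ∩′ s₆ ⊑ s₅ ∷
         s₁ ⊑ s₆ ∷ s₂ ⊑ s₇ ∷ s₃ ∩′ s₄ ⊑ ∅′ ∷ s₆ ∩′ s₂ ⊑ ∅′ ∷ [])
        (∣ s₂ ∣′ ≼ ∣ s₃ ∣′ ∷ [])
        (∣ s₀ ∣′ ⊕ ∣ s₂ ∩′ s₄ ∣′ ⊕ ∣ s₁ ∩′ s₄ ∣′)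
        (∣ s₁ ∣′ ⊕ ∣ s₅ ─′ s₁ ∣′ ⊕ ∣ s₃ ─′ (s₆ ∪′ s₂) ∣′)
        (Z ∷ F′ ∷ B₁ ∷ C ∷ D ∷ K ∷ E N₁ ∷ E M ∷ []) []
        (⊆-reflexive (trans Z≡ (cong ((F′ ∪ B₁) ∩_) E≡A))) (T₁.⊆cl (Z ∪ C))
        (T₁.cyc⊆E (Z ∪ C)) B₁⊆E C∩D R₁B₁ (≤-reflexive ∣B₁∣≡∣C∣)

      -- If `F′` were all of `E N₁` the first bound would reach `k`; if it were empty, the bound
      -- would reach `|Z ∪ C|`. Both exceed `ρ M (Z ∪ C)`.
      F′-Z' : Z' N₁ F′
      F′-Z' = T₁.cyc-cyclicFlat (Z ∪ C) , nonempty , λ F′≡E → <⇒≱ Z<k (≤-trans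
        (lin (n₀ ≼ n₁ ∷ n₁ ≼ n₂ ∷ n₃ ≼ n₄ ⊕ n₀ ∷ []) n₃ (n₂ ⊕ n₄ ⊕ n₅)
          (rk N₁ ∷ ρ N₁ F′ ∷ ρ N₁ (Z ∪ C) ∷ k ∷ ∣ B₁ ∣ ∷ ∣ (Z ∪ C) ─ (E N₁ ∪ B₁) ∣ ∷ [])
          (≤-reflexive (sym (trans (cong (ρ N₁) F′≡E) (ρ≡r N₁ (λ x → x)))))
          (m+n≤o⇒m≤o _ (T₁.ρ-cyc (Z ∪ C))) (≤-reflexive (sym size₁)))
        bound≤)
        where
        nonempty : Nonempty F′
        nonempty with nonempty? F′
        ... | yes ne = ne
        ... | no ¬ne = ⊥-elim (<⇒≱ Z<∣Z∣ (≤-trans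
          (≤-by (s₀ ∩′ s₁ ⊑ s₂ ∷ s₃ ⊑ ∅′ ∷ []) (n₀ ⊕ ∣ s₂ ─′ s₃ ∣′ ≼ n₁ ∷ [])
            ∣ s₀ ∣′ (n₁ ⊕ ∣ s₄ ∣′ ⊕ ∣ s₀ ─′ (s₁ ∪′ s₄) ∣′)
            (Z ∪ C ∷ E N₁ ∷ K ∷ F′ ∷ B₁ ∷ []) (ρ N₁ F′ ∷ ρ N₁ (Z ∪ C) ∷ [])
            (T₁.⊆cl (Z ∪ C)) (Empty⇒⊆∅ ¬ne) (T₁.ρ-cyc (Z ∪ C)))
          bound≤))

    -- Along g the rank drops and the nullity grows; this combination of
    -- the two absorbs all the error terms at once.
    potential : Subset n → ℕ
    potential F = ∣ E N₁ ─ F ∣ + ρ N₁ F + ρ N₁ F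

    slack : Subset n → ℕ
    slack F = ∣ T₁.cl (img F ∪ C) ─ g F ∣ + ∣ C ─ (E N₁ ∪ B₁) ∣ + ∣ B₁ ∩ D ∣ + ∣ g F ∩ D ∣

    decrease : ∀ {F} → Z' N₁ F → potential (g F) + slack F ≤ potential F
    decrease {F} z = ≤-by (s₁ ⊑ s₀ ∷ s₂ ⊑ s₀ ∷ [])
      -- The rank drop enters twice: one copy pays the error terms of the size gain, the other
      -- leaves them over as slack.
      (n₀ ⊕ n₁ ⊕ n₂ ≼ n₃ ∷ n₀ ⊕ n₁ ⊕ n₂ ≼ n₃ ∷ n₄ ⊕ n₅ ⊕ n₆ ≼ ∣ s₂ ∣′ ⊕ n₁ ⊕ n₂ ∷ ∣ s₁ ∣′ ≼ n₄ ∷ [])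
      (∣ s₀ ─′ s₂ ∣′ ⊕ n₀ ⊕ n₀ ⊕ (n₁ ⊕ n₂ ⊕ n₅ ⊕ n₆)) (∣ s₀ ─′ s₁ ∣′ ⊕ n₃ ⊕ n₃)
      (E N₁ ∷ F ∷ F′ ∷ [])
      (ρ N₁ F′ ∷ ∣ K ─ F′ ∣ ∷ ∣ C ─ (E N₁ ∪ B₁) ∣ ∷ ρ N₁ F ∷ ∣ Z ∣ ∷ ∣ B₁ ∩ D ∣ ∷ ∣ F′ ∩ D ∣ ∷ [])
      F⊆E (T₁.cyc⊆E (Z ∪ C))
      rank-drop rank-drop size-gain (≤-reflexive (sym (∣img∣ F F⊆E)))
      where
      open Step z
      F⊆E = proj₁ (proj₁ (proj₁ z))

    injective : ∀ {F F″} → Z' N₁ F → Z' N₁ F″ → g F ≡ g F″ → F ≡ F″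
    injective {F} {F″} z z″ eq = ⊆-antisym
      (img-injective (proj₁ (proj₁ (proj₁ z))) (⊆-reflexive img≡))
      (img-injective (proj₁ (proj₁ (proj₁ z″))) (⊆-reflexive (sym img≡)))
      where
      img≡ : img F ≡ img F″
      img≡ = trans (Step.Z≡ z) (trans (cong (λ W → (W ∪ B₁) ∩ E A) eq) (sym (Step.Z≡ z″)))

    open Orbit (Z' N₁) g potential slack (λ z → Step.F′-Z' z) injective decrease

    -- `F` is the image of a flat `F₀` whose slack vanishes, and the four summands vanish
    -- separately. The first of them makes `cl (img F₀ ∪ C)`, which contains `C ∩ E N₁`, collapse
    -- onto `F`.
    conclusions : ∀ F → Z' N₁ F → C ⊆ E N₁ ∪ B₁ × B₁ ∩ D ⊆ ∅ × C ∩ E N₁ ⊆ F × F ∩ D ⊆ ∅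
    conclusions F z = from-tight (tight-preimage z)
      where
      from-tight : (∃ λ F₀ → Z' N₁ F₀ × g F₀ ≡ F × slack F₀ ≤ 0) →
                   C ⊆ E N₁ ∪ B₁ × B₁ ∩ D ⊆ ∅ × C ∩ E N₁ ⊆ F × F ∩ D ⊆ ∅
      from-tight (F₀ , z₀ , gF₀≡F , tight) =
        ⊆-by (s₀ ─′ s₁ ⊑ ∅′ ∷ []) s₀ s₁ (C ∷ E N₁ ∪ B₁ ∷ []) (∣∣≤0⇒⊆∅ (lin zero-sum n₁ (con 0) nums tight)) ,
        ∣∣≤0⇒⊆∅ (lin zero-sum n₂ (con 0) nums tight) ,
        ⊆-by (s₃ ─′ s₄ ⊑ ∅′ ∷ (s₁ ∪′ s₀) ∩′ s₂ ⊑ s₃ ∷ s₄ ⊑ s₅ ∷ []) (s₀ ∩′ s₂) s₅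
          (C ∷ img F₀ ∷ E N₁ ∷ K₀ ∷ g F₀ ∷ F ∷ [])
          (∣∣≤0⇒⊆∅ (lin zero-sum n₀ (con 0) nums tight)) (T₁.⊆cl (img F₀ ∪ C)) (⊆-reflexive gF₀≡F) ,
        ⊆-by (s₀ ∩′ s₁ ⊑ ∅′ ∷ s₂ ⊑ s₀ ∷ []) (s₂ ∩′ s₁) ∅′ (g F₀ ∷ D ∷ F ∷ [])
          (∣∣≤0⇒⊆∅ (lin zero-sum n₃ (con 0) nums tight)) (⊆-reflexive (sym gF₀≡F))
        where
        K₀ : Subset n
        K₀ = T₁.cl (img F₀ ∪ C)
        zero-sum : List (NumHyp 0 4)
        zero-sum = n₀ ⊕ n₁ ⊕ n₂ ⊕ n₃ ≼ con 0 ∷ []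
        nums : Vec ℕ 4
        nums = ∣ K₀ ─ g F₀ ∣ ∷ ∣ C ─ (E N₁ ∪ B₁) ∣ ∷ ∣ B₁ ∩ D ∣ ∷ ∣ g F₀ ∩ D ∣ ∷ []

    -- The inclusions hold at every nonempty proper cyclic flat: `C ∩ E N₁` lies in all of them and
    -- `D` meets none. The given flat serves for the two conclusions that do not mention `F`.
    forced : (∃ λ F → Z' N₁ F) →
                (∀ e → e ∈ C → e ∈ B₁ ⊎ FI (dual N₁) e) × (∀ e → e ∈ D → e ∉ B₁ × (e ∈ E N₁ → FI N₁ e))
    forced (F , z) =
      (λ e e∈C → [ (λ e∈R → inj₂ (FI-dual-by-Z' isM₁ e∈R λ F′ z′ →
                     proj₁ (proj₂ (proj₂ (conclusions F′ z′))) (x∈p∩q⁺ (e∈C , e∈R))))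
                 , inj₁ ] (x∈p∪q⁻ (E N₁) B₁ (proj₁ (conclusions F z) e∈C))) ,
      (λ e e∈D →
        (λ e∈B → ∉⊥ (proj₁ (proj₂ (conclusions F z)) (x∈p∩q⁺ (e∈B , e∈D)))) ,
        (λ e∈R → FI-by-Z' isM₁ e∈R λ F′ z′ e∈F′ →
          ∉⊥ (proj₂ (proj₂ (proj₂ (conclusions F′ z′))) (x∈p∩q⁺ (e∈F′ , e∈D)))))

  confined : ¬ Reach N₂ N₁ → ∣ E N₁ ∣ + ∣ E N₁ ∣ + ∣ E N₂ ∣ ≤ k → (∃ λ F → Z' N₁ F) →
             (∀ e → e ∈ C → e ∈ B₁ ⊎ FI (dual N₁) e) ×
             (∀ e → e ∈ D → e ∉ B₁ × (e ∈ E N₁ → FI N₁ e))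
  confined unreachable k-big z = [
      (λ k≤ → ⊥-elim (unreachable (transR (reach-from-second Am P k≤) (iso (Iso-sym ι))))) ,
      (λ k≤ → Irrelevant.forced k≤ z) ]
    (one-bound-fails Am C C⊆E C-size k-big)

-- Confinement of prescribed elements, and minimality

module _ {k : ℕ} {N₁ N₂ M : Matroid n} {B₁ B₂ : Subset n} (Am : Amalgam k N₁ B₁ N₂ B₂ M) where
  open Amalgam Am

  Confined : Subset n → Subset n → Set
  Confined I J = (∀ e → e ∈ I → e ∈ B₁ ⊎ FI (dual N₁) e) ×
                 (∀ e → e ∈ J → e ∉ B₁ × (e ∈ E N₁ → FI N₁ e))

  -- Normalising may shift elements between contraction and deletion, so conclusions reach only the
  -- prescribed independent `I` and coindependent `J`. One of them will be a singleton and the other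
  -- empty.
  minor-confined : ∀ {C₀ D₀ I J} → ValidMinor M C₀ D₀ → HasMinor (minor M C₀ D₀) N₁ →
                   I ⊆ C₀ → ∣ I ∣ ≤ ρ M I → J ⊆ D₀ → ρ M (E M) ≤ ρ M (E M ─ J) →
                   ¬ Reach N₂ N₁ → ∣ E N₁ ∣ + ∣ E N₁ ∣ + ∣ E N₂ ∣ ≤ k → (∃ λ F → Z' N₁ F) →
                   Confined I J
  minor-confined {C₀} {D₀} {I} {J} v₀ (C , D , v , ι) I⊆ I-ind J⊆ J-coind unreachable k-big z =
    restrict (normalise isM I J (presented-minor isM (presented-minor isM (presented-self isM) v₀) v)
      (⊆-by (s₀ ⊑ s₁ ∷ []) s₀ ((∅′ ∪′ s₁) ∪′ s₂) (I ∷ C₀ ∷ C ∷ []) I⊆) I-ind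
      (⊆-by (s₀ ⊑ s₁ ∷ []) s₀ ((∅′ ∪′ s₁) ∪′ s₂) (J ∷ D₀ ∷ D ∷ []) J⊆) J-coind)
    where
    restrict : (∃ λ C′ → ∃ λ D′ → Presented M (minor (minor M C₀ D₀) C D) C′ D′ × I ⊆ C′ × J ⊆ D′ ×
                  ∣ C′ ∣ ≤ ρ M C′ × ρ M (E M) ≤ ρ M (E M ─ D′)) → Confined I J
    restrict (C′ , D′ , P , I⊆C′ , J⊆D′ , C′-ind , D′-coind) =
      let (contracted , deleted) = Core.confined Am P ι C′-ind D′-coind unreachable k-big z
      in (λ e e∈I → contracted e (I⊆C′ e∈I)) , (λ e e∈J → deleted e (J⊆D′ e∈J))

4*⊔⇒ : ∀ x y {k} → 4 * (x ⊔ y) ≤ k → x + x + y ≤ k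
4*⊔⇒ x y {k} le =
  lin (n₀ ≼ n₂ ∷ n₀ ≼ n₂ ∷ n₁ ≼ n₂ ∷ n₂ ⊕ (n₂ ⊕ (n₂ ⊕ (n₂ ⊕ con 0))) ≼ n₃ ∷ []) (n₀ ⊕ n₀ ⊕ n₁) n₃
    (x ∷ y ∷ x ⊔ y ∷ k ∷ []) (m≤m⊔n x y) (m≤m⊔n x y) (m≤n⊔m x y) le

theorem3p3 : ∀ {n : ℕ} (M₁ M₂ : Matroid n) (S'₁ S'₂ T₁ T₂ : Subset n) (k : ℕ) (M : Matroid n) →
    IsMatroid M₁ → IsMatroid M₂ →
    0 < rk M₁ → 0 < rk M₂ →
    Disjoint (E M₁) (E M₂) →
    ¬ Reach M₂ M₁ → ¬ Reach M₁ M₂ →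
    (∀ e → FI M₁ e → e ∈ S'₁) → S'₁ ⊆ E M₁ → (∀ e → e ∈ S'₁ → ¬ FI (dual M₁) e) →
    (∀ e → FI M₂ e → e ∈ S'₂) → S'₂ ⊆ E M₂ → (∀ e → e ∈ S'₂ → ¬ FI (dual M₂) e) →
    4 * (∣ E M₁ ∣ ⊔ ∣ E M₂ ∣) ≤ k →
    ∣ T₁ ∣ + rk M₁ + ∣ S'₂ ∣ ≡ k →
    ∣ T₂ ∣ + rk M₂ + ∣ S'₁ ∣ ≡ k →
    Disjoint T₁ T₂ → Disjoint T₁ (E M₁ ∪ E M₂) → Disjoint T₂ (E M₁ ∪ E M₂) →
    IsMk k M₁ S'₁ T₁ M₂ S'₂ T₂ M →
    Intertwine M M₁ M₂
theorem3p3 {n} M₁ M₂ S'₁ S'₂ T₁ T₂ k M matroid₁ matroid₂ pos₁ pos₂ _ unreachable₁ unreachable₂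
  FI⊆₁ _ ∩FI*₁ FI⊆₂ _ ∩FI*₂ k-big _ _ _ T₁# T₂# mk =
  hasMinor₁ Am , hasMinor₁ Am′ , λ C D v ne (m₁ , m₂) →
    -- The goal is absurdity, so flats may be drawn from existence statements that are only doubly
    -- negated.
    Z'-exists matroid₁ pos₁ FI⊆₁ ∩FI*₁ λ F₁ z₁ → Z'-exists matroid₂ pos₂ FI⊆₂ ∩FI*₂ λ F₂ z₂ →
      minimal C D v m₁ m₂ (F₁ , z₁) (F₂ , z₂) ne
  where
  Am = IsMk⇒Amalgam mk
  Am′ = Amalgam-sym Am
  open Amalgam Am

  ∉-disjoint : ∀ {e} {T R R′ : Subset n} → Disjoint T (R ∪ R′) → e ∈ T → e ∈ R ∪ R′ → ⊥
  ∉-disjoint T# e∈T e∈R = T# (_ , x∈p∩q⁺ (e∈T , e∈R))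

  not-contracted : ∀ {e} → e ∈ T₁ ∪ S'₂ ⊎ FI (dual M₁) e → e ∈ T₂ ∪ S'₁ ⊎ FI (dual M₂) e → ⊥
  not-contracted (inj₁ e∈B₁) (inj₁ e∈B₂) = ∉⊥ (B₁B₂ (x∈p∩q⁺ (e∈B₁ , e∈B₂)))
  not-contracted (inj₂ fi₁)  (inj₂ fi₂)  = ∉⊥ (R₁R₂ (x∈p∩q⁺ (proj₁ fi₁ , proj₁ fi₂)))
  not-contracted (inj₁ e∈B₁) (inj₂ fi₂) with x∈p∪q⁻ T₁ S'₂ e∈B₁
  ... | inj₁ e∈T = ∉-disjoint T₁# e∈T (q⊆p∪q (E M₁) (E M₂) (proj₁ fi₂))
  ... | inj₂ e∈S = ∩FI*₂ _ e∈S fi₂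
  not-contracted (inj₂ fi₁) (inj₁ e∈B₂) with x∈p∪q⁻ T₂ S'₁ e∈B₂
  ... | inj₁ e∈T = ∉-disjoint T₂# e∈T (p⊆p∪q (E M₂) (proj₁ fi₁))
  ... | inj₂ e∈S = ∩FI*₁ _ e∈S fi₁

  not-deleted : ∀ {e} → e ∈ E M → e ∉ T₁ ∪ S'₂ × (e ∈ E M₁ → FI M₁ e) →
                e ∉ T₂ ∪ S'₁ × (e ∈ E M₂ → FI M₂ e) → ⊥
  not-deleted e∈E (e∉B₁ , fi₁) (e∉B₂ , fi₂) with x∈p∪q⁻ (E M₁) _ (E⊆ e∈E)
  ... | inj₁ e∈R₁ = e∉B₂ (q⊆p∪q T₂ S'₁ (FI⊆₁ _ (fi₁ e∈R₁)))
  ... | inj₂ e∈ with x∈p∪q⁻ (E M₂) _ e∈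
  ...   | inj₁ e∈R₂ = e∉B₁ (q⊆p∪q T₁ S'₂ (FI⊆₂ _ (fi₂ e∈R₂)))
  ...   | inj₂ e∈B with x∈p∪q⁻ (T₁ ∪ S'₂) (T₂ ∪ S'₁) e∈B
  ...     | inj₁ e∈B₁ = e∉B₁ e∈B₁
  ...     | inj₂ e∈B₂ = e∉B₂ e∈B₂

  big₁ : ∣ E M₁ ∣ + ∣ E M₁ ∣ + ∣ E M₂ ∣ ≤ k
  big₁ = 4*⊔⇒ ∣ E M₁ ∣ ∣ E M₂ ∣ k-big

  big₂ : ∣ E M₂ ∣ + ∣ E M₂ ∣ + ∣ E M₁ ∣ ≤ k
  big₂ = 4*⊔⇒ ∣ E M₂ ∣ ∣ E M₁ ∣ (subst (λ x → 4 * x ≤ k) (⊔-comm ∣ E M₁ ∣ ∣ E M₂ ∣) k-big)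

  ∅-coind : ρ M (E M) ≤ ρ M (E M ─ ∅)
  ∅-coind = MatroidTheory.mono isM (⊆-by [] s₀ (s₀ ─′ ∅′) (E M ∷ []))

  minimal : ∀ C D → ValidMinor M C D → HasMinor (minor M C D) M₁ → HasMinor (minor M C D) M₂ →
            (∃ λ F → Z' M₁ F) → (∃ λ F → Z' M₂ F) → Nonempty (C ∪ D) → ⊥
  minimal C D v@(C⊆ , D⊆ , _) m₁ m₂ z₁ z₂ (e , e∈) with x∈p∪q⁻ C D e∈
  -- As `M` has no loops, `⁅ e ⁆` is independent, so both minors can be presented with `e`
  -- contracted; in the other case the absence of coloops keeps `e` deleted for both.
  ... | inj₁ e∈C = not-contracted
    (proj₁ (minor-confined Am v m₁ (⁅⁆⊆ e∈C) ind (⊥⊆ {p = D}) ∅-coind unreachable₁ big₁ z₁) e (x∈⁅x⁆ e))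
    (proj₁ (minor-confined Am′ v m₂ (⁅⁆⊆ e∈C) ind (⊥⊆ {p = D}) ∅-coind unreachable₂ big₂ z₂) e (x∈⁅x⁆ e))
    where
    ind : ∣ ⁅ e ⁆ ∣ ≤ ρ M ⁅ e ⁆
    ind = ≤-trans (∣⁅⁆∣≤ e) (loopless e (C⊆ e∈C))
  ... | inj₂ e∈D = not-deleted (D⊆ e∈D)
    (proj₂ (minor-confined Am v m₁ (⊥⊆ {p = C}) ∅-ind (⁅⁆⊆ e∈D) coind unreachable₁ big₁ z₁) e (x∈⁅x⁆ e))
    (proj₂ (minor-confined Am′ v m₂ (⊥⊆ {p = C}) ∅-ind (⁅⁆⊆ e∈D) coind unreachable₂ big₂ z₂) e (x∈⁅x⁆ e))
    where
    ∅-ind : ∣ ∅ {n} ∣ ≤ ρ M ∅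
    ∅-ind = subst (_≤ ρ M ∅) (sym (∣⊥∣≡0 n)) z≤n
    coind : ρ M (E M) ≤ ρ M (E M ─ ⁅ e ⁆)
    coind = subst (_≤ ρ M (E M ─ ⁅ e ⁆)) (sym rank-E) (coloopless e (D⊆ e∈D))
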